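{- Let $d+1=2^t$ for some integer $t\ge 2$. Then, for every $\epsilon>0$, there exists $n_0$ such that for every $n\ge n_0$ the following hold: 1. $\delta_d(S_{d+1,n})\ge \frac12-\epsilon$. 2. $\mathrm{Rej}_{d,d+1}(S_{d+1,n})\le \frac12-2^{ -7}+\epsilon$.
   Context: For positive integers $m\le n$, $S_{m,n}:\mathbb{F}_2^n\to\mathbb{F}_2$ is the elementary symmetric polynomial $S_{m,n}(x_1,\dots,x_n)=\sum_{I\subseteq[n],\,|I|=m}\prod_{i\in I}x_i$. Every function $f:\mathbb{F}_2^n\to\mathbb{F}_2$ is uniquely a multilinear polynomial over $\mathbb{F}_2$; $\deg f$ is its degree. $\delta_d(f)=\min\{\Pr_{x\in\mathbb{F}_2^n}[f(x)\ne g(x)] : g:\mathbb{F}_2^n\to\mathbb{F}_2,\ \deg g\le d\}$, with $x$ uniform. $\mathrm{Rej}_{d,k}(f)$ is the probability that $f|_A$ is not of degree at most $d$ when $A$ is a uniformly random $k$-dimensional affine subspace of $\mathbb{F}_2^n$ (the restriction is viewed as a function on $\mathbb{F}_2^k$ via any affine parametrization of $A$). -}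

module Defs where

open import Data.Bool using (Bool; true; false; _∧_; _xor_; T)
open import Data.Bool.Properties as Bool using (T?)
open import Data.Fin.Subset using (Subset; inside; outside; ∣_∣)
open import Data.Integer using (+_)
open import Data.List using (List; []; _∷_; _++_; map; filter; foldr; length; cartesianProduct; cartesianProductWith)
open import Data.List.Extrema.Nat using (max)
open import Data.List.Membership.Propositional using (_∈_; lose; find)
open import Data.List.Membership.Propositional.Properties using (∈-cartesianProduct⁺; ∈-cartesianProductWith⁺)
open import Data.List.Properties using (++-identityʳ)
open import Data.List.Relation.Unary.All as All using (all?)
open import Data.List.Relation.Unary.Any using (here; there; any?)
open import Data.Nat using (ℕ; zero; suc; _≟_; _≤_; _≤?_)
open import Data.Product using (∃; ∃!; _×_; _,_; proj₁; proj₂; uncurry)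
open import Data.Rational using (ℚ; 0ℚ; 1ℚ; _/_)
open import Data.Rational.Properties using (≤-decTotalOrder)
open import Data.Vec as Vec using (Vec; []; _∷_; zipWith; replicate)
open import Data.Vec.Properties using (≡-dec)
open import Function using (_∘_; _⇔_; mk⇔; module Equivalence)
open import Level using (Level)
open import Relation.Binary.PropositionalEquality using (_≡_; _≗_; refl; sym; trans; cong; cong₂; module ≡-Reasoning)
open import Relation.Binary using (DecTotalOrder)
open import Relation.Nullary using (Dec; ¬_; ¬?; _×-dec_; _→-dec_)
open import Relation.Nullary.Decidable using (map′)
open import Relation.Unary using (Pred; Decidable)

import Data.List.Extrema (DecTotalOrder.totalOrder ≤-decTotalOrder) as ℚ-Extrema

private
  variable
    a p : Level
    A B : Set a
    k n : ℕ

vectors : List A → ∀ n → List (Vec A n)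
vectors xs zero    = [] ∷ []
vectors xs (suc n) = cartesianProductWith _∷_ xs (vectors xs n)

∈-vectors : {xs : List A} → (∀ x → x ∈ xs) → (v : Vec A n) → v ∈ vectors xs n
∈-vectors complete []      = here refl
∈-vectors complete (x ∷ v) =
  ∈-cartesianProductWith⁺ _∷_ (complete x) (∈-vectors complete v)

decide-∀ : {xs : List A} → (∀ x → x ∈ xs) →
           {P : Pred A p} → Decidable P → Dec (∀ x → P x)
decide-∀ complete P? =
  map′ (λ all x → All.lookup all (complete x)) (λ h → All.tabulate (λ {x} _ → h x)) (all? P? _)

decide-∃ : {xs : List A} → (∀ x → x ∈ xs) →
           {P : Pred A p} → Decidable P → Dec (∃ P)
decide-∃ complete P? =
  map′ (λ any → let x , _ , px = find any in x , px)
       (λ (x , px) → lose (complete x) px)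
       (any? P? _)

_⇔-dec_ : Dec A → Dec B → Dec (A ⇔ B)
A? ⇔-dec B? =
  map′ (uncurry mk⇔) (λ e → Equivalence.to e , Equivalence.from e)
       ((A? →-dec B?) ×-dec (B? →-dec A?))

-- The probability of P at a uniformly random entry of the list, which is
-- used only for lists without repetition.  The empty list gets a junk value.
Pr : {P : Pred A p} → Decidable P → List A → ℚ
Pr P? []           = 0ℚ
Pr P? xs@(_ ∷ _)   = + length (filter P? xs) / length xs

𝔽₂ : Set
𝔽₂ = Bool

𝔽₂^ : ℕ → Set
𝔽₂^ n = Vec 𝔽₂ n

scalars : List 𝔽₂
scalars = false ∷ true ∷ []

∈-scalars : ∀ b → b ∈ scalars
∈-scalars false = here refl
∈-scalars true  = there (here refl)

-- Since Subset n is also Vec Bool n, this lists the subsets of [n] as well.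
points : ∀ n → List (𝔽₂^ n)
points = vectors scalars

∈-points : (x : 𝔽₂^ n) → x ∈ points n
∈-points = ∈-vectors ∈-scalars

glue : (𝔽₂^ n → 𝔽₂) → (𝔽₂^ n → 𝔽₂) → 𝔽₂^ (suc n) → 𝔽₂
glue g₀ g₁ (false ∷ x) = g₀ x
glue g₀ g₁ (true  ∷ x) = g₁ x

-- Each function appears exactly once, up to pointwise equality.
functions : ∀ n → List (𝔽₂^ n → 𝔽₂)
functions zero    = map (λ b _ → b) scalars
functions (suc n) = cartesianProductWith glue (functions n) (functions n)

Σ₂ : List A → (A → 𝔽₂) → 𝔽₂
Σ₂ xs f = foldr (λ x s → f x xor s) false xs

-- ∏_{i ∈ I} xᵢ
monomial : Subset n → 𝔽₂^ n → 𝔽₂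
monomial []            []      = true
monomial (inside  ∷ I) (b ∷ x) = b ∧ monomial I x
monomial (outside ∷ I) (b ∷ x) = monomial I x

S : ∀ m n → 𝔽₂^ n → 𝔽₂
S m n x = Σ₂ (filter (λ I → ∣ I ∣ ≟ m) (points n)) (λ I → monomial I x)

-- The multilinear polynomial whose coefficient at ∏_{i ∈ I} xᵢ is c I.
eval : (Subset n → 𝔽₂) → 𝔽₂^ n → 𝔽₂
eval c x = Σ₂ (points _) (λ I → c I ∧ monomial I x)

Σ₂-cong : ∀ (xs : List A) {f g} → f ≗ g → Σ₂ xs f ≡ Σ₂ xs g
Σ₂-cong []       f≗g = refl
Σ₂-cong (x ∷ xs) f≗g = cong₂ _xor_ (f≗g x) (Σ₂-cong xs f≗g)

Σ₂-++ : ∀ (xs ys : List A) f → Σ₂ (xs ++ ys) f ≡ Σ₂ xs f xor Σ₂ ys f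
Σ₂-++ []       ys f = refl
Σ₂-++ (x ∷ xs) ys f =
  trans (cong (f x xor_) (Σ₂-++ xs ys f)) (sym (Bool.xor-assoc (f x) _ _))

Σ₂-map : ∀ (h : A → B) xs f → Σ₂ (map h xs) f ≡ Σ₂ xs (f ∘ h)
Σ₂-map h []       f = refl
Σ₂-map h (x ∷ xs) f = cong (f (h x) xor_) (Σ₂-map h xs f)

Σ₂-false : ∀ (xs : List A) → Σ₂ xs (λ _ → false) ≡ false
Σ₂-false []       = refl
Σ₂-false (x ∷ xs) = Σ₂-false xs

Σ₂-∧ : ∀ b (xs : List A) f → Σ₂ xs (λ x → b ∧ f x) ≡ b ∧ Σ₂ xs f
Σ₂-∧ false xs f = Σ₂-false xs
Σ₂-∧ true  xs f = refl

∧-swap : ∀ a b c → a ∧ (b ∧ c) ≡ b ∧ (a ∧ c)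
∧-swap false false c = refl
∧-swap false true  c = refl
∧-swap true  b     c = refl

eval-∷ : ∀ (c : Subset (suc n) → 𝔽₂) b x →
         eval c (b ∷ x) ≡
         eval (c ∘ (outside ∷_)) x xor (b ∧ eval (c ∘ (inside ∷_)) x)
eval-∷ {n} c b x = begin
  Σ₂ (map (outside ∷_) Is ++ (map (inside ∷_) Is ++ [])) term
    ≡⟨ Σ₂-++ (map (outside ∷_) Is) _ term ⟩
  Σ₂ (map (outside ∷_) Is) term xor Σ₂ (map (inside ∷_) Is ++ []) term
    ≡⟨ cong₂ _xor_ (Σ₂-map (outside ∷_) Is term) right ⟩
  eval (c ∘ (outside ∷_)) x xor (b ∧ eval (c ∘ (inside ∷_)) x) ∎
  where
  open ≡-Reasoning
  Is = points n
  term : Subset (suc n) → 𝔽₂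
  term I = c I ∧ monomial I (b ∷ x)
  right : Σ₂ (map (inside ∷_) Is ++ []) term ≡ b ∧ eval (c ∘ (inside ∷_)) x
  right = begin
    Σ₂ (map (inside ∷_) Is ++ []) term
      ≡⟨ cong (λ l → Σ₂ l term) (++-identityʳ (map (inside ∷_) Is)) ⟩
    Σ₂ (map (inside ∷_) Is) term
      ≡⟨ Σ₂-map (inside ∷_) Is term ⟩
    Σ₂ Is (λ I → c (inside ∷ I) ∧ (b ∧ monomial I x))
      ≡⟨ Σ₂-cong Is (λ I → ∧-swap (c (inside ∷ I)) b (monomial I x)) ⟩
    Σ₂ Is (λ I → b ∧ (c (inside ∷ I) ∧ monomial I x))
      ≡⟨ Σ₂-∧ b Is _ ⟩
    b ∧ eval (c ∘ (inside ∷_)) x ∎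

xor-cancelˡ : ∀ a b → a xor (a xor b) ≡ b
xor-cancelˡ false b     = refl
xor-cancelˡ true  false = refl
xor-cancelˡ true  true  = refl

-- f(b, x) = f(0, x) + b · (f(0, x) + f(1, x))
multilinear : (f : 𝔽₂^ n → 𝔽₂) → ∃! _≗_ (λ c → eval c ≗ f)
multilinear {zero} f = (λ _ → f []) , represents , unique
  where
  represents : eval (λ _ → f []) ≗ f
  represents [] = trans (Bool.xor-identityʳ _) (Bool.∧-identityʳ _)
  unique : ∀ {c} → eval c ≗ f → (λ _ → f []) ≗ c
  unique h [] = trans (sym (h [])) (trans (Bool.xor-identityʳ _) (Bool.∧-identityʳ _))
multilinear {suc n} f = c , represents , unique
  where
  f₀ f₁ Δf : 𝔽₂^ n → 𝔽₂
  f₀ x = f (false ∷ x)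
  f₁ x = f (true ∷ x)
  Δf x = f₀ x xor f₁ x
  c : Subset (suc n) → 𝔽₂
  c (outside ∷ I) = proj₁ (multilinear f₀) I
  c (inside  ∷ I) = proj₁ (multilinear Δf) I
  represents : eval c ≗ f
  represents (false ∷ x) = trans (eval-∷ c false x)
    (trans (Bool.xor-identityʳ _) (proj₁ (proj₂ (multilinear f₀)) x))
  represents (true ∷ x) = trans (eval-∷ c true x)
    (trans (cong₂ _xor_ (proj₁ (proj₂ (multilinear f₀)) x) (proj₁ (proj₂ (multilinear Δf)) x))
           (xor-cancelˡ (f₀ x) (f₁ x)))
  unique : ∀ {c′} → eval c′ ≗ f → c ≗ c′
  unique {c′} h (outside ∷ I) = proj₂ (proj₂ (multilinear f₀)) {c′ ∘ (outside ∷_)} on-f₀ I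
    where
    on-f₀ : eval (c′ ∘ (outside ∷_)) ≗ f₀
    on-f₀ x = trans (sym (Bool.xor-identityʳ _)) (trans (sym (eval-∷ c′ false x)) (h _))
  unique {c′} h (inside ∷ I) = proj₂ (proj₂ (multilinear Δf)) {c′ ∘ (inside ∷_)} on-Δf I
    where
    on-Δf : eval (c′ ∘ (inside ∷_)) ≗ Δf
    on-Δf x = sym (begin
      f₀ x xor f₁ x
        ≡⟨ cong₂ _xor_ (h (false ∷ x)) (h (true ∷ x)) ⟨
      eval c′ (false ∷ x) xor eval c′ (true ∷ x)
        ≡⟨ cong₂ _xor_ (trans (eval-∷ c′ false x) (Bool.xor-identityʳ (eval (c′ ∘ (outside ∷_)) x))) (eval-∷ c′ true x) ⟩
      eval (c′ ∘ (outside ∷_)) x xor (eval (c′ ∘ (outside ∷_)) x xor eval (c′ ∘ (inside ∷_)) x)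
        ≡⟨ xor-cancelˡ (eval (c′ ∘ (outside ∷_)) x) _ ⟩
      eval (c′ ∘ (inside ∷_)) x ∎)
      where open ≡-Reasoning

coeff : (𝔽₂^ n → 𝔽₂) → Subset n → 𝔽₂
coeff f = proj₁ (multilinear f)

-- The zero function gets degree 0, which is as good as -∞ for the
-- conditions deg f ≤ d with d : ℕ.
deg : (𝔽₂^ n → 𝔽₂) → ℕ
deg {n} f = max 0 (map ∣_∣ (filter (λ I → T? (coeff f I)) (points n)))

distance : (f g : 𝔽₂^ n → 𝔽₂) → ℚ
distance {n} f g = Pr (λ x → ¬? (f x Bool.≟ g x)) (points n)

-- All distances are at most 1ℚ, and the list is nonempty because it contains
-- the distance to the zero function; so 1ℚ does not affect the minimum.
δ : ℕ → (𝔽₂^ n → 𝔽₂) → ℚ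
δ {n} d f =
  ℚ-Extrema.min 1ℚ (map (distance f) (filter (λ g → deg g ≤? d) (functions n)))

infixl 6 _⊕_

_⊕_ : 𝔽₂^ n → 𝔽₂^ n → 𝔽₂^ n
_⊕_ = zipWith _xor_

𝟎 : 𝔽₂^ n
𝟎 = replicate _ false

_·_ : 𝔽₂ → 𝔽₂^ n → 𝔽₂^ n
b · v = Vec.map (b ∧_) v

-- Σᵢ xᵢ vᵢ
combination : Vec (𝔽₂^ n) k → 𝔽₂^ k → 𝔽₂^ n
combination []       []      = 𝟎
combination (v ∷ vs) (b ∷ x) = (b · v) ⊕ combination vs x

LinearlyIndependent : Vec (𝔽₂^ n) k → Set
LinearlyIndependent vs = ∀ x → combination vs x ≡ 𝟎 → x ≡ 𝟎

-- A base point and k direction vectors.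
Frame : ℕ → ℕ → Set
Frame n k = 𝔽₂^ n × Vec (𝔽₂^ n) k

affine : Frame n k → 𝔽₂^ k → 𝔽₂^ n
affine (o , vs) x = o ⊕ combination vs x

Parametrizes : Frame n k → (𝔽₂^ n → Bool) → Set
Parametrizes φ@(o , vs) A =
  LinearlyIndependent vs × (∀ y → T (A y) ⇔ ∃ λ x → affine φ x ≡ y)

IsAffineSubspace : ℕ → (𝔽₂^ n → Bool) → Set
IsAffineSubspace {n} k A = ∃ λ (φ : Frame n k) → Parametrizes φ A

-- The restriction of f to A has degree > d.  Any two parametrizations of A
-- differ by an affine bijection of 𝔽₂ᵏ, which preserves the degree, so it
-- does not matter which one is used.
Rejects : ∀ (d k : ℕ) → (𝔽₂^ n → 𝔽₂) → (𝔽₂^ n → Bool) → Set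
Rejects {n} d k f A =
  ∃ λ (φ : Frame n k) → Parametrizes φ A × ¬ (deg (f ∘ affine φ) ≤ d)

∈-frames : (φ : Frame n k) → φ ∈ cartesianProduct (points n) (vectors (points n) k)
∈-frames (o , vs) = ∈-cartesianProduct⁺ (∈-points o) (∈-vectors ∈-points vs)

_≟ᵥ_ : (x y : 𝔽₂^ n) → Dec (x ≡ y)
_≟ᵥ_ = ≡-dec Bool._≟_

parametrizes? : (φ : Frame n k) (A : 𝔽₂^ n → Bool) → Dec (Parametrizes φ A)
parametrizes? φ@(o , vs) A =
  decide-∀ ∈-points (λ x → (combination vs x ≟ᵥ 𝟎) →-dec (x ≟ᵥ 𝟎))
  ×-dec
  decide-∀ ∈-points (λ y → T? (A y) ⇔-dec decide-∃ ∈-points (λ x → affine φ x ≟ᵥ y))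

isAffineSubspace? : ∀ k → Decidable (IsAffineSubspace {n} k)
isAffineSubspace? k A = decide-∃ ∈-frames (λ φ → parametrizes? φ A)

rejects? : ∀ d k (f : 𝔽₂^ n → 𝔽₂) → Decidable (Rejects d k f)
rejects? d k f A =
  decide-∃ ∈-frames (λ φ → parametrizes? φ A ×-dec ¬? (deg (f ∘ affine φ) ≤? d))

Rej : ∀ (d k : ℕ) → (𝔽₂^ n → 𝔽₂) → ℚ
Rej {n} d k f = Pr (rejects? d k f) (filter (isAffineSubspace? k) (functions n))

{-# OPTIONS --safe #-}

-- By Lucas, S_{2^t}(x) is the t-th binary digit of |x|: as a function of the
-- weight it changes sign under a shift by 2^t, and the sum of the signs of
-- such a function over the cube is exponentially small.  Let f have degree
-- less than 2^t.  Ramsey's theorem gives a large set of coordinates such that,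
-- however the others are fixed, the top-degree part of f becomes a multiple
-- of some S_r with r < 2^t.  That part depends only on |x| mod 2^t, so adding
-- it keeps the change of sign, and f can be replaced by a polynomial of
-- smaller degree.
--
-- Let k = d + 1.  The restriction of S_k to o + ⟨v₁, …, v_k⟩ has top
-- coefficient ω(v₁, …, v_k) = Σ_{|I| = k} det v_I (the Gram determinant), an
-- alternating multilinear form.  When v₄, …, v_k are fixed there is a vector h
-- such that the remaining trilinear form vanishes on the orthogonal complement
-- of h.  Hence its bias is at least 1/8 and ω = 1 with probability at most 7/16.
-- Tuples are almost surely linearly independent, and all affine subspaces have
-- equally many parametrizations, which leaves room below 1/2 - 2^-7.
module Submission where

open import Defs
open import Data.Bool using (Bool; true; false; not; _∧_; _xor_; T)
open import Data.Bool.Properties as Bool using (T?)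
open import Data.Bool.Solver using (module xor-∧-Solver)
open import Data.Fin.Subset using (Subset; inside; outside; ∣_∣)
open import Data.Integer as ℤ using (ℤ; +_; -1ℤ; 0ℤ; 1ℤ)
import Data.Integer.Properties as ℤ
import Data.Integer.Tactic.RingSolver as ℤRing
open import Data.List using (List; []; _∷_; _++_; _∷ʳ_; cartesianProduct; cartesianProductWith; filter; length; map)
open import Data.List.Extrema.Nat using (xs≤max; max≤v⁺)
import Data.List.Membership.DecPropositional as DecMembership
open import Data.List.Membership.Propositional using (_∈_)
open import Data.List.Membership.Propositional.Properties using (∈-∃++; ∈-filter⁺; ∈-filter⁻; ∈-map⁺; ∈-map⁻)
open import Data.List.Membership.Propositional.Properties.WithK using (unique∧set⇒bag)
open import Data.List.Properties using (++-identityʳ; ∷ʳ-++; length-map)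
open import Data.List.Relation.Binary.BagAndSetEquality using (∼bag⇒↭)
open import Data.List.Relation.Binary.Permutation.Propositional as ↭ using (_↭_; ↭-sym; refl; prep; swap)
open import Data.List.Relation.Binary.Permutation.Propositional.Properties using (¬x∷xs↭[]; All-resp-↭; map⁺; shift; ↭-length; ∈-resp-↭)
open import Data.List.Relation.Unary.All as All using (All; []; _∷_)
import Data.List.Relation.Unary.All.Properties as All
open import Data.List.Relation.Unary.AllPairs using ([]; _∷_)
open import Data.List.Relation.Unary.Any using (here; there)
open import Data.List.Relation.Unary.Unique.Propositional using (Unique)
import Data.List.Relation.Unary.Unique.Propositional.Properties as Unique
open import Data.Nat using (ℕ; zero; suc; _+_; _*_; _∸_; _^_; _≟_; _≤_; _≤?_; _<_; _<?_; z≤n; s≤s; s≤s⁻¹; NonZero; >-nonZero⁻¹)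
open import Data.Nat.Properties hiding (_≟_; _≤?_; _<?_)
open import Data.Nat.Tactic.RingSolver using (solve-∀)
open import Data.Product using (∃; ∃-syntax; _×_; _,_; proj₁; proj₂)
open import Data.Product.Properties using (,-injective)
open import Data.Rational as ℚ using (ℚ; mkℚ; 0ℚ; 1ℚ; ½; _/_; *≤*)
import Data.Rational.Properties as ℚ
open import Data.Rational.Unnormalised as ℚᵘ using (mkℚᵘ)
import Data.Rational.Unnormalised.Properties as ℚᵘ
open import Data.Sum using (_⊎_; inj₁; inj₂)
open import Data.Unit using (⊤; tt)
open import Data.Vec as Vec using (Vec; []; _∷_; head; replicate; tail; toList)
open import Data.Vec.Properties using (∷-injective; length-toList)
open import Function using (_∘_; _⇔_; mk⇔; module Equivalence)
open import Function.Definitions using (Injective)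
open import Level using (Level)
open import Relation.Binary using (DecTotalOrder; DecidableEquality)
open import Relation.Binary.PropositionalEquality using (_≡_; _≢_; _≗_; refl; sym; trans; cong; cong₂; subst; subst₂; module ≡-Reasoning)
open import Relation.Nullary using (Dec; does; yes; no; contradiction; ¬_; ¬?; _×-dec_; _→-dec_)
open import Relation.Nullary.Decidable using (dec-false; dec-true; does-⇔; map′)
open import Relation.Unary using (Pred; Decidable)

import Data.List.Extrema (DecTotalOrder.totalOrder ℚ.≤-decTotalOrder) as ℚ-Extrema

-- In the bound on `δ` the polynomial f is arbitrary and has no symmetry. Ramsey's theorem evens out
-- only its top coefficients, and only on some set of coordinates. That is enough: the sum over the
-- whole cube is an average of sums over the subcubes obtained by fixing the other coordinates, so
-- it suffices to bound each of these.
--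
-- In the bound on `Rej`, det² = det over F₂, so Cauchy-Binet turns the sum of the det v_I into the
-- determinant of the Gram matrix. If the Gram matrix of v₄, ..., v_k is nonsingular, v₁, v₂, v₃ may
-- be projected to the orthogonal complement of the others, and the Gram determinant of the three
-- projections splits off. Its diagonal entries ⟨x, x⟩ = ⟨1, x⟩ are linear in x. On the hyperplane
-- where they vanish the 3 × 3 matrix is alternating, and an alternating matrix of odd size is
-- singular. One vector would be too few: a linear form that vanishes on a hyperplane can still have
-- bias 0. With several variables each partial sum of characters is nonnegative, so leaving the
-- hyperplane costs only a factor 2 per variable.

private
  variable
    ℓa ℓb ℓp : Level
    A : Set ℓa
    B : Set ℓb
    k l m n : ℕ

-- Ramsey's theorem

data Thin : ℕ → ℕ → Set where
  done : Thin 0 0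
  keep : Thin m n → Thin (suc m) (suc n)
  drop : Thin m n → Thin m (suc n)

thin-∅ : ∀ n → Thin 0 n
thin-∅ zero    = done
thin-∅ (suc n) = drop (thin-∅ n)

thin-≤ : m ≤ n → Thin m n
thin-≤ z≤n       = thin-∅ _
thin-≤ (s≤s m≤n) = keep (thin-≤ m≤n)

_⨾_ : Thin l m → Thin m n → Thin l n
θ        ⨾ drop ψ = drop (θ ⨾ ψ)
done     ⨾ done   = done
keep θ   ⨾ keep ψ = keep (θ ⨾ ψ)
drop θ   ⨾ keep ψ = drop (θ ⨾ ψ)

embed : Thin m n → Subset m → Subset n
embed done     []      = []
embed (keep θ) (b ∷ I) = b ∷ embed θ I
embed (drop θ) I       = outside ∷ embed θ I

embed-⨾ : ∀ (θ : Thin l m) (ψ : Thin m n) I → embed (θ ⨾ ψ) I ≡ embed ψ (embed θ I)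
embed-⨾ θ        (drop ψ) I       = cong (outside ∷_) (embed-⨾ θ ψ I)
embed-⨾ done     done     []      = refl
embed-⨾ (keep θ) (keep ψ) (b ∷ I) = cong (b ∷_) (embed-⨾ θ ψ I)
embed-⨾ (drop θ) (keep ψ) I       = cong (outside ∷_) (embed-⨾ θ ψ I)

∣embed∣ : ∀ (θ : Thin m n) I → ∣ embed θ I ∣ ≡ ∣ I ∣
∣embed∣ done     []            = refl
∣embed∣ (keep θ) (inside  ∷ I) = cong suc (∣embed∣ θ I)
∣embed∣ (keep θ) (outside ∷ I) = ∣embed∣ θ I
∣embed∣ (drop θ) I             = ∣embed∣ θ I

Coloring : ℕ → Set
Coloring n = Subset n → Bool

Monochromatic : ℕ → Bool → Coloring n → Set
Monochromatic r b c = ∀ I → ∣ I ∣ ≡ r → c I ≡ b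

Ramsey : ℕ → Set
Ramsey r = ∀ m → ∃[ N ] ∀ n → N ≤ n → (c : Coloring n) →
           ∃[ θ ] ∃[ b ] Monochromatic {m} r b (c ∘ embed θ)

-- The colour of an (r + 1)-subset depends only on its least element.
Canonical : ℕ → Coloring n → Set
Canonical {zero}  r c = ⊤
Canonical {suc n} r c =
  (∃[ b ] Monochromatic r b (c ∘ (inside ∷_))) × Canonical r (c ∘ (outside ∷_))

Canonical-cong : ∀ r {c c′ : Coloring n} → c ≗ c′ → Canonical r c → Canonical r c′
Canonical-cong {zero}  r c≗c′ _ = tt
Canonical-cong {suc n} r c≗c′ ((b , mono) , can) =
  (b , λ I ∣I∣≡r → trans (sym (c≗c′ _)) (mono I ∣I∣≡r)) , Canonical-cong r (c≗c′ ∘ (outside ∷_)) can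

-- The first coordinate is kept. The colours of the sets that contain it form a colouring of r-sets,
-- which the hypothesis makes constant on a part of size `M` of the rest; `M` is large enough to
-- continue inside that part.
canonicalize : ∀ r → Ramsey r → ∀ m → ∃[ N ] ∀ n → N ≤ n → (c : Coloring n) →
               ∃[ θ ] Canonical {m} r (c ∘ embed θ)
canonicalize r ramsey zero = 0 , λ n _ c → thin-∅ n , tt
canonicalize r ramsey (suc m) = suc N , λ where
    (suc n) (s≤s N≤n) c →
      let θ , b , mono = large n N≤n (c ∘ (inside ∷_))
          ψ , can      = canon M ≤-refl (c ∘ (outside ∷_) ∘ embed θ)
      in keep (ψ ⨾ θ) ,
         (b , λ I ∣I∣≡r → trans (cong (c ∘ (inside ∷_)) (embed-⨾ ψ θ I))
                                (mono (embed ψ I) (trans (∣embed∣ ψ I) ∣I∣≡r))) ,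
         Canonical-cong r (λ I → cong (c ∘ (outside ∷_)) (sym (embed-⨾ ψ θ I))) can
  where
  M     = proj₁ (canonicalize r ramsey m)
  canon = proj₂ (canonicalize r ramsey m)
  N     = proj₁ (ramsey M)
  large = proj₂ (ramsey M)

-- Each coordinate votes for the colour of the sets whose least element it is; coordinates with the
-- same vote form a homogeneous set.
pigeonhole : ∀ r i j → i + j ≤ n → (c : Coloring n) → Canonical r c →
             (∃[ θ ] Monochromatic {i} (suc r) true  (c ∘ embed θ)) ⊎
             (∃[ θ ] Monochromatic {j} (suc r) false (c ∘ embed θ))
-- An empty set of coordinates has no subset of size `suc r`, so it is homogeneous in either colour.
pigeonhole {n} r zero j _ c _ = inj₁ (thin-∅ n , λ { [] () })
pigeonhole {n} r (suc i) zero _ c _ = inj₂ (thin-∅ n , λ { [] () })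
pigeonhole {suc n} r (suc i) (suc j) i+j≤n c ((true , mono) , can)
  with pigeonhole r i (suc j) (s≤s⁻¹ i+j≤n) (c ∘ (outside ∷_)) can
... | inj₁ (θ , h) = inj₁ (keep θ , λ where
        (inside  ∷ I) ∣I∣≡r → mono (embed θ I) (trans (∣embed∣ θ I) (suc-injective ∣I∣≡r))
        (outside ∷ I) ∣I∣≡r → h I ∣I∣≡r)
... | inj₂ (θ , h) = inj₂ (drop θ , h)
pigeonhole {suc n} r (suc i) (suc j) i+j≤n c ((false , mono) , can)
  with pigeonhole r (suc i) j (≤-trans (≤-reflexive (sym (+-suc i j))) (s≤s⁻¹ i+j≤n)) (c ∘ (outside ∷_)) can
... | inj₁ (θ , h) = inj₁ (drop θ , h)
... | inj₂ (θ , h) = inj₂ (keep θ , λ where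
        (inside  ∷ I) ∣I∣≡r → mono (embed θ I) (trans (∣embed∣ θ I) (suc-injective ∣I∣≡r))
        (outside ∷ I) ∣I∣≡r → h I ∣I∣≡r)

∣I∣≡0⇒same : ∀ (I J : Subset n) → ∣ I ∣ ≡ 0 → ∣ J ∣ ≡ 0 → I ≡ J
∣I∣≡0⇒same []            []            _ _ = refl
∣I∣≡0⇒same (outside ∷ I) (outside ∷ J) p q = cong (outside ∷_) (∣I∣≡0⇒same I J p q)

∣𝟎∣≡0 : ∀ n → ∣ 𝟎 {n} ∣ ≡ 0
∣𝟎∣≡0 zero    = refl
∣𝟎∣≡0 (suc n) = ∣𝟎∣≡0 n

ramsey : ∀ r → Ramsey r
ramsey zero m = m , λ n m≤n c → let θ = thin-≤ m≤n in
  θ , c (embed θ 𝟎) , λ I ∣I∣≡0 → cong (c ∘ embed θ) (∣I∣≡0⇒same I 𝟎 ∣I∣≡0 (∣𝟎∣≡0 m))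
ramsey (suc r) m = N , homogeneous
  where
  N     = proj₁ (canonicalize r (ramsey r) (m + m))
  canon = proj₂ (canonicalize r (ramsey r) (m + m))
  homogeneous : ∀ n → N ≤ n → (c : Coloring n) → ∃[ θ ] ∃[ b ] Monochromatic {m} (suc r) b (c ∘ embed θ)
  homogeneous n N≤n c with canon n N≤n c
  ... | ψ , can with pigeonhole r m m ≤-refl (c ∘ embed ψ) can
  ...   | inj₁ (θ , h) = θ ⨾ ψ , true  , λ I ∣I∣ → trans (cong c (embed-⨾ θ ψ I)) (h I ∣I∣)
  ...   | inj₂ (θ , h) = θ ⨾ ψ , false , λ I ∣I∣ → trans (cong c (embed-⨾ θ ψ I)) (h I ∣I∣)

-- Sums over the cube

_↾_ : (𝔽₂^ (suc n) → A) → 𝔽₂ → 𝔽₂^ n → A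
(F ↾ b) x = F (b ∷ x)

∫ : (𝔽₂^ n → ℤ) → ℤ
∫ {zero}  F = F []
∫ {suc n} F = ∫ (F ↾ false) ℤ.+ ∫ (F ↾ true)

∫-cong : {F G : 𝔽₂^ n → ℤ} → F ≗ G → ∫ F ≡ ∫ G
∫-cong {zero}  F≗G = F≗G []
∫-cong {suc n} F≗G = cong₂ ℤ._+_ (∫-cong (F≗G ∘ (false ∷_))) (∫-cong (F≗G ∘ (true ∷_)))

∫-+ : (F G : 𝔽₂^ n → ℤ) → ∫ (λ x → F x ℤ.+ G x) ≡ ∫ F ℤ.+ ∫ G
∫-+ {zero}  F G = refl
∫-+ {suc n} F G = trans (cong₂ ℤ._+_ (∫-+ (F ↾ false) (G ↾ false)) (∫-+ (F ↾ true) (G ↾ true)))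
                        (interchange (∫ (F ↾ false)) (∫ (G ↾ false)) (∫ (F ↾ true)) (∫ (G ↾ true)))
  where
  interchange : ∀ i j k l → (i ℤ.+ j) ℤ.+ (k ℤ.+ l) ≡ (i ℤ.+ k) ℤ.+ (j ℤ.+ l)
  interchange = ℤRing.solve-∀

∫-* : ∀ i (F : 𝔽₂^ n → ℤ) → ∫ (λ x → i ℤ.* F x) ≡ i ℤ.* ∫ F
∫-* {zero}  i F = refl
∫-* {suc n} i F = trans (cong₂ ℤ._+_ (∫-* i (F ↾ false)) (∫-* i (F ↾ true)))
                        (sym (ℤ.*-distribˡ-+ i (∫ (F ↾ false)) (∫ (F ↾ true))))

∫-abs : ∀ E B (F : 𝔽₂^ n → ℤ) → (∀ x → E * ℤ.∣ F x ∣ ≤ B) → E * ℤ.∣ ∫ F ∣ ≤ 2 ^ n * B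
∫-abs {zero}  E B F bound = ≤-trans (bound []) (≤-reflexive (sym (*-identityˡ B)))
∫-abs {suc n} E B F bound = begin
  E * ℤ.∣ ∫ F₀ ℤ.+ ∫ F₁ ∣               ≤⟨ *-monoʳ-≤ E (ℤ.∣i+j∣≤∣i∣+∣j∣ (∫ F₀) (∫ F₁)) ⟩
  E * (ℤ.∣ ∫ F₀ ∣ + ℤ.∣ ∫ F₁ ∣)         ≡⟨ *-distribˡ-+ E _ _ ⟩
  E * ℤ.∣ ∫ F₀ ∣ + E * ℤ.∣ ∫ F₁ ∣
    ≤⟨ +-mono-≤ (∫-abs E B F₀ (bound ∘ (false ∷_))) (∫-abs E B F₁ (bound ∘ (true ∷_))) ⟩
  2 ^ n * B + 2 ^ n * B                 ≡⟨ double (2 ^ n) B ⟩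
  2 ^ suc n * B                         ∎
  where
  open ≤-Reasoning
  F₀ = F ↾ false
  F₁ = F ↾ true
  double : ∀ N B → N * B + N * B ≡ 2 * N * B
  double = solve-∀

-- The coordinates in the image of θ are taken from the second vector, and
-- those of the first vector there are ignored.
merge : Thin m n → 𝔽₂^ n → 𝔽₂^ m → 𝔽₂^ n
merge done     []      []      = []
merge (keep θ) (_ ∷ s) (b ∷ x) = b ∷ merge θ s x
merge (drop θ) (b ∷ s) x       = b ∷ merge θ s x

-- Every point of the n-cube arises from `2 ^ m` values of `s`, because the coordinates of `s` in
-- the image of `θ` are overwritten.
∫-merge : ∀ (θ : Thin m n) (F : 𝔽₂^ n → ℤ) → ∫ (λ s → ∫ (F ∘ merge θ s)) ≡ + (2 ^ m) ℤ.* ∫ F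
∫-merge done F = sym (ℤ.*-identityˡ _)
∫-merge {suc m} {suc n} (keep θ) F = begin
  ∫ G ℤ.+ ∫ G                                    ≡⟨ cong (λ i → i ℤ.+ i) (∫-+ G₀ G₁) ⟩
  (∫ G₀ ℤ.+ ∫ G₁) ℤ.+ (∫ G₀ ℤ.+ ∫ G₁)
    ≡⟨ cong (λ i → i ℤ.+ i) (cong₂ ℤ._+_ (∫-merge θ F₀) (∫-merge θ F₁)) ⟩
  (M ℤ.* ∫ F₀ ℤ.+ M ℤ.* ∫ F₁) ℤ.+ (M ℤ.* ∫ F₀ ℤ.+ M ℤ.* ∫ F₁) ≡⟨ lemma M (∫ F₀) (∫ F₁) ⟩
  (+ 2 ℤ.* M) ℤ.* (∫ F₀ ℤ.+ ∫ F₁)                ≡⟨ cong (ℤ._* (∫ F₀ ℤ.+ ∫ F₁)) (ℤ.pos-* 2 (2 ^ m)) ⟨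
  + (2 ^ suc m) ℤ.* (∫ F₀ ℤ.+ ∫ F₁)              ∎
  where
  open ≡-Reasoning
  M = + (2 ^ m)
  F₀ = F ↾ false
  F₁ = F ↾ true
  G₀ G₁ G : 𝔽₂^ n → ℤ
  G₀ s = ∫ (F₀ ∘ merge θ s)
  G₁ s = ∫ (F₁ ∘ merge θ s)
  G  s = G₀ s ℤ.+ G₁ s
  lemma : ∀ M i j → (M ℤ.* i ℤ.+ M ℤ.* j) ℤ.+ (M ℤ.* i ℤ.+ M ℤ.* j) ≡ (+ 2 ℤ.* M) ℤ.* (i ℤ.+ j)
  lemma = ℤRing.solve-∀
∫-merge {m} (drop θ) F = trans (cong₂ ℤ._+_ (∫-merge θ (F ↾ false)) (∫-merge θ (F ↾ true)))
                               (sym (ℤ.*-distribˡ-+ (+ (2 ^ m)) (∫ (F ↾ false)) (∫ (F ↾ true))))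

-- Coefficients and symmetric polynomials

coeff-cong : {f g : 𝔽₂^ n → 𝔽₂} → f ≗ g → coeff f ≗ coeff g
coeff-cong {f = f} {g} f≗g =
  proj₂ (proj₂ (multilinear f)) (λ x → trans (proj₁ (proj₂ (multilinear g)) x) (sym (f≗g x)))

xor-interchange : ∀ a b c d → (a xor b) xor (c xor d) ≡ (a xor c) xor (b xor d)
xor-interchange = solve 4 (λ a b c d → (a :+ b) :+ (c :+ d) := (a :+ c) :+ (b :+ d)) refl
  where open xor-∧-Solver

coeff-xor : (f g : 𝔽₂^ n → 𝔽₂) → ∀ I → coeff (λ x → f x xor g x) I ≡ coeff f I xor coeff g I
coeff-xor f g []            = refl
coeff-xor f g (outside ∷ I) = coeff-xor (f ∘ (false ∷_)) (g ∘ (false ∷_)) I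
coeff-xor f g (inside ∷ I)  =
  trans (coeff-cong (λ x → xor-interchange (f (false ∷ x)) (g (false ∷ x)) (f (true ∷ x)) (g (true ∷ x))) I)
        (coeff-xor _ _ I)

coeff-false : ∀ I → coeff {n} (λ _ → false) I ≡ false
coeff-false []            = refl
coeff-false (outside ∷ I) = coeff-false I
coeff-false (inside  ∷ I) = coeff-false I

coeff-∧ : ∀ b (f : 𝔽₂^ n → 𝔽₂) I → coeff (λ x → b ∧ f x) I ≡ b ∧ coeff f I
coeff-∧ false f I = coeff-false I
coeff-∧ true  f I = refl

coeff≗false⇒≗false : (f : 𝔽₂^ n → 𝔽₂) → (∀ I → coeff f I ≡ false) → ∀ x → f x ≡ false
coeff≗false⇒≗false {n} f h x = begin
  f x                                              ≡⟨ proj₁ (proj₂ (multilinear f)) x ⟨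
  eval (coeff f) x                                 ≡⟨ Σ₂-cong (points n) (λ I → cong (_∧ monomial I x) (h I)) ⟩
  Σ₂ (points n) (λ I → false)                      ≡⟨ Σ₂-false (points n) ⟩
  false                                            ∎
  where open ≡-Reasoning

Σ₂-filter : {P : Pred A ℓp} (P? : Decidable P) → ∀ xs f →
            Σ₂ (filter P? xs) f ≡ Σ₂ xs (λ x → does (P? x) ∧ f x)
Σ₂-filter P? []       f = refl
Σ₂-filter P? (x ∷ xs) f with does (P? x)
... | true  = cong (f x xor_) (Σ₂-filter P? xs f)
... | false = Σ₂-filter P? xs f

S-eval : ∀ r (x : 𝔽₂^ n) → S r n x ≡ eval (λ I → does (∣ I ∣ ≟ r)) x
S-eval {n} r x = Σ₂-filter (λ I → ∣ I ∣ ≟ r) (points n) (λ I → monomial I x)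

coeff-S : ∀ r (I : Subset n) → coeff (S r n) I ≡ does (∣ I ∣ ≟ r)
coeff-S {n} r = proj₂ (proj₂ (multilinear (S r n))) (λ x → sym (S-eval r x))

S-zero : (x : 𝔽₂^ n) → S 0 n x ≡ true
S-zero []      = refl
S-zero {suc n} (b ∷ x) = begin
  S 0 (suc n) (b ∷ x)     ≡⟨ S-eval 0 (b ∷ x) ⟩
  eval (λ I → does (∣ I ∣ ≟ 0)) (b ∷ x) ≡⟨ eval-∷ (λ I → does (∣ I ∣ ≟ 0)) b x ⟩
  eval (λ I → does (∣ I ∣ ≟ 0)) x xor (b ∧ eval (λ _ → false) x)
    ≡⟨ cong₂ (λ s s′ → s xor (b ∧ s′)) (sym (S-eval 0 x)) (Σ₂-false (points n)) ⟩
  S 0 n x xor (b ∧ false) ≡⟨ cong₂ _xor_ (S-zero x) (Bool.∧-zeroʳ b) ⟩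
  true ∎
  where open ≡-Reasoning

S-∷ : ∀ r b (x : 𝔽₂^ n) → S (suc r) (suc n) (b ∷ x) ≡ S (suc r) n x xor (b ∧ S r n x)
S-∷ r b x = begin
  S (suc r) _ (b ∷ x)  ≡⟨ S-eval (suc r) (b ∷ x) ⟩
  eval (λ I → does (∣ I ∣ ≟ suc r)) (b ∷ x) ≡⟨ eval-∷ (λ I → does (∣ I ∣ ≟ suc r)) b x ⟩
  _ ≡⟨ cong₂ (λ s s′ → s xor (b ∧ s′)) (S-eval (suc r) x) (S-eval r x) ⟨
  S (suc r) _ x xor (b ∧ S r _ x) ∎
  where open ≡-Reasoning

-- odd-choose r m is the parity of m choose r.
odd-choose : ℕ → ℕ → 𝔽₂
odd-choose zero    m       = true
odd-choose (suc r) zero    = false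
odd-choose (suc r) (suc m) = odd-choose (suc r) m xor odd-choose r m

S-weight : ∀ r (x : 𝔽₂^ n) → S r n x ≡ odd-choose r ∣ x ∣
S-weight zero    x           = S-zero x
S-weight (suc r) []          = refl
S-weight (suc r) (false ∷ x) = trans (S-∷ r false x) (trans (Bool.xor-identityʳ _) (S-weight (suc r) x))
S-weight (suc r) (true ∷ x)  = trans (S-∷ r true x) (cong₂ _xor_ (S-weight (suc r) x) (S-weight r x))

-- Compare coefficients in (1 + X)^(2^t) = 1 + X^(2^t) over F₂. Squaring this identity is the
-- induction step, in which the two middle terms cancel.
odd-choose-shift : ∀ t r m → odd-choose (2 ^ t + r) (2 ^ t + m) ≡ odd-choose (2 ^ t + r) m xor odd-choose r m
odd-choose-shift zero r m = refl
odd-choose-shift (suc t) r m = begin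
  c (2 * q + r) (2 * q + m)                        ≡⟨ cong₂ c (two q r) (two q m) ⟩
  c (q + (q + r)) (q + (q + m))                    ≡⟨ odd-choose-shift t (q + r) (q + m) ⟩
  c (q + (q + r)) (q + m) xor c (q + r) (q + m)
    ≡⟨ cong₂ _xor_ (odd-choose-shift t (q + r) m) (odd-choose-shift t r m) ⟩
  (c (q + (q + r)) m xor c (q + r) m) xor (c (q + r) m xor c r m)
    ≡⟨ cancel (c (q + (q + r)) m) (c (q + r) m) (c r m) ⟩
  c (q + (q + r)) m xor c r m                      ≡⟨ cong (λ s → c s m xor c r m) (sym (two q r)) ⟩
  c (2 * q + r) m xor c r m                        ∎
  where
  open ≡-Reasoning
  q = 2 ^ t
  c = odd-choose
  two : ∀ q r → 2 * q + r ≡ q + (q + r)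
  two = solve-∀
  cancel : ∀ a b d → (a xor b) xor (b xor d) ≡ a xor d
  cancel a b d = trans (Bool.xor-assoc a b _) (cong (a xor_) (xor-cancelˡ b d))

-- Of the factor 1 + X^(2^t) only the summand 1 contributes to the coefficient of X^r when r < 2^t.
odd-choose-periodic : ∀ t {r} → r < 2 ^ t → ∀ m → odd-choose r (2 ^ t + m) ≡ odd-choose r m
odd-choose-periodic zero {zero} r<q m = refl
odd-choose-periodic zero {suc r} (s≤s ()) m
odd-choose-periodic (suc t) {r} r<2q m with r <? 2 ^ t
... | yes r<q = begin
  odd-choose r (2 * q + m)     ≡⟨ cong (odd-choose r) (two q m) ⟩
  odd-choose r (q + (q + m))   ≡⟨ odd-choose-periodic t r<q (q + m) ⟩
  odd-choose r (q + m)         ≡⟨ odd-choose-periodic t r<q m ⟩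
  odd-choose r m               ∎
  where
  open ≡-Reasoning
  q = 2 ^ t
  two : ∀ q r → 2 * q + r ≡ q + (q + r)
  two = solve-∀
... | no r≮q = subst (λ r → odd-choose r (2 * q + m) ≡ odd-choose r m) (m+[n∸m]≡n (≮⇒≥ r≮q)) (begin
  c (q + r′) (2 * q + m)                        ≡⟨ cong (c (q + r′)) (two q m) ⟩
  c (q + r′) (q + (q + m))                      ≡⟨ odd-choose-shift t r′ (q + m) ⟩
  c (q + r′) (q + m) xor c r′ (q + m)
    ≡⟨ cong₂ _xor_ (odd-choose-shift t r′ m) (odd-choose-periodic t r′<q m) ⟩
  (c (q + r′) m xor c r′ m) xor c r′ m
    ≡⟨ trans (Bool.xor-assoc (c (q + r′) m) _ _) (cong (c (q + r′) m xor_) (Bool.xor-same (c r′ m))) ⟩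
  c (q + r′) m xor false                        ≡⟨ Bool.xor-identityʳ _ ⟩
  c (q + r′) m                                  ∎)
  where
  open ≡-Reasoning
  q = 2 ^ t
  c = odd-choose
  r′ = r ∸ q
  two : ∀ q r → 2 * q + r ≡ q + (q + r)
  two = solve-∀
  r′<q : r′ < q
  r′<q = +-cancelˡ-< q r′ q (subst₂ _<_ (sym (m+[n∸m]≡n (≮⇒≥ r≮q))) (cong (λ s → q + s) (+-identityʳ q)) r<2q)

-- Bias of antiperiodic functions of the weight

Antiperiodic : ℕ → (ℕ → 𝔽₂) → Set
Antiperiodic q g = ∀ m → g (q + m) ≡ not (g m)

odd-choose-antiperiodic : ∀ t → Antiperiodic (2 ^ t) (odd-choose (2 ^ t))
odd-choose-antiperiodic t m = begin
  odd-choose (2 ^ t) (2 ^ t + m)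
    ≡⟨ cong (λ r → odd-choose r (2 ^ t + m)) (sym (+-identityʳ (2 ^ t))) ⟩
  odd-choose (2 ^ t + 0) (2 ^ t + m)       ≡⟨ odd-choose-shift t 0 m ⟩
  odd-choose (2 ^ t + 0) m xor true        ≡⟨ cong (λ r → odd-choose r m xor true) (+-identityʳ (2 ^ t)) ⟩
  odd-choose (2 ^ t) m xor true            ≡⟨ Bool.xor-comm _ true ⟩
  not (odd-choose (2 ^ t) m)               ∎
  where open ≡-Reasoning

χ : 𝔽₂ → ℤ
χ false = 1ℤ
χ true  = -1ℤ

χ-not : ∀ b → χ (not b) ≡ ℤ.- χ b
χ-not false = refl
χ-not true  = refl

∣χ∣ : ∀ b → ℤ.∣ χ b ∣ ≡ 1
∣χ∣ false = refl
∣χ∣ true  = refl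

∫-neg : (F : 𝔽₂^ n → ℤ) → ∫ (λ x → ℤ.- F x) ≡ ℤ.- ∫ F
∫-neg {zero}  F = refl
∫-neg {suc n} F = trans (cong₂ ℤ._+_ (∫-neg (F ↾ false)) (∫-neg (F ↾ true)))
                      (sym (ℤ.neg-distrib-+ (∫ (F ↾ false)) (∫ (F ↾ true))))

∫ʷ : ∀ n → (ℕ → ℤ) → ℤ
∫ʷ n u = ∫ {n} (λ x → u ∣ x ∣)

∫ʷ-cong : ∀ n {u v} → u ≗ v → ∫ʷ n u ≡ ∫ʷ n v
∫ʷ-cong n u≗v = ∫-cong {n} (λ x → u≗v ∣ x ∣)

∫ʷ-split : ∀ m n u → ∫ʷ (m + n) u ≡ ∫ʷ m (λ i → ∫ʷ n (λ j → u (i + j)))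
∫ʷ-split zero    n u = refl
∫ʷ-split (suc m) n u = cong₂ ℤ._+_ (∫ʷ-split m n u) (∫ʷ-split m n (u ∘ suc))

-- The index is shifted: the value is 2^(n+1) - 2, the number of points of the cube of dimension
-- `suc n` other than `𝟎` and `𝟏`.
2^n-2 : ℕ → ℕ
2^n-2 zero    = 0
2^n-2 (suc n) = 2 + 2 * 2^n-2 n

2^n-2+2 : ∀ n → 2 + 2^n-2 n ≡ 2 ^ suc n
2^n-2+2 zero    = refl
2^n-2+2 (suc n) = trans (lemma (2^n-2 n)) (cong (2 *_) (2^n-2+2 n))
  where
  lemma : ∀ c → 2 + (2 + 2 * c) ≡ 2 * (2 + c)
  lemma = solve-∀

-- The points `𝟎` and `𝟏` are kept apart from the trivially bounded rest because antiperiodicity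
-- will make their two terms cancel.
∫ʷ-ends : ∀ n u B → (∀ i → ℤ.∣ u i ∣ ≤ B) →
          ∃[ R ] ∫ʷ (suc n) u ≡ (u 0 ℤ.+ u (suc n)) ℤ.+ R × ℤ.∣ R ∣ ≤ 2^n-2 n * B
∫ʷ-ends zero    u B bound = 0ℤ , sym (ℤ.+-identityʳ _) , z≤n
∫ʷ-ends (suc n) u B bound =
  let R , eq , R≤ = ∫ʷ-ends n u B bound
      R′ , eq′ , R′≤ = ∫ʷ-ends n (u ∘ suc) B (bound ∘ suc)
  in (u (suc n) ℤ.+ u 1) ℤ.+ (R ℤ.+ R′) ,
     trans (cong₂ ℤ._+_ eq eq′) (rearrange (u 0) (u (suc n)) R (u 1) (u (2 + n)) R′) ,
     (begin
       ℤ.∣ (u (suc n) ℤ.+ u 1) ℤ.+ (R ℤ.+ R′) ∣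
         ≤⟨ ℤ.∣i+j∣≤∣i∣+∣j∣ (u (suc n) ℤ.+ u 1) (R ℤ.+ R′) ⟩
       ℤ.∣ u (suc n) ℤ.+ u 1 ∣ + ℤ.∣ R ℤ.+ R′ ∣
         ≤⟨ +-mono-≤ (ℤ.∣i+j∣≤∣i∣+∣j∣ (u (suc n)) (u 1)) (ℤ.∣i+j∣≤∣i∣+∣j∣ R R′) ⟩
       (ℤ.∣ u (suc n) ∣ + ℤ.∣ u 1 ∣) + (ℤ.∣ R ∣ + ℤ.∣ R′ ∣)
         ≤⟨ +-mono-≤ (+-mono-≤ (bound (suc n)) (bound 1)) (+-mono-≤ R≤ R′≤) ⟩
       (B + B) + (2^n-2 n * B + 2^n-2 n * B)
         ≡⟨ collect (2^n-2 n) B ⟩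
       2^n-2 (suc n) * B ∎)
  where
  open ≤-Reasoning
  rearrange : ∀ a b R c d R′ → ((a ℤ.+ b) ℤ.+ R) ℤ.+ ((c ℤ.+ d) ℤ.+ R′) ≡ (a ℤ.+ d)
      ℤ.+ ((b ℤ.+ c) ℤ.+ (R ℤ.+ R′))
  rearrange = ℤRing.solve-∀
  collect : ∀ c B → (B + B) + (c * B + c * B) ≡ (2 + 2 * c) * B
  collect = solve-∀

-- The bound is uniform in `g` because the inductions pass from `g` to its translates.
WeightBias≤ : ℕ → ℕ → ℕ → Set
WeightBias≤ q n B = ∀ g → Antiperiodic q g → ℤ.∣ ∫ʷ n (χ ∘ g) ∣ ≤ B

shift-antiperiodic : ∀ {q g} k → Antiperiodic q g → Antiperiodic q (λ m → g (k + m))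
shift-antiperiodic {q} {g} k anti m = trans (cong g (comm k q m)) (anti (k + m))
  where
  comm : ∀ k q m → k + (q + m) ≡ q + (k + m)
  comm = solve-∀

weightBias-suc : ∀ {q n B} → WeightBias≤ q n B → WeightBias≤ q (suc n) (2 * B)
weightBias-suc {q} {n} {B} bound g anti = begin
  ℤ.∣ ∫ʷ n (χ ∘ g) ℤ.+ ∫ʷ n (χ ∘ g ∘ suc) ∣         ≤⟨ ℤ.∣i+j∣≤∣i∣+∣j∣ (∫ʷ n (χ ∘ g)) _ ⟩
  ℤ.∣ ∫ʷ n (χ ∘ g) ∣ + ℤ.∣ ∫ʷ n (χ ∘ g ∘ suc) ∣
    ≤⟨ +-mono-≤ (bound g anti) (bound (g ∘ suc) (shift-antiperiodic 1 anti)) ⟩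
  B + B                                             ≡⟨ cong (λ s → B + s) (sym (+-identityʳ B)) ⟩
  2 * B                                             ∎
  where open ≤-Reasoning

-- Among the 2 ^ suc p translates of g in ∫ʷ-split, the first and the last
-- cancel.
weightBias-q : ∀ {p n B} → WeightBias≤ (suc p) n B → WeightBias≤ (suc p) (suc p + n) (2^n-2 p * B)
weightBias-q {p} {n} {B} bound g anti =
  let R , eq , R≤ = ∫ʷ-ends p (λ i → ∫ʷ n (λ j → χ (g (i + j)))) B
                      (λ i → bound _ (shift-antiperiodic i anti))
  in subst (λ i → ℤ.∣ i ∣ ≤ 2^n-2 p * B)
       (sym (trans (∫ʷ-split (suc p) n (χ ∘ g)) (trans eq (cancel R)))) R≤
  where
  opposite : ∫ʷ n (λ j → χ (g (suc p + j))) ≡ ℤ.- ∫ʷ n (χ ∘ g)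
  opposite = trans (∫ʷ-cong n (λ j → trans (cong χ (anti j)) (χ-not (g j)))) (∫-neg {n} _)
  cancel : ∀ R → (∫ʷ n (χ ∘ g) ℤ.+ ∫ʷ n (λ j → χ (g (suc p + j)))) ℤ.+ R ≡ R
  cancel R = trans (cong (λ i → (∫ʷ n (χ ∘ g) ℤ.+ i) ℤ.+ R) opposite)
                   (trans (cong (ℤ._+ R) (ℤ.+-inverseʳ (∫ʷ n (χ ∘ g)))) (ℤ.+-identityˡ R))

weightBias-0 : ∀ {q} r → WeightBias≤ q r (2 ^ r)
weightBias-0     zero    g anti = ≤-reflexive (∣χ∣ (g 0))
weightBias-0 {q} (suc r)        = weightBias-suc {q} {r} (weightBias-0 {q} r)

-- Each of the `j` blocks of q = `suc p` coordinates contributes 2^q - 2 instead of 2^q, so the bias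
-- decays like (1 - 2/2^q)^j.
weightBias : ∀ {p} j r → WeightBias≤ (suc p) (j * suc p + r) (2^n-2 p ^ j * 2 ^ r)
weightBias {p} zero    r = subst (WeightBias≤ (suc p) r) (sym (*-identityˡ _)) (weightBias-0 r)
weightBias {p} (suc j) r = subst₂ (WeightBias≤ (suc p)) (sym (+-assoc (suc p) _ r))
    (sym (*-assoc (2^n-2 p) _ _))
                             (weightBias-q (weightBias j r))

-- A form of Bernoulli's inequality, (1 + 2/c)^j ≥ 1 + j/c, cleared of denominators.
bernoulli : ∀ c j → c ^ j * (c + j) ≤ c * (2 + c) ^ j
bernoulli c zero    = ≤-reflexive (lemma c)
  where
  lemma : ∀ c → 1 * (c + 0) ≡ c * 1
  lemma = solve-∀
bernoulli c (suc j) = begin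
  c * X * (c + suc j)                    ≤⟨ m≤m+n _ _ ⟩
  c * X * (c + suc j) + X * (2 * j + c)  ≡⟨ lemma₁ c X j ⟩
  (2 + c) * (X * (c + j))                ≤⟨ *-monoʳ-≤ (2 + c) (bernoulli c j) ⟩
  (2 + c) * (c * (2 + c) ^ j)            ≡⟨ lemma₂ (2 + c) c ((2 + c) ^ j) ⟩
  c * (2 + c) ^ suc j                    ∎
  where
  open ≤-Reasoning
  X = c ^ j
  lemma₁ : ∀ c X j → c * X * (c + (1 + j)) + X * (2 * j + c) ≡ (2 + c) * (X * (c + j))
  lemma₁ = solve-∀
  lemma₂ : ∀ a b d → a * (b * d) ≡ b * (a * d)
  lemma₂ = solve-∀

-- The exponent j = E c makes 1 + j/c exceed E.
geometric-decay : ∀ E c .{{_ : NonZero c}} → E * c ^ (E * c) ≤ (2 + c) ^ (E * c)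
geometric-decay E c = *-cancelˡ-≤ c (begin
  c * (E * c ^ j)            ≡⟨ lemma c E (c ^ j) ⟩
  c ^ j * (E * c)            ≤⟨ *-monoʳ-≤ (c ^ j) (m≤n+m (E * c) c) ⟩
  c ^ j * (c + j)            ≤⟨ bernoulli c j ⟩
  c * (2 + c) ^ j            ∎)
  where
  open ≤-Reasoning
  j = E * c
  lemma : ∀ c E X → c * (E * X) ≡ X * (E * c)
  lemma = solve-∀

-- Correlation of antiperiodic functions with polynomials of low degree

Degree< : ℕ → (𝔽₂^ n → 𝔽₂) → Set
Degree< r f = ∀ I → r ≤ ∣ I ∣ → coeff f I ≡ false

SmallBias : ℕ → ℕ → Set
SmallBias q r = ∀ E → ∃[ N ] ∀ n → N ≤ n → ∀ g → Antiperiodic q g → (f : 𝔽₂^ n → 𝔽₂) → Degree< r f →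
                E * ℤ.∣ ∫ (λ x → χ (g ∣ x ∣ xor f x)) ∣ ≤ 2 ^ n

-- With f = 0 this is `weightBias` for `E * c` blocks, and the remaining `n ∸ N` coordinates are
-- estimated trivially. Since the period is at least 2, c = 2^q - 2 is positive, as
-- `geometric-decay` demands.
smallBias-zero : ∀ p → SmallBias (2 + p) 0
smallBias-zero p E = N , λ n N≤n g anti f deg<0 → begin
    E * ℤ.∣ ∫ (λ x → χ (g ∣ x ∣ xor f x)) ∣
      ≡⟨ cong (λ i → E * ℤ.∣ i ∣)
          (∫-cong (λ x → cong χ (trans (cong (g ∣ x ∣ xor_) (coeff≗false⇒≗false f (λ I → deg<0 I z≤n) x))
          (Bool.xor-identityʳ _)))) ⟩
    E * ℤ.∣ ∫ʷ n (χ ∘ g) ∣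
      ≡⟨ cong (λ n → E * ℤ.∣ ∫ʷ n (χ ∘ g) ∣) (m+[n∸m]≡n N≤n) ⟨
    E * ℤ.∣ ∫ʷ (N + (n ∸ N)) (χ ∘ g) ∣
      ≤⟨ *-monoʳ-≤ E (weightBias j (n ∸ N) g anti) ⟩
    E * (c ^ j * 2 ^ (n ∸ N))
      ≡⟨ *-assoc E (c ^ j) _ ⟨
    E * c ^ j * 2 ^ (n ∸ N)
      ≤⟨ *-monoˡ-≤ (2 ^ (n ∸ N)) (geometric-decay E c) ⟩
    (2 + c) ^ j * 2 ^ (n ∸ N)
      ≡⟨ cong (λ a → a ^ j * 2 ^ (n ∸ N)) (2^n-2+2 (suc p)) ⟩
    (2 ^ q) ^ j * 2 ^ (n ∸ N)
      ≡⟨ cong (_* 2 ^ (n ∸ N)) (trans (^-*-assoc 2 q j) (cong (2 ^_) (*-comm q j))) ⟩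
    2 ^ N * 2 ^ (n ∸ N)
      ≡⟨ ^-distribˡ-+-* 2 N (n ∸ N) ⟨
    2 ^ (N + (n ∸ N))
      ≡⟨ cong (2 ^_) (m+[n∸m]≡n N≤n) ⟩
    2 ^ n ∎
  where
  open ≤-Reasoning
  q = 2 + p
  c = 2^n-2 (suc p)
  j = E * c
  N = j * q

∣merge∣ : ∀ (θ : Thin m n) s x → ∣ merge θ s x ∣ ≡ ∣ merge θ s 𝟎 ∣ + ∣ x ∣
∣merge∣ done     []          []          = refl
∣merge∣ (keep θ) (_ ∷ s)     (true ∷ x)  = trans (cong suc (∣merge∣ θ s x)) (sym (+-suc _ _))
∣merge∣ (keep θ) (_ ∷ s)     (false ∷ x) = ∣merge∣ θ s x
∣merge∣ (drop θ) (true ∷ s)  x           = cong suc (∣merge∣ θ s x)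
∣merge∣ (drop θ) (false ∷ s) x           = ∣merge∣ θ s x

coeff-f₁ : ∀ (f : 𝔽₂^ (suc n) → 𝔽₂) I → coeff (f ∘ (true ∷_)) I ≡ coeff f (outside ∷ I) xor coeff f (inside ∷ I)
coeff-f₁ f I = trans (coeff-cong (λ x → sym (xor-cancelˡ (f (false ∷ x)) (f (true ∷ x)))) I) (coeff-xor _ _ I)

-- A monomial of f that contributes to `I` after fixing coordinates consists of `embed θ I` and
-- possibly some fixed variables. If there are any of the latter, its size exceeds `r` and its
-- coefficient is `false`.
coeff-merge : ∀ r (θ : Thin m n) s (f : 𝔽₂^ n → 𝔽₂) → Degree< (suc r) f → ∀ I → r ≤ ∣ I ∣ →
              coeff (f ∘ merge θ s) I ≡ coeff f (embed θ I)
coeff-merge r done [] f deg [] r≤ = refl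
coeff-merge r (keep θ) (_ ∷ s) f deg (outside ∷ I) r≤ =
  coeff-merge r θ s _ (λ J → deg (outside ∷ J)) I r≤
coeff-merge zero (keep θ) (_ ∷ s) f deg (inside ∷ I) r≤ =
  coeff-merge zero θ s _ (λ J _ → deg (inside ∷ J) (s≤s z≤n)) I z≤n
coeff-merge (suc r) (keep θ) (_ ∷ s) f deg (inside ∷ I) (s≤s r≤) =
  coeff-merge r θ s _ (λ J r≤J → deg (inside ∷ J) (s≤s r≤J)) I r≤
coeff-merge r (drop θ) (false ∷ s) f deg I r≤ =
  coeff-merge r θ s _ (λ J → deg (outside ∷ J)) I r≤
coeff-merge r (drop θ) (true ∷ s) f deg I r≤ = begin
  coeff (f ∘ (true ∷_) ∘ merge θ s) I
    ≡⟨ coeff-merge r θ s (f ∘ (true ∷_)) deg₁ I r≤ ⟩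
  coeff (f ∘ (true ∷_)) (embed θ I)
    ≡⟨ coeff-f₁ f (embed θ I) ⟩
  coeff f (outside ∷ embed θ I) xor coeff f (inside ∷ embed θ I)
    ≡⟨ cong (coeff f (outside ∷ embed θ I) xor_)
        (deg (inside ∷ embed θ I) (s≤s (subst (r ≤_) (sym (∣embed∣ θ I)) r≤))) ⟩
  coeff f (outside ∷ embed θ I) xor false
    ≡⟨ Bool.xor-identityʳ _ ⟩
  coeff f (outside ∷ embed θ I) ∎
  where
  open ≡-Reasoning
  deg₁ : Degree< (suc r) (f ∘ (true ∷_))
  deg₁ J r<J = trans (coeff-f₁ f J) (cong₂ _xor_ (deg (outside ∷ J) r<J) (deg (inside ∷ J) (m≤n⇒m≤1+n r<J)))

-- By Ramsey's theorem, f is on a large subcube a multiple of S r plus a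
-- polynomial of smaller degree, whatever the values of the other coordinates.
smallBias-suc : ∀ {q r} → (∀ m → odd-choose r (q + m) ≡ odd-choose r m) → SmallBias q r → SmallBias q (suc r)
smallBias-suc {q} {r} periodic small E = proj₁ (ramsey r M) , λ n N≤n g anti f deg →
  let θ , b , mono = proj₂ (ramsey r M) n N≤n (coeff f) in
  let open ≤-Reasoning
      F : 𝔽₂^ n → ℤ
      F x = χ (g ∣ x ∣ xor f x)
  -- Multiplying by `2 ^ M`, the multiplicity in `∫-merge`, replaces the sum by sums over the
  -- subcubes treated in `restricted`.
  in *-cancelˡ-≤ (2 ^ M) {{m^n≢0 2 M}} (begin
    2 ^ M * (E * ℤ.∣ ∫ F ∣)                      ≡⟨ lemma (2 ^ M) E ℤ.∣ ∫ F ∣ ⟩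
    E * (2 ^ M * ℤ.∣ ∫ F ∣)
      ≡⟨ cong (E *_) (trans (cong ℤ.∣_∣ (∫-merge θ F)) (ℤ.abs-* (+ (2 ^ M)) (∫ F))) ⟨
    E * ℤ.∣ ∫ (λ s → ∫ (F ∘ merge θ s)) ∣
      ≤⟨ ∫-abs E (2 ^ M) (λ s → ∫ (F ∘ merge θ s)) (λ s → restricted n g anti f deg θ b mono s) ⟩
    2 ^ n * 2 ^ M                                ≡⟨ *-comm (2 ^ n) (2 ^ M) ⟩
    2 ^ M * 2 ^ n                                ∎)
  where
  M = proj₁ (small E)
  lemma : ∀ a b c → a * (b * c) ≡ b * (a * c)
  lemma = solve-∀
  restricted : ∀ n g → Antiperiodic q g → (f : 𝔽₂^ n → 𝔽₂) → Degree< (suc r) f →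
               (θ : Thin M n) → ∀ b → Monochromatic r b (coeff f ∘ embed θ) → ∀ s →
               E * ℤ.∣ ∫ (λ x → χ (g ∣ merge θ s x ∣ xor f (merge θ s x))) ∣ ≤ 2 ^ M
  restricted n g anti f deg θ b mono s =
    subst (λ i → E * ℤ.∣ i ∣ ≤ 2 ^ M) (∫-cong (λ x → cong χ (same x)))
      (proj₂ (small E) M ≤-refl g′ anti′ f′ deg′)
    where
    -- The fixed coordinates add a constant to the weight, so `g` turns into a translate.
    w = ∣ merge θ s 𝟎 ∣
    g′ : ℕ → 𝔽₂
    -- The multiple of `S r M` is added to both `g` and f: it cancels in their sum, and in f it
    -- removes the coefficients of size `r`.
    g′ m = g (w + m) xor (b ∧ odd-choose r m)
    f′ : 𝔽₂^ M → 𝔽₂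
    f′ x = f (merge θ s x) xor (b ∧ S r M x)
    anti′ : Antiperiodic q g′
    anti′ m = trans (cong₂ (λ c d → c xor (b ∧ d)) (shift-antiperiodic w anti m) (periodic m))
                    (sym (Bool.not-distribˡ-xor (g (w + m)) (b ∧ odd-choose r m)))
    same : ∀ x → g′ ∣ x ∣ xor f′ x ≡ g ∣ merge θ s x ∣ xor f (merge θ s x)
    same x rewrite S-weight r x | ∣merge∣ θ s x =
      trans (xor-interchange (g (w + ∣ x ∣)) _ (f (merge θ s x)) _)
            (trans (cong ((g (w + ∣ x ∣) xor f (merge θ s x)) xor_) (Bool.xor-same (b ∧ odd-choose r ∣ x ∣)))
                   (Bool.xor-identityʳ _))
    deg′ : Degree< r f′
    deg′ I r≤I = trans (coeff-xor (f ∘ merge θ s) _ I)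
      (trans (cong₂ _xor_ (coeff-merge r θ s f deg I r≤I)
          (trans (coeff-∧ b (S r M) I) (cong (b ∧_) (coeff-S r I)))) cancel)
      where
      cancel : coeff f (embed θ I) xor (b ∧ does (∣ I ∣ ≟ r)) ≡ false
      cancel with ∣ I ∣ ≟ r
      ... | yes ∣I∣≡r rewrite dec-true (∣ I ∣ ≟ r) ∣I∣≡r | mono I ∣I∣≡r = trans
          (cong (b xor_) (Bool.∧-identityʳ b)) (Bool.xor-same b)
      ... | no  ∣I∣≢r rewrite dec-false (∣ I ∣ ≟ r) ∣I∣≢r | deg (embed θ I)
          (subst (suc r ≤_) (sym (∣embed∣ θ I)) (≤∧≢⇒< r≤I (∣I∣≢r ∘ sym))) = Bool.∧-zeroʳ b

-- The degrees that are removed are 2^t - 1, ..., 0, all below 2^t, so `odd-choose-periodic` is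
-- available each time. The value r = 2^t is the one for polynomials of degree at most d.
smallBias : ∀ t p → 2 ^ t ≡ 2 + p → ∀ r → r ≤ 2 ^ t → SmallBias (2 ^ t) r
smallBias t p eq zero    r≤q = subst (λ q → SmallBias q 0) (sym eq) (smallBias-zero p)
smallBias t p eq (suc r) r<q = smallBias-suc (odd-choose-periodic t r<q) (smallBias t p eq r (<⇒≤ r<q))

-- From bias to distance

deg≤⇒Degree< : ∀ {d} (f : 𝔽₂^ n → 𝔽₂) → deg f ≤ d → Degree< (suc d) f
deg≤⇒Degree< {n} {d} f deg≤d I d<I with coeff f I in eq
... | false = refl
... | true  = contradiction (≤-trans d<I (≤-trans ∣I∣≤deg deg≤d)) 1+n≰n
  where
  ∣I∣≤deg : ∣ I ∣ ≤ deg f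
  ∣I∣≤deg = All.lookup (xs≤max 0 (map ∣_∣ (filter (λ I → T? (coeff f I)) (points n))))
    (∈-map⁺ ∣_∣ (∈-filter⁺ (λ I → T? (coeff f I)) (∈-points I) (subst T (sym eq) tt)))

Degree<⇒deg≤ : ∀ {d} (f : 𝔽₂^ n → 𝔽₂) → Degree< (suc d) f → deg f ≤ d
Degree<⇒deg≤ {n} {d} f deg< = max≤v⁺ z≤n (All.tabulate bound)
  where
  bound : ∀ {i} → i ∈ map ∣_∣ (filter (λ I → T? (coeff f I)) (points n)) → i ≤ d
  bound i∈ with ∈-map⁻ ∣_∣ i∈
  ... | I , I∈ , refl with ∣ I ∣ ≤? d
  ...   | yes ≤d = ≤d
  ...   | no  ≰d = contradiction (subst T (deg< I (≰⇒> ≰d))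
      (proj₂ (∈-filter⁻ (λ I → T? (coeff f I)) {xs = points n} I∈))) λ ()

𝟙 : Bool → ℕ
𝟙 false = 0
𝟙 true  = 1

∑ : List A → (A → ℕ) → ℕ
∑ []       f = 0
∑ (x ∷ xs) f = f x + ∑ xs f

∑-cong : ∀ (xs : List A) {f g : A → ℕ} → f ≗ g → ∑ xs f ≡ ∑ xs g
∑-cong []       f≗g = refl
∑-cong (x ∷ xs) f≗g = cong₂ _+_ (f≗g x) (∑-cong xs f≗g)

∑-++ : ∀ (xs ys : List A) f → ∑ (xs ++ ys) f ≡ ∑ xs f + ∑ ys f
∑-++ []       ys f = refl
∑-++ (x ∷ xs) ys f = trans (cong (λ s → f x + s) (∑-++ xs ys f)) (sym (+-assoc (f x) _ _))

∑-map : ∀ (h : A → B) xs f → ∑ (map h xs) f ≡ ∑ xs (f ∘ h)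
∑-map h []       f = refl
∑-map h (x ∷ xs) f = cong (λ s → f (h x) + s) (∑-map h xs f)

∑-cartesianProductWith : ∀ {C : Set ℓp} (h : A → B → C) xs ys f →
                         ∑ (cartesianProductWith h xs ys) f ≡ ∑ xs (λ x → ∑ ys (λ y → f (h x y)))
∑-cartesianProductWith h []       ys f = refl
∑-cartesianProductWith h (x ∷ xs) ys f =
  trans (∑-++ (map (h x) ys) _ f) (cong₂ _+_ (∑-map (h x) ys f) (∑-cartesianProductWith h xs ys f))

∑-points : ∀ n f → ∑ (points (suc n)) f ≡ ∑ (points n) (f ↾ false) + ∑ (points n) (f ↾ true)
∑-points n f = trans (∑-cartesianProductWith _∷_ scalars (points n) f)
                     (cong (λ s → ∑ (points n) (f ↾ false) + s) (+-identityʳ _))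

length-filter : {P : Pred A ℓp} (P? : Decidable P) → ∀ xs → length (filter P? xs) ≡ ∑ xs (λ x → 𝟙 (does (P? x)))
length-filter P? []       = refl
length-filter P? (x ∷ xs) with does (P? x)
... | true  = cong suc (length-filter P? xs)
... | false = length-filter P? xs

∑-const : ∀ (xs : List A) c → ∑ xs (λ _ → c) ≡ length xs * c
∑-const []       c = refl
∑-const (x ∷ xs) c = cong (λ s → c + s) (∑-const xs c)

length-∑ : ∀ (xs : List A) → length xs ≡ ∑ xs (λ _ → 1)
length-∑ xs = trans (sym (*-identityʳ _)) (sym (∑-const xs 1))

length-points : ∀ n → length (points n) ≡ 2 ^ n
length-points zero    = refl
length-points (suc n) = begin
  length (points (suc n))                              ≡⟨ length-∑ (points (suc n)) ⟩
  ∑ (points (suc n)) (λ _ → 1)                         ≡⟨ ∑-points n (λ _ → 1) ⟩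
  ∑ (points n) (λ _ → 1) + ∑ (points n) (λ _ → 1)
    ≡⟨ cong (λ N → N + N) (trans (sym (length-∑ (points n))) (length-points n)) ⟩
  2 ^ n + 2 ^ n                                        ≡⟨ cong (λ N → 2 ^ n + N) (sym (+-identityʳ (2 ^ n))) ⟩
  2 ^ suc n                                            ∎
  where open ≡-Reasoning

-- The general constant `M` allows nesting: `trilinear-count` applies this to functions that are
-- themselves sums over cubes.
∫-complement : ∀ (F : 𝔽₂^ n → ℤ) f M → (∀ x → F x ℤ.+ + (2 * f x) ≡ + M) →
               ∫ F ℤ.+ + (2 * ∑ (points n) f) ≡ + (2 ^ n * M)
∫-complement {zero} F f M eq = begin
  F [] ℤ.+ + (2 * (f [] + 0))   ≡⟨ cong (λ s → F [] ℤ.+ + (2 * s)) (+-identityʳ (f [])) ⟩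
  F [] ℤ.+ + (2 * f [])         ≡⟨ eq [] ⟩
  + M                           ≡⟨ cong +_ (sym (+-identityʳ M)) ⟩
  + (1 * M)                     ∎
  where open ≡-Reasoning
∫-complement {suc n} F f M eq = begin
  (i ℤ.+ j) ℤ.+ + (2 * ∑ (points (suc n)) f)         ≡⟨ cong (λ s → (i ℤ.+ j) ℤ.+ + (2 * s)) (∑-points n f) ⟩
  (i ℤ.+ j) ℤ.+ + (2 * (s + t))                      ≡⟨ cong (λ u → (i ℤ.+ j) ℤ.+ + u) (*-distribˡ-+ 2 s t) ⟩
  (i ℤ.+ j) ℤ.+ (+ (2 * s) ℤ.+ + (2 * t))            ≡⟨ interchange i j (+ (2 * s)) (+ (2 * t)) ⟩
  (i ℤ.+ + (2 * s)) ℤ.+ (j ℤ.+ + (2 * t))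
    ≡⟨ cong₂ ℤ._+_ (∫-complement (F ↾ false) (f ↾ false) M (eq ∘ (false ∷_)))
                                                                    (∫-complement (F ↾ true) (f ↾ true)
                                                                        M (eq ∘ (true ∷_))) ⟩
  + (2 ^ n * M + 2 ^ n * M)                          ≡⟨ cong +_ (double (2 ^ n) M) ⟩
  + (2 ^ suc n * M)                                  ∎
  where
  open ≡-Reasoning
  i = ∫ (F ↾ false)
  j = ∫ (F ↾ true)
  s = ∑ (points n) (f ↾ false)
  t = ∑ (points n) (f ↾ true)
  interchange : ∀ a b c d → (a ℤ.+ b) ℤ.+ (c ℤ.+ d) ≡ (a ℤ.+ c) ℤ.+ (b ℤ.+ d)
  interchange = ℤRing.solve-∀
  double : ∀ N M → N * M + N * M ≡ 2 * N * M
  double = solve-∀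

χ+2𝟙 : ∀ b → χ b ℤ.+ + (2 * 𝟙 b) ≡ + 1
χ+2𝟙 false = refl
χ+2𝟙 true  = refl

∫-χ : (f : 𝔽₂^ n → 𝔽₂) → ∫ (χ ∘ f) ℤ.+ + (2 * ∑ (points n) (𝟙 ∘ f)) ≡ + (2 ^ n)
∫-χ {n} f = trans (∫-complement (χ ∘ f) (𝟙 ∘ f) 1 (χ+2𝟙 ∘ f)) (cong +_ (*-identityʳ (2 ^ n)))

does-≢ : ∀ a b → does (¬? (a Bool.≟ b)) ≡ a xor b
does-≢ false false = refl
does-≢ false true  = refl
does-≢ true  false = refl
does-≢ true  true  = refl

bias⇒disagreements : ∀ E (f g : 𝔽₂^ n → 𝔽₂) → E * ℤ.∣ ∫ (λ x → χ (f x xor g x)) ∣ ≤ 2 ^ n →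
  E * length (points n) ≤ length (points n) + 2 * (E * length (filter (λ x → ¬? (f x Bool.≟ g x)) (points n)))
bias⇒disagreements {n} E f g bias = subst₂ (λ L d → E * L ≤ L + 2 * (E * d))
  (sym (length-points n))
  (sym (trans (length-filter (λ x → ¬? (f x Bool.≟ g x)) (points n))
      (∑-cong (points n) (λ x → cong 𝟙 (does-≢ (f x) (g x))))))
  (begin
    E * 2 ^ n                                      ≡⟨ cong (λ i → E * ℤ.∣ i ∣) (∫-χ h) ⟨
    E * ℤ.∣ ∫ (χ ∘ h) ℤ.+ + (2 * s) ∣              ≤⟨ *-monoʳ-≤ E (ℤ.∣i+j∣≤∣i∣+∣j∣ (∫ (χ ∘ h)) (+ (2 * s))) ⟩
    E * (ℤ.∣ ∫ (χ ∘ h) ∣ + 2 * s)                  ≡⟨ lemma E ℤ.∣ ∫ (χ ∘ h) ∣ s ⟩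
    E * ℤ.∣ ∫ (χ ∘ h) ∣ + 2 * (E * s)              ≤⟨ +-monoˡ-≤ _ bias ⟩
    2 ^ n + 2 * (E * s)                            ∎)
  where
  open ≤-Reasoning
  h : 𝔽₂^ n → 𝔽₂
  h x = f x xor g x
  s = ∑ (points n) (𝟙 ∘ h)
  lemma : ∀ E b s → E * (b + 2 * s) ≡ E * b + 2 * (E * s)
  lemma = solve-∀

-- With E the denominator of `ε`, the inequality assumed says a/L ≥ 1/2 - 1/(2E) for L = `suc l`,
-- and ε ≥ 1/E because a positive numerator is at least 1.
½-ε≤ : ∀ ε → 0ℚ ℚ.< ε → ∀ a l → ℚ.↧ₙ ε * suc l ≤ suc l + 2 * (ℚ.↧ₙ ε * a) → ½ ℚ.- ε ℚ.≤ (+ a) ℚ./ suc l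
½-ε≤ (mkℚ (+ 0) d _)      (ℚ.*<* (ℤ.+<+ ()))
½-ε≤ (mkℚ ℤ.-[1+ _ ] d _) (ℚ.*<* ())
½-ε≤ ε@(mkℚ (+ suc n) d _) _ a l h = begin
  ½ ℚ.- ε                       ≤⟨ ℚ.+-monoˡ-≤ (ℚ.- ε) ½≤ ⟩
  (a/L ℚ.+ ε) ℚ.- ε             ≡⟨ ℚ.+-assoc a/L ε (ℚ.- ε) ⟩
  a/L ℚ.+ (ε ℚ.- ε)             ≡⟨ cong (a/L ℚ.+_) (ℚ.+-inverseʳ ε) ⟩
  a/L ℚ.+ 0ℚ                    ≡⟨ ℚ.+-identityʳ a/L ⟩
  a/L                           ∎
  where
  open ℚ.≤-Reasoning
  a/L = (+ a) ℚ./ suc l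
  arith : 1 * (suc l * suc d) ≤ (a * suc d + suc n * suc l) * 2
  arith = ≤-trans (≤-reflexive (lemma₁ l d))
      (≤-trans h (≤-trans (m≤m+n _ (suc l + n * suc l * 2)) (≤-reflexive (lemma₂ l d a n))))
    where
    lemma₁ : ∀ l d → 1 * ((1 + l) * (1 + d)) ≡ (1 + d) * (1 + l)
    lemma₁ = solve-∀
    lemma₂ : ∀ l d a n → ((1 + l) + 2 * ((1 + d) * a)) + ((1 + l) + n * (1 + l) * 2)
        ≡ (a * (1 + d) + (1 + n) * (1 + l)) * 2
    lemma₂ = solve-∀
  ½≤ : ½ ℚ.≤ a/L ℚ.+ ε
  ½≤ = ℚ.toℚᵘ-cancel-≤
      (ℚᵘ.≤-respʳ-≃
      (ℚᵘ.≃-sym (ℚᵘ.≃-trans (ℚ.toℚᵘ-homo-+ a/L ε) (ℚᵘ.+-congˡ (ℚ.toℚᵘ ε) (ℚ.toℚᵘ-fromℚᵘ (mkℚᵘ (+ a) l)))))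
    (ℚᵘ.*≤* (subst₂ ℤ._≤_ (ℤ.pos-* 1 (suc l * suc d)) (trans (ℤ.pos-* (a * suc d + suc n * suc l) 2)
        (cong (ℤ._* + 2) (trans (ℤ.pos-+ (a * suc d) (suc n * suc l))
        (cong₂ ℤ._+_ (ℤ.pos-* a (suc d)) (ℤ.pos-* (suc n) (suc l))))))
      (ℤ.+≤+ arith))))

Pr≥½-ε : ∀ ε → 0ℚ ℚ.< ε → {P : Pred A ℓp} (P? : Decidable P) → ∀ xs → 0 < length xs →
         ℚ.↧ₙ ε * length xs ≤ length xs + 2 * (ℚ.↧ₙ ε * length (filter P? xs)) → ½ ℚ.- ε ℚ.≤ Pr P? xs
Pr≥½-ε ε ε>0 P? xs@(_ ∷ ys) _ h = ½-ε≤ ε ε>0 (length (filter P? xs)) (length ys) h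

-- The quotient is at most 7/15, which lies below 63/128 = 1/2 - 2^-7.
Pr≤ : {P : Pred A ℓp} (P? : Decidable P) → ∀ xs → 15 * length (filter P? xs) ≤ 7 * length xs →
      Pr P? xs ℚ.≤ ½ ℚ.- + 1 ℚ./ (2 ^ 7)
-- On the empty list `Pr` has the value `0ℚ`.
Pr≤ P? [] _ = *≤* (ℤ.+≤+ z≤n)
Pr≤ P? xs@(_ ∷ ys) h = ℚ.toℚᵘ-cancel-≤ (ℚᵘ.≤-respˡ-≃ (ℚᵘ.≃-sym (ℚ.toℚᵘ-fromℚᵘ (mkℚᵘ (+ r) (length ys))))
    (ℚᵘ.*≤* (subst₂ ℤ._≤_ (ℤ.pos-* r 128) (ℤ.pos-* 63 L) (ℤ.+≤+ arith))))
  where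
  r = length (filter P? xs)
  L = length xs
  arith : r * 128 ≤ 63 * L
  arith = *-cancelˡ-≤ 15 (begin
    15 * (r * 128)   ≡⟨ lemma₁ r ⟩
    128 * (15 * r)   ≤⟨ *-monoʳ-≤ 128 h ⟩
    128 * (7 * L)    ≤⟨ m≤m+n _ (49 * L) ⟩
    128 * (7 * L) + 49 * L ≡⟨ lemma₂ L ⟩
    15 * (63 * L)    ∎)
    where
    open ≤-Reasoning
    lemma₁ : ∀ r → 15 * (r * 128) ≡ 128 * (15 * r)
    lemma₁ = solve-∀
    lemma₂ : ∀ L → 128 * (7 * L) + 49 * L ≡ 15 * (63 * L)
    lemma₂ = solve-∀

½-ε≤1 : ∀ ε → 0ℚ ℚ.< ε → ½ ℚ.- ε ℚ.≤ 1ℚ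
½-ε≤1 ε ε>0 = begin
  ½ ℚ.- ε        ≤⟨ ℚ.+-monoʳ-≤ ½ (ℚ.neg-antimono-≤ (ℚ.<⇒≤ ε>0)) ⟩
  ½ ℚ.+ 0ℚ       ≡⟨ ℚ.+-identityʳ ½ ⟩
  ½              ≤⟨ *≤* (ℤ.+≤+ (s≤s z≤n)) ⟩
  1ℚ             ∎
  where open ℚ.≤-Reasoning

δ-bound : ∀ d t → 2 ≤ t → d + 1 ≡ 2 ^ t → ∀ ε → 0ℚ ℚ.< ε →
          ∃[ N ] ∀ n → N ≤ n → δ d (S (d + 1) n) ℚ.≥ ½ ℚ.- ε
δ-bound d t 2≤t d+1≡2^t ε ε>0 with smallBias t (2 ^ t ∸ 2)
    (sym (m+[n∸m]≡n {2} (≤-trans (s≤s (s≤s z≤n)) (^-monoʳ-≤ 2 2≤t)))) (2 ^ t) ≤-refl (ℚ.↧ₙ ε)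
-- The default value `1ℚ` of the minimum must be bounded along with the distances; `½-ε≤1` does
-- this.
... | N , small = N , λ n N≤n → ℚ-Extrema.v≤min⁺ (½-ε≤1 ε ε>0) (All.tabulate (bound n N≤n))
  where
  bound : ∀ n → N ≤ n → ∀ {q} → q ∈ map (distance (S (d + 1) n))
      (filter (λ g → deg g ≤? d) (functions n)) → ½ ℚ.- ε ℚ.≤ q
  bound n N≤n q∈ with ∈-map⁻ (distance (S (d + 1) n)) q∈
  ... | g , g∈ , refl = Pr≥½-ε ε ε>0 (λ x → ¬? (S (d + 1) n x Bool.≟ g x)) (points n)
          (subst (0 <_) (sym (length-points n)) (m^n>0 2 n))
          (bias⇒disagreements (ℚ.↧ₙ ε) (S (d + 1) n) g
            (subst (λ i → ℚ.↧ₙ ε * ℤ.∣ i ∣ ≤ 2 ^ n)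
                (∫-cong (λ x → cong (λ b → χ (b xor g x))
                (sym (trans (S-weight (d + 1) x) (cong (λ r → odd-choose r ∣ x ∣) d+1≡2^t)))))
              (small n N≤n (odd-choose (2 ^ t)) (odd-choose-antiperiodic t) g
                (subst (λ r → Degree< r g) (trans (sym (+-comm d 1)) d+1≡2^t)
                  (deg≤⇒Degree< g (proj₂ (∈-filter⁻ (λ g → deg g ≤? d) {xs = functions n} g∈)))))))

-- Alternating forms

Form : Set ℓa → Set ℓa
Form A = List A → 𝔽₂

infixr 7 _⋆_

-- The exterior product of a linear form and an alternating form.
_⋆_ : (A → 𝔽₂) → Form A → Form A
(β ⋆ Φ) []      = false
(β ⋆ Φ) (v ∷ V) = (β v ∧ Φ V) xor (β ⋆ (λ U → Φ (v ∷ U))) V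

⋆-congˡ : ∀ {β γ : A → 𝔽₂} (Φ : Form A) V → β ≗ γ → (β ⋆ Φ) V ≡ (γ ⋆ Φ) V
⋆-congˡ Φ []      β≗γ = refl
⋆-congˡ Φ (v ∷ V) β≗γ = cong₂ _xor_ (cong (_∧ Φ V) (β≗γ v)) (⋆-congˡ (λ U → Φ (v ∷ U)) V β≗γ)

-- `β ⋆ Φ` evaluates `Φ` only on lists with one entry removed. This matters for `∂-S`, whose
-- induction hypothesis concerns a single length.
⋆-congʳ-length : ∀ (β : A → 𝔽₂) {Φ Ψ : Form A} V →
                 (∀ U → suc (length U) ≡ length V → Φ U ≡ Ψ U) → (β ⋆ Φ) V ≡ (β ⋆ Ψ) V
⋆-congʳ-length β []      Φ≗Ψ = refl
⋆-congʳ-length β (v ∷ V) Φ≗Ψ =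
  cong₂ _xor_ (cong (β v ∧_) (Φ≗Ψ V refl)) (⋆-congʳ-length β V (λ U ∣U∣ → Φ≗Ψ (v ∷ U) (cong suc ∣U∣)))

⋆-congʳ : ∀ (β : A → 𝔽₂) {Φ Ψ : Form A} V → Φ ≗ Ψ → (β ⋆ Φ) V ≡ (β ⋆ Ψ) V
⋆-congʳ β V Φ≗Ψ = ⋆-congʳ-length β V (λ U _ → Φ≗Ψ U)

⋆-xorʳ : ∀ (β : A → 𝔽₂) Φ Ψ V → (β ⋆ (λ U → Φ U xor Ψ U)) V ≡ (β ⋆ Φ) V xor (β ⋆ Ψ) V
⋆-xorʳ β Φ Ψ []      = refl
⋆-xorʳ β Φ Ψ (v ∷ V) = trans (cong ((β v ∧ (Φ V xor Ψ V)) xor_)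
    (⋆-xorʳ β (λ U → Φ (v ∷ U)) (λ U → Ψ (v ∷ U)) V))
  (solve 5 (λ b x y z w → b :* (x :+ y) :+ (z :+ w) := (b :* x :+ z) :+ (b :* y :+ w))
      refl (β v) (Φ V) (Ψ V) _ _)
  where open xor-∧-Solver

⋆-xorˡ : ∀ (β γ : A → 𝔽₂) Φ V → ((λ v → β v xor γ v) ⋆ Φ) V ≡ (β ⋆ Φ) V xor (γ ⋆ Φ) V
⋆-xorˡ β γ Φ []      = refl
⋆-xorˡ β γ Φ (v ∷ V) = trans (cong (((β v xor γ v) ∧ Φ V) xor_) (⋆-xorˡ β γ (λ U → Φ (v ∷ U)) V))
  (solve 5 (λ b c x z w → (b :+ c) :* x :+ (z :+ w) := (b :* x :+ z) :+ (c :* x :+ w))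
      refl (β v) (γ v) (Φ V) _ _)
  where open xor-∧-Solver

⋆-∧ʳ : ∀ (β : A → 𝔽₂) s Φ V → (β ⋆ (λ U → s ∧ Φ U)) V ≡ s ∧ (β ⋆ Φ) V
⋆-∧ʳ β s Φ []      = sym (Bool.∧-zeroʳ s)
⋆-∧ʳ β s Φ (v ∷ V) = trans (cong ((β v ∧ (s ∧ Φ V)) xor_) (⋆-∧ʳ β s (λ U → Φ (v ∷ U)) V))
  (solve 4 (λ b s x z → b :* (s :* x) :+ s :* z := s :* (b :* x :+ z)) refl (β v) s (Φ V) _)
  where open xor-∧-Solver

⋆-∧ˡ : ∀ s (β : A → 𝔽₂) Φ V → ((λ v → s ∧ β v) ⋆ Φ) V ≡ s ∧ (β ⋆ Φ) V
⋆-∧ˡ s β Φ []      = sym (Bool.∧-zeroʳ s)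
⋆-∧ˡ s β Φ (v ∷ V) = trans (cong (((s ∧ β v) ∧ Φ V) xor_) (⋆-∧ˡ s β (λ U → Φ (v ∷ U)) V))
  (solve 4 (λ b s x z → (s :* b) :* x :+ s :* z := s :* (b :* x :+ z)) refl (β v) s (Φ V) _)
  where open xor-∧-Solver

⋆-vanishʳ : ∀ (β : A → 𝔽₂) Φ V → (∀ U → Φ U ≡ false) → (β ⋆ Φ) V ≡ false
⋆-vanishʳ β Φ []      Φ≗0 = refl
⋆-vanishʳ β Φ (v ∷ V) Φ≗0 =
  cong₂ _xor_ (trans (cong (β v ∧_) (Φ≗0 V)) (Bool.∧-zeroʳ (β v)))
      (⋆-vanishʳ β (λ U → Φ (v ∷ U)) V (λ U → Φ≗0 (v ∷ U)))

⋆-vanishˡ : ∀ {β : A → 𝔽₂} Φ {V} → All (λ v → β v ≡ false) V → (β ⋆ Φ) V ≡ false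
⋆-vanishˡ Φ []                = refl
⋆-vanishˡ Φ {v ∷ V} (β≡0 ∷ V⊥) = cong₂ _xor_ (cong (_∧ Φ V) β≡0) (⋆-vanishˡ (λ U → Φ (v ∷ U)) V⊥)

-- Exterior products of linear forms anticommute, and over F₂ there is no sign.
⋆-comm : ∀ (β γ : A → 𝔽₂) Φ V → (β ⋆ γ ⋆ Φ) V ≡ (γ ⋆ β ⋆ Φ) V
⋆-comm β γ Φ []      = refl
⋆-comm β γ Φ (v ∷ V) = begin
  (β v ∧ g) xor (β ⋆ (λ U → (γ v ∧ Φ U) xor (γ ⋆ Φv) U)) V
    ≡⟨ cong ((β v ∧ g) xor_) (trans (⋆-xorʳ β _ _ V) (cong₂ _xor_ (⋆-∧ʳ β (γ v) Φ V) (⋆-comm β γ Φv V))) ⟩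
  (β v ∧ g) xor ((γ v ∧ b) xor (γ ⋆ β ⋆ Φv) V)
    ≡⟨ solve 3 (λ x y z → x :+ (y :+ z) := y :+ (x :+ z)) refl (β v ∧ g) (γ v ∧ b) _ ⟩
  (γ v ∧ b) xor ((β v ∧ g) xor (γ ⋆ β ⋆ Φv) V)
    ≡⟨ cong ((γ v ∧ b) xor_) (trans (⋆-xorʳ γ _ _ V) (cong (_xor (γ ⋆ β ⋆ Φv) V) (⋆-∧ʳ γ (β v) Φ V))) ⟨
  (γ v ∧ b) xor (γ ⋆ (λ U → (β v ∧ Φ U) xor (β ⋆ Φv) U)) V ∎
  where
  open ≡-Reasoning
  open xor-∧-Solver using (solve; _:+_; _:=_)
  Φv : Form _
  Φv U = Φ (v ∷ U)
  g = (γ ⋆ Φ) V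
  b = (β ⋆ Φ) V

⋆-square : ∀ (β : A → 𝔽₂) Φ V → (β ⋆ β ⋆ Φ) V ≡ false
⋆-square β Φ []      = refl
⋆-square β Φ (v ∷ V) = begin
  (β v ∧ b) xor (β ⋆ (λ U → (β v ∧ Φ U) xor (β ⋆ Φv) U)) V
    ≡⟨ cong ((β v ∧ b) xor_) (trans (⋆-xorʳ β _ _ V) (cong₂ _xor_ (⋆-∧ʳ β (β v) Φ V) (⋆-square β Φv V))) ⟩
  (β v ∧ b) xor ((β v ∧ b) xor false)
    ≡⟨ xor-cancelˡ (β v ∧ b) false ⟩
  false ∎
  where
  open ≡-Reasoning
  Φv : Form _
  Φv U = Φ (v ∷ U)
  b = (β ⋆ Φ) V

⋆-map : ∀ (β : B → 𝔽₂) (h : A → B) Φ V → (β ⋆ Φ) (map h V) ≡ ((β ∘ h) ⋆ (Φ ∘ map h)) V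
⋆-map β h Φ []      = refl
⋆-map β h Φ (v ∷ V) = cong ((β (h v) ∧ Φ (map h V)) xor_) (⋆-map β h (λ U → Φ (h v ∷ U)) V)

Symmetric : {A : Set ℓa} → Form A → Set ℓa
Symmetric Φ = ∀ {V W} → V ↭ W → Φ V ≡ Φ W

⋆-symmetric : ∀ (β : A → 𝔽₂) Φ → Symmetric Φ → Symmetric (β ⋆ Φ)
⋆-symmetric β Φ sy refl = refl
⋆-symmetric β Φ sy (prep v V↭W) = cong₂ _xor_ (cong (β v ∧_) (sy V↭W)) (⋆-symmetric β _ (sy ∘ prep v) V↭W)
⋆-symmetric β Φ sy {_ ∷ _ ∷ V} {_ ∷ _ ∷ W} (swap u v V↭W)
  rewrite sy (prep v V↭W) | sy (prep u V↭W)
        | ⋆-symmetric β (λ U → Φ (u ∷ v ∷ U)) (sy ∘ prep u ∘ prep v) V↭W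
        | ⋆-congʳ β {λ U → Φ (u ∷ v ∷ U)} {λ U → Φ (v ∷ u ∷ U)} W (λ U → sy (swap u v refl)) =
  solve 3 (λ x y z → x :+ (y :+ z) := y :+ (x :+ z)) refl (β u ∧ Φ (v ∷ W)) (β v ∧ Φ (u ∷ W)) _
  where open xor-∧-Solver
⋆-symmetric β Φ sy (↭.trans p q) = trans (⋆-symmetric β Φ sy p) (⋆-symmetric β Φ sy q)

-- The sum over all I ⊆ [n] of the determinants of the columns in I; only the
-- I whose size is the number of arguments contribute.
ω : Form (𝔽₂^ n)
ω {zero}  []      = true
ω {zero}  (_ ∷ _) = false
ω {suc n} V       = (ω ∘ map tail) V xor (head ⋆ (ω ∘ map tail)) V

dot : 𝔽₂^ n → 𝔽₂^ n → 𝔽₂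
dot []      []      = false
dot (b ∷ x) (c ∷ y) = (b ∧ c) xor dot x y

𝟏 : 𝔽₂^ n
𝟏 = replicate _ true

ω-∷ : ∀ (w : 𝔽₂^ n) V → ω (w ∷ V) ≡ (dot 𝟏 w ∧ ω V) xor (dot w ⋆ ω) V
ω-∷ {zero}  []      V = sym (⋆-vanishˡ ω {V} (All.universal (λ { [] → refl }) V))
ω-∷ {suc n} (h ∷ w) V = begin
  P ((h ∷ w) ∷ V) xor ((h ∧ p) xor (head ⋆ (λ U → P ((h ∷ w) ∷ U))) V)
    ≡⟨ cong₂ (λ b c → b xor ((h ∧ p) xor c)) (step V)
         (trans (⋆-congʳ head V step)
             (trans (⋆-xorʳ head _ _ V) (cong (_xor (head ⋆ β ⋆ P) V) (⋆-∧ʳ head s P V)))) ⟩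
  ((s ∧ p) xor r) xor ((h ∧ p) xor ((s ∧ q) xor (head ⋆ β ⋆ P) V))
    ≡⟨ cong (λ x → ((s ∧ p) xor r) xor ((h ∧ p) xor ((s ∧ q) xor x))) (⋆-comm head β P V) ⟩
  ((s ∧ p) xor r) xor ((h ∧ p) xor ((s ∧ q) xor (β ⋆ head ⋆ P) V))
    ≡⟨ solve 6 (λ s h p q r x → (s :* p :+ r) :+ (h :* p :+ (s :* q :+ x)) := (h :+ s) :* (p :+ q)
        :+ (h :* (q :+ con false) :+ (r :+ x)))
         refl s h p q r _ ⟩
  ((h xor s) ∧ (p xor q)) xor ((h ∧ (q xor false)) xor (r xor (β ⋆ head ⋆ P) V))
    ≡⟨ cong (((h xor s) ∧ (p xor q)) xor_) (cong₂ _xor_ (cong (λ b → h ∧ (q xor b)) (⋆-square head P V))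
        (⋆-xorʳ β P (head ⋆ P) V)) ⟨
  ((h xor s) ∧ (p xor q)) xor ((h ∧ (q xor (head ⋆ head ⋆ P) V)) xor (β ⋆ ω) V)
    ≡⟨ cong (λ b → ((h xor s) ∧ (p xor q)) xor (b xor (β ⋆ ω) V))
        (trans (⋆-∧ˡ h head ω V) (cong (h ∧_) (⋆-xorʳ head P (head ⋆ P) V))) ⟨
  ((h xor s) ∧ (p xor q)) xor (((λ v → h ∧ head v) ⋆ ω) V xor (β ⋆ ω) V)
    ≡⟨ cong (((h xor s) ∧ (p xor q)) xor_) (trans (⋆-congˡ ω V (λ { (c ∷ x) → refl }))
        (⋆-xorˡ (λ v → h ∧ head v) β ω V)) ⟨
  ((h xor s) ∧ (p xor q)) xor (dot (h ∷ w) ⋆ ω) V ∎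
  where
  open ≡-Reasoning
  open xor-∧-Solver using (solve; con; _:+_; _:*_; _:=_)
  P : Form (𝔽₂^ (suc n))
  P = ω ∘ map tail
  β : 𝔽₂^ (suc n) → 𝔽₂
  β = dot w ∘ tail
  s = dot 𝟏 w
  p = P V
  q = (head ⋆ P) V
  r = (β ⋆ P) V
  step : ∀ U → P ((h ∷ w) ∷ U) ≡ (s ∧ P U) xor (β ⋆ P) U
  step U = trans (ω-∷ w (map tail U)) (cong ((s ∧ P U) xor_) (⋆-map (dot w) tail ω U))

ω-[] : ∀ n → ω {n} [] ≡ true
ω-[] zero    = refl
ω-[] (suc n) = trans (Bool.xor-identityʳ _) (ω-[] n)

ω-symmetric : Symmetric (ω {n})
ω-symmetric {zero} {[]}    {[]}    _   = refl
ω-symmetric {zero} {[]}    {_ ∷ _} V↭W = contradiction (↭-sym V↭W) ¬x∷xs↭[]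
ω-symmetric {zero} {_ ∷ _} {[]}    V↭W = contradiction V↭W ¬x∷xs↭[]
ω-symmetric {zero} {_ ∷ _} {_ ∷ _} _   = refl
ω-symmetric {suc n} V↭W =
  cong₂ _xor_ (ω-symmetric (map⁺ tail V↭W)) (⋆-symmetric head (ω ∘ map tail) (ω-symmetric ∘ map⁺ tail) V↭W)

ω-repeat : ∀ (v : 𝔽₂^ n) V → ω (v ∷ v ∷ V) ≡ false
ω-repeat {zero}  v V = refl
ω-repeat {suc n} v V = cong₂ _xor_ (ω-repeat (tail v) (map tail V))
  (trans (cong (λ b → c xor (c xor b)) (⋆-vanishʳ head _ V (λ U → ω-repeat (tail v) (map tail U))))
      (xor-cancelˡ c false))
  where c = head v ∧ ω (map tail (v ∷ V))

dot-⊕ʳ : ∀ (x y z : 𝔽₂^ n) → dot x (y ⊕ z) ≡ dot x y xor dot x z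
dot-⊕ʳ []      []      []      = refl
dot-⊕ʳ (a ∷ x) (b ∷ y) (c ∷ z) = trans (cong ((a ∧ (b xor c)) xor_) (dot-⊕ʳ x y z))
  (solve 5 (λ a b c d e → a :* (b :+ c) :+ (d :+ e) := (a :* b :+ d) :+ (a :* c :+ e))
      refl a b c (dot x y) (dot x z))
  where open xor-∧-Solver

dot-comm : ∀ (x y : 𝔽₂^ n) → dot x y ≡ dot y x
dot-comm []      []      = refl
dot-comm (a ∷ x) (b ∷ y) = cong₂ _xor_ (Bool.∧-comm a b) (dot-comm x y)

dot-⊕ˡ : ∀ (x y z : 𝔽₂^ n) → dot (x ⊕ y) z ≡ dot x z xor dot y z
dot-⊕ˡ x y z = trans (dot-comm (x ⊕ y) z) (trans (dot-⊕ʳ z x y) (cong₂ _xor_ (dot-comm z x) (dot-comm z y)))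

dot-𝟎ʳ : ∀ (x : 𝔽₂^ n) → dot x 𝟎 ≡ false
dot-𝟎ʳ []      = refl
dot-𝟎ʳ (b ∷ x) = cong₂ _xor_ (Bool.∧-zeroʳ b) (dot-𝟎ʳ x)

dot-self : ∀ (x : 𝔽₂^ n) → dot x x ≡ dot 𝟏 x
dot-self []      = refl
dot-self (b ∷ x) = cong₂ _xor_ (Bool.∧-idem b) (dot-self x)

ω-⊕ : ∀ (x y : 𝔽₂^ n) V → ω ((x ⊕ y) ∷ V) ≡ ω (x ∷ V) xor ω (y ∷ V)
ω-⊕ x y V = begin
  ω ((x ⊕ y) ∷ V)
    ≡⟨ ω-∷ (x ⊕ y) V ⟩
  (dot 𝟏 (x ⊕ y) ∧ ω V) xor (dot (x ⊕ y) ⋆ ω) V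
    ≡⟨ cong₂ (λ b c → (b ∧ ω V) xor c) (dot-⊕ʳ 𝟏 x y)
        (trans (⋆-congˡ ω V (dot-⊕ˡ x y)) (⋆-xorˡ (dot x) (dot y) ω V)) ⟩
  ((dot 𝟏 x xor dot 𝟏 y) ∧ ω V) xor ((dot x ⋆ ω) V xor (dot y ⋆ ω) V)
    ≡⟨ solve 5 (λ b c d e f → (b :+ c) :* f :+ (d :+ e) := (b :* f :+ d) :+ (c :* f :+ e)) refl (dot 𝟏 x)
        (dot 𝟏 y) _ _ (ω V) ⟩
  ((dot 𝟏 x ∧ ω V) xor (dot x ⋆ ω) V) xor ((dot 𝟏 y ∧ ω V) xor (dot y ⋆ ω) V)
    ≡⟨ cong₂ _xor_ (ω-∷ x V) (ω-∷ y V) ⟨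
  ω (x ∷ V) xor ω (y ∷ V) ∎
  where
  open ≡-Reasoning
  open xor-∧-Solver using (solve; _:+_; _:*_; _:=_)

infix 4 _⊥_

_⊥_ : 𝔽₂^ n → List (𝔽₂^ n) → Set
w ⊥ V = All (λ v → dot w v ≡ false) V

ω-isolated : ∀ {w : 𝔽₂^ n} {V} → dot 𝟏 w ≡ false → w ⊥ V → ω (w ∷ V) ≡ false
ω-isolated {w = w} {V} even w⊥V = trans (ω-∷ w V) (cong₂ _xor_ (cong (_∧ ω V) even) (⋆-vanishˡ ω w⊥V))

ω-𝟎 : ∀ (V : List (𝔽₂^ n)) → ω (𝟎 ∷ V) ≡ false
ω-𝟎 {n} V = ω-isolated {w = 𝟎} {V} (dot-𝟎ʳ (𝟏 {n})) (All.universal (λ v → trans (dot-comm 𝟎 v) (dot-𝟎ʳ v)) V)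

false·≡𝟎 : ∀ (v : 𝔽₂^ n) → false · v ≡ 𝟎
false·≡𝟎 []      = refl
false·≡𝟎 (b ∷ v) = cong (false ∷_) (false·≡𝟎 v)

true·≡id : ∀ (v : 𝔽₂^ n) → true · v ≡ v
true·≡id []      = refl
true·≡id (b ∷ v) = cong (b ∷_) (true·≡id v)

⊕-identityˡ : ∀ (x : 𝔽₂^ n) → 𝟎 ⊕ x ≡ x
⊕-identityˡ []      = refl
⊕-identityˡ (b ∷ x) = cong (b ∷_) (⊕-identityˡ x)

⊕-comm : ∀ (x y : 𝔽₂^ n) → x ⊕ y ≡ y ⊕ x
⊕-comm []      []      = refl
⊕-comm (b ∷ x) (c ∷ y) = cong₂ _∷_ (Bool.xor-comm b c) (⊕-comm x y)

⊕-assoc : ∀ (x y z : 𝔽₂^ n) → (x ⊕ y) ⊕ z ≡ x ⊕ (y ⊕ z)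
⊕-assoc []      []      []      = refl
⊕-assoc (a ∷ x) (b ∷ y) (c ∷ z) = cong₂ _∷_ (Bool.xor-assoc a b c) (⊕-assoc x y z)

⊕-cancelˡ : ∀ (x y : 𝔽₂^ n) → x ⊕ (x ⊕ y) ≡ y
⊕-cancelˡ []      []      = refl
⊕-cancelˡ (a ∷ x) (b ∷ y) = cong₂ _∷_ (xor-cancelˡ a b) (⊕-cancelˡ x y)

⊕-identityʳ : ∀ (x : 𝔽₂^ n) → x ⊕ 𝟎 ≡ x
⊕-identityʳ x = trans (⊕-comm x 𝟎) (⊕-identityˡ x)

⊕-self : ∀ (x : 𝔽₂^ n) → x ⊕ x ≡ 𝟎
⊕-self x = trans (cong (x ⊕_) (sym (⊕-identityʳ x))) (⊕-cancelˡ x 𝟎)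

⊕≡𝟎⇒≡ : ∀ {x y : 𝔽₂^ n} → x ⊕ y ≡ 𝟎 → x ≡ y
⊕≡𝟎⇒≡ {x = x} {y} eq = trans (sym (⊕-identityʳ x)) (trans (cong (x ⊕_) (sym eq)) (⊕-cancelˡ x y))

⊕-interchange : ∀ (x y z w : 𝔽₂^ n) → (x ⊕ y) ⊕ (z ⊕ w) ≡ (x ⊕ z) ⊕ (y ⊕ w)
⊕-interchange []      []      []      []      = refl
⊕-interchange (a ∷ x) (b ∷ y) (c ∷ z) (d ∷ w) = cong₂ _∷_ (xor-interchange a b c d) (⊕-interchange x y z w)

xor-· : ∀ b c (x : 𝔽₂^ n) → (b xor c) · x ≡ (b · x) ⊕ (c · x)
xor-· b c []      = refl
xor-· b c (d ∷ x) = cong₂ _∷_ (Bool.∧-distribʳ-xor d b c) (xor-· b c x)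

combination-⊕ : ∀ (V : Vec (𝔽₂^ n) k) x y → combination V (x ⊕ y) ≡ combination V x ⊕ combination V y
combination-⊕ []      []      []      = sym (⊕-self 𝟎)
combination-⊕ (v ∷ V) (b ∷ x) (c ∷ y) =
  trans (cong₂ _⊕_ (xor-· b c v) (combination-⊕ V x y)) (⊕-interchange (b · v) (c · v) _ _)

combination-𝟎 : ∀ (V : Vec (𝔽₂^ n) k) → combination V 𝟎 ≡ 𝟎
combination-𝟎 []      = refl
combination-𝟎 (v ∷ V) = trans (cong₂ _⊕_ (false·≡𝟎 v) (combination-𝟎 V)) (⊕-self 𝟎)

⊥-combination : ∀ (w : 𝔽₂^ n) (V : Vec (𝔽₂^ n) k) → w ⊥ toList V → ∀ x → dot w (combination V x) ≡ false
⊥-combination w []      []        []          = dot-𝟎ʳ w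
⊥-combination w (v ∷ V) (w⊥v ∷ w⊥V) (false ∷ x) = trans (dot-⊕ʳ w _ _)
  (cong₂ _xor_ (trans (cong (dot w) (false·≡𝟎 v)) (dot-𝟎ʳ w)) (⊥-combination w V w⊥V x))
⊥-combination w (v ∷ V) (w⊥v ∷ w⊥V) (true ∷ x) = trans (dot-⊕ʳ w _ _)
  (cong₂ _xor_ (trans (cong (dot w) (true·≡id v)) w⊥v) (⊥-combination w V w⊥V x))

-- By linearity only vectors that already occur among the other arguments appear in front, and `ω`
-- is alternating. `U` collects the vectors already passed, so that they remain arguments.
ω-combination : ∀ (V : Vec (𝔽₂^ n) k) x U → ω (combination V x ∷ (U ++ toList V)) ≡ false
ω-combination []      []      U = ω-𝟎 (U ++ [])
ω-combination (v ∷ V) (b ∷ x) U = trans (ω-⊕ (b · v) (combination V x) W) (cong₂ _xor_ (first b) second)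
  where
  W = U ++ v ∷ toList V
  first : ∀ b → ω ((b · v) ∷ W) ≡ false
  first false = trans (cong (λ w → ω (w ∷ W)) (false·≡𝟎 v)) (ω-𝟎 W)
  first true  = trans (cong (λ w → ω (w ∷ W)) (true·≡id v))
                      (trans (ω-symmetric (prep v (shift v U (toList V)))) (ω-repeat v _))
  second : ω (combination V x ∷ W) ≡ false
  second = subst (λ W → ω (combination V x ∷ W) ≡ false) (∷ʳ-++ U v (toList V)) (ω-combination V x (U ∷ʳ v))

ω-translate : ∀ (V : Vec (𝔽₂^ n) k) x U w → ω (w ∷ (U ++ toList V))
    ≡ ω ((w ⊕ combination V x) ∷ (U ++ toList V))
ω-translate V x U w = sym (trans (ω-⊕ w (combination V x) _)
  (trans (cong (ω (w ∷ (U ++ toList V)) xor_) (ω-combination V x U)) (Bool.xor-identityʳ _)))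

-- A combination w of V that is orthogonal to everything can replace one of
-- the vectors of V.
ω-radical : ∀ (V : Vec (𝔽₂^ n) k) z U → z ≢ 𝟎 → ∀ w → w ≡ combination V z →
            dot 𝟏 w ≡ false → w ⊥ (U ++ toList V) → ω (U ++ toList V) ≡ false
ω-radical []      []          U z≢𝟎 w w≡ even w⊥ = contradiction refl z≢𝟎
-- Here v does not occur in the combination and joins `U`. The first vector that does occur is the
-- one to be replaced.
ω-radical (v ∷ V) (false ∷ z) U z≢𝟎 w w≡ even w⊥ =
  subst (λ W → ω W ≡ false) (∷ʳ-++ U v (toList V))
    (ω-radical V z (U ∷ʳ v) (z≢𝟎 ∘ cong (false ∷_)) w
      (trans w≡ (trans (cong (_⊕ combination V z) (false·≡𝟎 v)) (⊕-identityˡ _)))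
      even (subst (w ⊥_) (sym (∷ʳ-++ U v (toList V))) w⊥))
ω-radical (v ∷ V) (true ∷ z) U z≢𝟎 w w≡ even w⊥ = begin
  ω (U ++ v ∷ toList V)
    ≡⟨ ω-symmetric (shift v U (toList V)) ⟩
  ω (v ∷ (U ++ toList V))
    ≡⟨ ω-translate V z U v ⟩
  ω ((v ⊕ combination V z) ∷ (U ++ toList V))
    ≡⟨ cong (λ w → ω (w ∷ (U ++ toList V))) (trans (cong (_⊕ combination V z) (sym (true·≡id v))) (sym w≡)) ⟩
  ω (w ∷ (U ++ toList V))
    ≡⟨ ω-isolated even (All.tail (All-resp-↭ (shift v U (toList V)) w⊥)) ⟩
  false ∎
  where open ≡-Reasoning

-- Gram matrices and orthogonal projection

unique-⊆⇒length≤ : ∀ {xs ys : List A} → Unique xs → (∀ {x} → x ∈ xs → x ∈ ys) → length xs ≤ length ys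
unique-⊆⇒length≤ {xs = []} _ _ = z≤n
unique-⊆⇒length≤ {xs = x ∷ xs} (x∉xs ∷ xs!) xs⊆ys with ∈-∃++ (xs⊆ys (here refl))
... | us , vs , refl = ≤-trans (s≤s (unique-⊆⇒length≤ xs! xs⊆us++vs))
    (≤-reflexive (sym (↭-length (shift x us vs))))
  where
  xs⊆us++vs : ∀ {y} → y ∈ xs → y ∈ us ++ vs
  xs⊆us++vs y∈xs with ∈-resp-↭ (shift x us vs) (xs⊆ys (there y∈xs))
  ... | here refl = contradiction refl (All.lookup x∉xs y∈xs)
  ... | there y∈  = y∈

-- A value missed by `f` could be put in front of `map f xs`, giving a list without repetition that
-- is longer than `xs`.
injective⇒surjective : DecidableEquality A → ∀ {xs : List A} → Unique xs → (∀ x → x ∈ xs) →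
                       {f : A → A} → Injective _≡_ _≡_ f → ∀ y → ∃[ x ] f x ≡ y
injective⇒surjective _≟_ {xs} xs! complete {f} inj y with DecMembership._∈?_ _≟_ y (map f xs)
... | yes y∈ = let x , _ , y≡fx = ∈-map⁻ f y∈ in x , sym y≡fx
... | no  y∉ = contradiction
      (≤-trans (≤-reflexive (cong suc (sym (length-map f xs))))
               (unique-⊆⇒length≤ {xs = y ∷ map f xs} (All.¬Any⇒All¬ (map f xs) y∉ ∷ Unique.map⁺ inj xs!)
                   (λ {x} _ → complete x)))
      1+n≰n

points-unique : ∀ n → Unique (points n)
points-unique zero    = [] ∷ []
points-unique (suc n) = Unique.cartesianProductWith⁺ _∷_ ∷-injective (((λ ()) ∷ []) ∷ [] ∷ []) (points-unique n)

gram : Vec (𝔽₂^ n) k → 𝔽₂^ k → 𝔽₂^ k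
gram V x = Vec.map (dot (combination V x)) V

map-dot-⊕ : ∀ (V : Vec (𝔽₂^ n) k) x y → Vec.map (dot (x ⊕ y)) V ≡ Vec.map (dot x) V ⊕ Vec.map (dot y) V
map-dot-⊕ []      x y = refl
map-dot-⊕ (v ∷ V) x y = cong₂ _∷_ (dot-⊕ˡ x y v) (map-dot-⊕ V x y)

map-dot≡𝟎⇒⊥ : ∀ (V : Vec (𝔽₂^ n) k) w → Vec.map (dot w) V ≡ 𝟎 → w ⊥ toList V
map-dot≡𝟎⇒⊥ []      w _  = []
map-dot≡𝟎⇒⊥ (v ∷ V) w eq = let h , t = ∷-injective eq in h ∷ map-dot≡𝟎⇒⊥ V w t

gram-⊕ : ∀ (V : Vec (𝔽₂^ n) k) x y → gram V (x ⊕ y) ≡ gram V x ⊕ gram V y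
gram-⊕ V x y = trans (cong (λ w → Vec.map (dot w) V) (combination-⊕ V x y))
    (map-dot-⊕ V (combination V x) (combination V y))

-- An injective Gram map is onto, so the products of `w` with the vectors of `V` can be matched by
-- those of a combination of `V`; adding it cancels them.
projection : ∀ (V : Vec (𝔽₂^ n) k) → (∀ z → gram V z ≡ 𝟎 → z ≡ 𝟎) →
             ∀ w → ∃[ x ] (w ⊕ combination V x) ⊥ toList V
projection V ker w with injective⇒surjective _≟ᵥ_ (points-unique _) ∈-points {gram V}
    injective (Vec.map (dot w) V)
  where
  injective : Injective _≡_ _≡_ (gram V)
  injective {x} {y} eq = ⊕≡𝟎⇒≡ (ker (x ⊕ y) (trans (gram-⊕ V x y) (trans (cong (_⊕ gram V y) eq) (⊕-self _))))
... | x , eq = x , map-dot≡𝟎⇒⊥ V (w ⊕ combination V x) (trans (map-dot-⊕ V w (combination V x))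
    (trans (cong (Vec.map (dot w) V ⊕_) eq) (⊕-self _)))

-- If V has a singular Gram matrix, take for h an element of its radical.
-- Otherwise take the projection of 𝟏 to the orthogonal complement of V.
trilinear-vanishes : ∀ (V : Vec (𝔽₂^ n) k) → ∃[ h ] ∀ a b c →
  dot h a ≡ false → dot h b ≡ false → dot h c ≡ false → ω (a ∷ b ∷ c ∷ toList V) ≡ false
trilinear-vanishes V with decide-∃ ∈-points (λ z → ¬? (z ≟ᵥ 𝟎) ×-dec (gram V z ≟ᵥ 𝟎))
... | yes (z , z≢𝟎 , Gz≡𝟎) = h , λ a b c h⊥a h⊥b h⊥c →
  ω-radical V z (a ∷ b ∷ c ∷ []) z≢𝟎 h refl
    -- h lies both in the span of `V` and in its orthogonal complement, so ⟨𝟏, h⟩ = ⟨h, h⟩ = 0.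
    (trans (sym (dot-self h)) (⊥-combination h V h⊥V z))
    (h⊥a ∷ h⊥b ∷ h⊥c ∷ h⊥V)
  where
  h = combination V z
  h⊥V = map-dot≡𝟎⇒⊥ V h Gz≡𝟎
... | no ¬kernel = h , vanishes
  where
  ker : ∀ z → gram V z ≡ 𝟎 → z ≡ 𝟎
  ker z Gz≡𝟎 with z ≟ᵥ 𝟎
  ... | yes z≡𝟎 = z≡𝟎
  ... | no  z≢𝟎 = contradiction (z , z≢𝟎 , Gz≡𝟎) ¬kernel
  e = combination V (proj₁ (projection V ker 𝟏))
  h = 𝟏 ⊕ e
  h⊥V : h ⊥ toList V
  h⊥V = proj₂ (projection V ker 𝟏)
  y : 𝔽₂^ _ → 𝔽₂^ _
  y x = proj₁ (projection V ker x)
  π : 𝔽₂^ _ → 𝔽₂^ _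
  π x = x ⊕ combination V (y x)
  π⊥V : ∀ x → π x ⊥ toList V
  π⊥V x = proj₂ (projection V ker x)
  -- 𝟏 and h differ by the element e of the span, to which `π x` is orthogonal; x and `π x` differ
  -- by another element of the span, to which h is orthogonal.
  even : ∀ x → dot h x ≡ false → dot 𝟏 (π x) ≡ false
  even x h⊥x = begin
    dot 𝟏 (π x)                                       ≡⟨ Bool.xor-identityʳ _ ⟨
    dot 𝟏 (π x) xor false
      ≡⟨ cong (dot 𝟏 (π x) xor_) (trans (dot-comm e (π x)) (⊥-combination (π x) V (π⊥V x) _)) ⟨
    dot 𝟏 (π x) xor dot e (π x)                       ≡⟨ dot-⊕ˡ 𝟏 e (π x) ⟨
    dot h (π x)                                       ≡⟨ dot-⊕ʳ h x _ ⟩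
    dot h x xor dot h (combination V (y x))           ≡⟨ cong₂ _xor_ h⊥x (⊥-combination h V h⊥V (y x)) ⟩
    false                                             ∎
    where open ≡-Reasoning
  vanishes : ∀ a b c → dot h a ≡ false → dot h b ≡ false → dot h c ≡ false → ω (a ∷ b ∷ c ∷ toList V) ≡ false
  vanishes a b c h⊥a h⊥b h⊥c = begin
    ω (a ∷ b ∷ c ∷ toList V)              ≡⟨ ω-translate V (y a) (b ∷ c ∷ []) a ⟩
    ω (π a ∷ b ∷ c ∷ toList V)            ≡⟨ ω-symmetric (swap (π a) b refl) ⟩
    ω (b ∷ π a ∷ c ∷ toList V)            ≡⟨ ω-translate V (y b) (π a ∷ c ∷ []) b ⟩
    ω (π b ∷ π a ∷ c ∷ toList V)          ≡⟨ ω-symmetric (shift c (π b ∷ π a ∷ []) (toList V)) ⟩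
    ω (c ∷ π b ∷ π a ∷ toList V)          ≡⟨ ω-translate V (y c) (π b ∷ π a ∷ []) c ⟩
    ω (π c ∷ π b ∷ π a ∷ toList V)        ≡⟨ ω-∷ (π c) (π b ∷ π a ∷ toList V) ⟩
    (dot 𝟏 (π c) ∧ ω (π b ∷ π a ∷ toList V)) xor (dot (π c) ⋆ ω) (π b ∷ π a ∷ toList V)
      ≡⟨ cong₂ (λ s r → (s ∧ ω (π b ∷ π a ∷ toList V)) xor r) (even c h⊥c) expand ⟩
    false ∎
    where
    open ≡-Reasoning
    -- The products of `π c` with `V` vanish. The two remaining terms contain `ω (π a ∷ V)` and
    -- `ω (π b ∷ V)`, which vanish by `ω-isolated`.
    expand : (dot (π c) ⋆ ω) (π b ∷ π a ∷ toList V) ≡ false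
    expand rewrite ω-isolated (even a h⊥a) (π⊥V a) | ω-isolated (even b h⊥b) (π⊥V b)
                 | ⋆-vanishˡ (λ U → ω (π b ∷ π a ∷ U)) (π⊥V c)
                 | Bool.∧-zeroʳ (dot (π c) (π b)) | Bool.∧-zeroʳ (dot (π c) (π a)) = refl

-- Derivatives

Δ : 𝔽₂^ n → (𝔽₂^ n → 𝔽₂) → 𝔽₂^ n → 𝔽₂
Δ v f x = f x xor f (x ⊕ v)

∂ : (𝔽₂^ n → 𝔽₂) → List (𝔽₂^ n) → 𝔽₂^ n → 𝔽₂
∂ f []      o = f o
∂ f (v ∷ V) o = ∂ (Δ v f) V o

∂-cong : ∀ {f g : 𝔽₂^ n → 𝔽₂} V → f ≗ g → ∂ f V ≗ ∂ g V
∂-cong []      f≗g = f≗g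
∂-cong (v ∷ V) f≗g = ∂-cong V (λ x → cong₂ _xor_ (f≗g x) (f≗g (x ⊕ v)))

∂-xor : ∀ (f g : 𝔽₂^ n → 𝔽₂) V o → ∂ (λ x → f x xor g x) V o ≡ ∂ f V o xor ∂ g V o
∂-xor f g []      o = refl
∂-xor f g (v ∷ V) o =
  trans (∂-cong V (λ x → xor-interchange (f x) (g x) (f (x ⊕ v)) (g (x ⊕ v))) o) (∂-xor (Δ v f) (Δ v g) V o)

∂-∧ : ∀ s (f : 𝔽₂^ n → 𝔽₂) V o → ∂ (λ x → s ∧ f x) V o ≡ s ∧ ∂ f V o
∂-∧ s f []      o = refl
∂-∧ s f (v ∷ V) o =
  trans (∂-cong V (λ x → sym (Bool.∧-distribˡ-xor s (f x) (f (x ⊕ v)))) o) (∂-∧ s (Δ v f) V o)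

∂-translate : ∀ (f : 𝔽₂^ n → 𝔽₂) u V o → ∂ (λ x → f (x ⊕ u)) V o ≡ ∂ f V (o ⊕ u)
∂-translate f u []      o = refl
∂-translate f u (v ∷ V) o =
  trans (∂-cong V (λ x → cong (λ y → f (x ⊕ u) xor f y)
          (trans (⊕-assoc x v u) (trans (cong (x ⊕_) (⊕-comm v u)) (sym (⊕-assoc x u v))))) o)
        (∂-translate (Δ v f) u V o)

∂-∷ : ∀ (f : 𝔽₂^ n → 𝔽₂) v V o → ∂ f (v ∷ V) o ≡ ∂ f V o xor ∂ f V (o ⊕ v)
∂-∷ f v V o = trans (∂-xor f _ V o) (cong (∂ f V o xor_) (∂-translate f v V o))

∂-tail : ∀ (f : 𝔽₂^ n → 𝔽₂) V o → ∂ (f ∘ tail) V o ≡ ∂ f (map tail V) (tail o)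
∂-tail f []            o = refl
∂-tail f ((c ∷ v) ∷ V) o =
  trans (∂-cong V (λ { (b ∷ x) → refl }) o) (∂-tail (Δ v f) V o)

∂-const : ∀ s (v : 𝔽₂^ n) V o → ∂ (λ _ → s) (v ∷ V) o ≡ false
∂-const s v []      o = Bool.xor-same s
∂-const s v (w ∷ V) o = trans (∂-cong V (λ x → cong (λ b → b xor b) (Bool.xor-same s)) o)
    (∂-∧ false (λ _ → false) V o)

-- By the Leibniz rule the coordinate `head x` absorbs at most one direction, leaving the constant
-- `head v`. The term in which it absorbs none contains a derivative of g of order `length V`,
-- excluded by `vanish`.
∂-product : ∀ V (g : 𝔽₂^ n → 𝔽₂) o → (∀ W x → length W ≡ length V → ∂ g W x ≡ false) →
            ∂ (λ x → head x ∧ g (tail x)) V o ≡ (head ⋆ (λ W → ∂ g (map tail W) (tail o))) V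
∂-product []            g o vanish = trans (cong (head o ∧_) (vanish [] (tail o) refl)) (Bool.∧-zeroʳ (head o))
∂-product ((c ∷ v) ∷ V) g o vanish = begin
  ∂ (Δ (c ∷ v) (λ x → head x ∧ g (tail x))) V o
    ≡⟨ ∂-cong V (λ { (b ∷ x) → leibniz b (g x) (g (x ⊕ v)) }) o ⟩
  ∂ (λ x → (c ∧ g (tail x ⊕ v)) xor (head x ∧ Δ v g (tail x))) V o
    ≡⟨ ∂-xor _ _ V o ⟩
  ∂ (λ x → c ∧ g (tail x ⊕ v)) V o xor ∂ (λ x → head x ∧ Δ v g (tail x)) V o
    ≡⟨ cong₂ _xor_ left (∂-product V (Δ v g) o (λ W x ∣W∣ → vanish (v ∷ W) x (cong suc ∣W∣))) ⟩
  (c ∧ ∂ g (map tail V) (tail o)) xor (head ⋆ (λ W → ∂ (Δ v g) (map tail W) (tail o))) V ∎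
  where
  open ≡-Reasoning
  leibniz : ∀ b y z → (b ∧ y) xor ((b xor c) ∧ z) ≡ (c ∧ z) xor (b ∧ (y xor z))
  leibniz b y z = solve 4 (λ b c y z → b :* y :+ (b :+ c) :* z := c :* z :+ b :* (y :+ z)) refl b c y z
    where open xor-∧-Solver
  left : ∂ (λ x → c ∧ g (tail x ⊕ v)) V o ≡ c ∧ ∂ g (map tail V) (tail o)
  left = trans (∂-∧ c (λ x → g (tail x ⊕ v)) V o) (cong (c ∧_) (begin
    ∂ (λ x → g (tail x ⊕ v)) V o              ≡⟨ ∂-tail (λ x → g (x ⊕ v)) V o ⟩
    ∂ (λ x → g (x ⊕ v)) (map tail V) (tail o) ≡⟨ ∂-translate g v (map tail V) (tail o) ⟩
    -- The shift by v may be removed because its effect is a derivative of one order more, which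
    -- vanishes.
    ∂ g (map tail V) (tail o ⊕ v)             ≡⟨ xor-cancelˡ (∂ g (map tail V) (tail o)) _ ⟨
    ∂ g (map tail V) (tail o) xor (∂ g (map tail V) (tail o) xor ∂ g (map tail V) (tail o ⊕ v))
      ≡⟨ cong (∂ g (map tail V) (tail o) xor_) (∂-∷ g v (map tail V) (tail o)) ⟨
    ∂ g (map tail V) (tail o) xor ∂ g (v ∷ map tail V) (tail o)
      ≡⟨ cong (∂ g (map tail V) (tail o) xor_)
          (vanish (v ∷ map tail V) (tail o) (cong suc (length-map tail V))) ⟩
    ∂ g (map tail V) (tail o) xor false       ≡⟨ Bool.xor-identityʳ _ ⟩
    ∂ g (map tail V) (tail o)                 ∎))

∂-S-∷ : ∀ m V (o : 𝔽₂^ (suc n)) → (∀ W x → length W ≡ length V → ∂ (S m n) W x ≡ false) →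
        ∂ (S (suc m) (suc n)) V o ≡
        ∂ (S (suc m) n) (map tail V) (tail o) xor (head ⋆ (λ W → ∂ (S m n) (map tail W) (tail o))) V
∂-S-∷ {n} m V o vanish = begin
  ∂ (S (suc m) (suc n)) V o
    ≡⟨ ∂-cong V (λ { (b ∷ x) → S-∷ m b x }) o ⟩
  ∂ (λ x → S (suc m) n (tail x) xor (head x ∧ S m n (tail x))) V o
    ≡⟨ ∂-xor _ _ V o ⟩
  ∂ (S (suc m) n ∘ tail) V o xor ∂ (λ x → head x ∧ S m n (tail x)) V o
    ≡⟨ cong₂ _xor_ (∂-tail (S (suc m) n) V o) (∂-product V (S m n) o vanish) ⟩
  _ ∎
  where open ≡-Reasoning

∂-S-vanish : ∀ m n V (o : 𝔽₂^ n) → length V ≡ suc m → ∂ (S m n) V o ≡ false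
∂-S-vanish zero    n       (v ∷ []) o _ = cong₂ _xor_ (S-zero o) (S-zero (o ⊕ v))
∂-S-vanish (suc m) zero    (v ∷ V)  o _ = trans (∂-cong {f = S (suc m) 0} {g = λ _ → false} (v ∷ V)
    (λ { [] → refl }) o) (∂-const false v V o)
∂-S-vanish (suc m) (suc n) V        o ∣V∣ = trans
  (∂-S-∷ m V o (λ W x ∣W∣ → vanish-more W x (trans ∣W∣ ∣V∣)))
  (cong₂ _xor_ (∂-S-vanish (suc m) n (map tail V) (tail o) (trans (length-map tail V) ∣V∣))
    (trans (⋆-congʳ-length head {Ψ = λ _ → false} V
             (λ W ∣W∣ → ∂-S-vanish m n (map tail W) (tail o)
                 (trans (length-map tail W) (suc-injective (trans ∣W∣ ∣V∣)))))
           (⋆-vanishʳ head _ V (λ _ → refl))))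
  where
  vanish-more : ∀ W x → length W ≡ suc (suc m) → ∂ (S m n) W x ≡ false
  vanish-more (w ∷ W) x ∣W∣ = trans (∂-∷ (S m n) w W x)
    (cong₂ _xor_ (∂-S-vanish m n W x (suc-injective ∣W∣)) (∂-S-vanish m n W (x ⊕ w) (suc-injective ∣W∣)))

-- Pascal's rule `S-∷`, differentiated as often as the degree, becomes the recursion that defines
-- `ω`.
∂-S : ∀ m n V (o : 𝔽₂^ n) → length V ≡ m → ∂ (S m n) V o ≡ ω V
∂-S zero    n       []      o _ = trans (S-zero o) (sym (ω-[] n))
∂-S (suc m) zero    (v ∷ V) o _ = trans (∂-cong {f = S (suc m) 0} {g = λ _ → false} (v ∷ V) (λ { [] → refl }) o)
    (∂-const false v V o)
∂-S (suc m) (suc n) V       o ∣V∣ = trans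
  (∂-S-∷ m V o (λ W x ∣W∣ → ∂-S-vanish m n W x (trans ∣W∣ ∣V∣)))
  (cong₂ _xor_ (∂-S (suc m) n (map tail V) (tail o) (trans (length-map tail V) ∣V∣))
    (⋆-congʳ-length head V
      (λ W ∣W∣ → ∂-S m n (map tail W) (tail o) (trans (length-map tail W) (suc-injective (trans ∣W∣ ∣V∣))))))

Σ₂-points : ∀ n f → Σ₂ (points (suc n)) f ≡ Σ₂ (points n) (f ↾ false) xor Σ₂ (points n) (f ↾ true)
Σ₂-points n f = trans (Σ₂-++ (map (false ∷_) (points n)) _ f) (cong₂ _xor_ (Σ₂-map (false ∷_) (points n) f)
  (trans (cong (λ xs → Σ₂ xs f) (++-identityʳ (map (true ∷_) (points n)))) (Σ₂-map (true ∷_) (points n) f)))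

Σ₂-xor : ∀ (xs : List A) f g → Σ₂ xs (λ x → f x xor g x) ≡ Σ₂ xs f xor Σ₂ xs g
Σ₂-xor []       f g = refl
Σ₂-xor (x ∷ xs) f g = trans (cong ((f x xor g x) xor_) (Σ₂-xor xs f g)) (xor-interchange (f x) (g x) _ _)

-- Summing over one direction v of the frame replaces f by `Δ v f`.
Σ₂-affine : ∀ (f : 𝔽₂^ n → 𝔽₂) o (V : Vec (𝔽₂^ n) k) → Σ₂ (points k) (f ∘ affine (o , V)) ≡ ∂ f (toList V) o
Σ₂-affine f o [] = trans (Bool.xor-identityʳ _) (cong f (⊕-identityʳ o))
Σ₂-affine {k = suc k} f o (v ∷ V) = begin
  Σ₂ (points (suc k)) (f ∘ affine (o , v ∷ V))
    ≡⟨ Σ₂-points k (f ∘ affine (o , v ∷ V)) ⟩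
  Σ₂ (points k) (λ x → f (affine (o , v ∷ V) (false ∷ x))) xor Σ₂ (points k)
      (λ x → f (affine (o , v ∷ V) (true ∷ x)))
    ≡⟨ cong₂ _xor_ (Σ₂-cong (points k) (cong f ∘ at-false)) (Σ₂-cong (points k) (cong f ∘ at-true)) ⟩
  Σ₂ (points k) (λ x → f (affine (o , V) x)) xor Σ₂ (points k) (λ x → f (affine (o , V) x ⊕ v))
    ≡⟨ Σ₂-xor (points k) (λ x → f (affine (o , V) x)) (λ x → f (affine (o , V) x ⊕ v)) ⟨
  Σ₂ (points k) (Δ v f ∘ affine (o , V))
    ≡⟨ Σ₂-affine (Δ v f) o V ⟩
  ∂ f (v ∷ toList V) o ∎
  where
  open ≡-Reasoning
  at-false : ∀ x → affine (o , v ∷ V) (false ∷ x) ≡ affine (o , V) x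
  at-false x = cong (o ⊕_) (trans (cong (_⊕ combination V x) (false·≡𝟎 v)) (⊕-identityˡ _))
  at-true : ∀ x → affine (o , v ∷ V) (true ∷ x) ≡ affine (o , V) x ⊕ v
  at-true x = trans (cong (o ⊕_) (trans (cong (_⊕ combination V x) (true·≡id v)) (⊕-comm v _)))
      (sym (⊕-assoc o _ v))

-- The bias of a trilinear form

∫-mono : {F G : 𝔽₂^ n → ℤ} → (∀ x → F x ℤ.≤ G x) → ∫ F ℤ.≤ ∫ G
∫-mono {zero}  F≤G = F≤G []
∫-mono {suc n} F≤G = ℤ.+-mono-≤ (∫-mono (F≤G ∘ (false ∷_))) (∫-mono (F≤G ∘ (true ∷_)))

∫-0 : ∫ {n} (λ _ → 0ℤ) ≡ 0ℤ
∫-0 {zero}  = refl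
∫-0 {suc n} = cong₂ ℤ._+_ (∫-0 {n}) (∫-0 {n})

∫-nonneg : {F : 𝔽₂^ n → ℤ} → (∀ x → 0ℤ ℤ.≤ F x) → 0ℤ ℤ.≤ ∫ F
∫-nonneg {n} 0≤F = ℤ.≤-trans (ℤ.≤-reflexive (sym (∫-0 {n}))) (∫-mono 0≤F)

∫-swap : (F : 𝔽₂^ m → 𝔽₂^ n → ℤ) → ∫ (λ x → ∫ (F x)) ≡ ∫ (λ y → ∫ (λ x → F x y))
∫-swap {zero}  F = refl
∫-swap {suc m} F = trans (cong₂ ℤ._+_ (∫-swap (F ↾ false)) (∫-swap (F ↾ true)))
  (sym (∫-+ (λ y → ∫ (λ x → F (false ∷ x) y)) (λ y → ∫ (λ x → F (true ∷ x) y))))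

Additive : (𝔽₂^ n → 𝔽₂) → Set
Additive ℓ = ∀ x y → ℓ (x ⊕ y) ≡ ℓ x xor ℓ y

χ-xor : ∀ a b → χ (a xor b) ≡ χ a ℤ.* χ b
χ-xor false b = sym (ℤ.*-identityˡ (χ b))
χ-xor true  false = refl
χ-xor true  true  = refl

-- A character sums to 0 unless it is trivial. In the induction the two halves of the cube have sums
-- that agree up to a sign, so they add up or cancel.
∫χ-nonneg : (ℓ : 𝔽₂^ n → 𝔽₂) → Additive ℓ → 0ℤ ℤ.≤ ∫ (χ ∘ ℓ)
∫χ-nonneg {zero} ℓ add with ℓ [] in eq
... | false = ℤ.+≤+ z≤n
... | true  = contradiction (trans (sym eq) (trans (add [] []) (Bool.xor-same (ℓ [])))) λ ()
∫χ-nonneg {suc n} ℓ add = subst (0ℤ ℤ.≤_) (sym (cong (λ i → ∫ (χ ∘ ℓ₀) ℤ.+ i) slope)) (sum (ℓ (true ∷ 𝟎)))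
  where
  ℓ₀ : 𝔽₂^ n → 𝔽₂
  ℓ₀ = ℓ ↾ false
  slope : ∫ (χ ∘ (ℓ ↾ true)) ≡ χ (ℓ (true ∷ 𝟎)) ℤ.* ∫ (χ ∘ ℓ₀)
  slope = trans
      (∫-cong (λ x →
      trans (cong χ (trans (cong (ℓ ∘ (true ∷_)) (sym (⊕-identityˡ x))) (add (true ∷ 𝟎) (false ∷ x))))
                                     (χ-xor (ℓ (true ∷ 𝟎)) (ℓ₀ x))))
                (∫-* (χ (ℓ (true ∷ 𝟎))) (χ ∘ ℓ₀))
  0≤ : 0ℤ ℤ.≤ ∫ (χ ∘ ℓ₀)
  0≤ = ∫χ-nonneg ℓ₀ (λ x y → add (false ∷ x) (false ∷ y))
  sum : ∀ b → 0ℤ ℤ.≤ ∫ (χ ∘ ℓ₀) ℤ.+ χ b ℤ.* ∫ (χ ∘ ℓ₀)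
  sum false = ℤ.+-mono-≤ 0≤ (subst (0ℤ ℤ.≤_) (sym (ℤ.*-identityˡ _)) 0≤)
  sum true  = ℤ.≤-reflexive (sym (trans (cong (λ i → ∫ (χ ∘ ℓ₀) ℤ.+ i) (ℤ.-1*i≡-i _))
      (ℤ.+-inverseʳ (∫ (χ ∘ ℓ₀)))))

*-mono-nonneg : ∀ {i j k} → 0ℤ ℤ.≤ i → j ℤ.≤ k → i ℤ.* j ℤ.≤ i ℤ.* k
*-mono-nonneg {i} 0≤i j≤k = ℤ.*-monoˡ-≤-nonNeg i {{ℤ.nonNegative 0≤i}} j≤k

*-nonneg : ∀ {i j} → 0ℤ ℤ.≤ i → 0ℤ ℤ.≤ j → 0ℤ ℤ.≤ i ℤ.* j
*-nonneg {i} 0≤i 0≤j = ℤ.≤-trans (ℤ.≤-reflexive (sym (ℤ.*-zeroʳ i))) (*-mono-nonneg 0≤i 0≤j)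

module _ (h : 𝔽₂^ n) where

  -- Twice the indicator of the orthogonal complement of h.
  κ : 𝔽₂^ n → ℤ
  κ x = 1ℤ ℤ.+ χ (dot h x)

  κ-nonneg : ∀ x → 0ℤ ℤ.≤ κ x
  κ-nonneg x with dot h x
  ... | false = ℤ.+≤+ z≤n
  ... | true  = ℤ.+≤+ z≤n

  κ-≤2 : ∀ x {i} → 0ℤ ℤ.≤ i → κ x ℤ.* i ℤ.≤ + 2 ℤ.* i
  κ-≤2 x 0≤i with dot h x
  ... | false = ℤ.≤-refl
  ... | true  = *-nonneg {+ 2} (ℤ.+≤+ z≤n) 0≤i

  -- The weighted character is the sum of the two characters given by ℓ and ℓ + ⟨h, ·⟩.
  ∫κχ-nonneg : (ℓ : 𝔽₂^ n → 𝔽₂) → Additive ℓ → 0ℤ ℤ.≤ ∫ (λ x → κ x ℤ.* χ (ℓ x))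
  ∫κχ-nonneg ℓ add = subst (0ℤ ℤ.≤_) (sym (trans (∫-cong expand) (∫-+ (χ ∘ ℓ) (χ ∘ ℓ′))))
    (ℤ.+-mono-≤ (∫χ-nonneg ℓ add) (∫χ-nonneg ℓ′ add′))
    where
    ℓ′ : 𝔽₂^ n → 𝔽₂
    ℓ′ x = dot h x xor ℓ x
    add′ : Additive ℓ′
    add′ x y = trans (cong₂ _xor_ (dot-⊕ʳ h x y) (add x y)) (xor-interchange (dot h x) (dot h y) (ℓ x) (ℓ y))
    expand : ∀ x → κ x ℤ.* χ (ℓ x) ≡ χ (ℓ x) ℤ.+ χ (ℓ′ x)
    expand x = trans (ℤ.*-distribʳ-+ (χ (ℓ x)) 1ℤ (χ (dot h x))) (cong₂ ℤ._+_ (ℤ.*-identityˡ (χ (ℓ x)))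
        (sym (χ-xor (dot h x) (ℓ x))))

  ∫κ-≤2 : {F : 𝔽₂^ n → ℤ} → (∀ x → 0ℤ ℤ.≤ F x) → ∫ (λ x → κ x ℤ.* F x) ℤ.≤ + 2 ℤ.* ∫ F
  ∫κ-≤2 {F} 0≤F = ℤ.≤-trans (∫-mono (λ x → κ-≤2 x (0≤F x))) (ℤ.≤-reflexive (∫-* (+ 2) F))

  ∫κ-mono : {F G : 𝔽₂^ n → ℤ} → (∀ x → F x ℤ.≤ G x) → ∫ (λ x → κ x ℤ.* F x) ℤ.≤ ∫ (λ x → κ x ℤ.* G x)
  ∫κ-mono F≤G = ∫-mono (λ x → *-mono-nonneg (κ-nonneg x) (F≤G x))

  ∫κ-swap : (F : 𝔽₂^ n → 𝔽₂^ m → ℤ) → ∫ (λ x → κ x ℤ.* ∫ (F x)) ≡ ∫ (λ y → ∫ (λ x → κ x ℤ.* F x y))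
  ∫κ-swap F = trans (∫-cong (λ x → sym (∫-* (κ x) (F x)))) (∫-swap (λ x y → κ x ℤ.* F x y))

  2^n≤∫κ : + (2 ^ n) ℤ.≤ ∫ κ
  2^n≤∫κ = begin
    + (2 ^ n)                              ≡⟨ trans (ℤ.+-identityʳ _) (∫1 {n}) ⟨
    ∫ {n} (λ _ → 1ℤ) ℤ.+ 0ℤ                ≤⟨ ℤ.+-monoʳ-≤ (∫ {n} (λ _ → 1ℤ)) (∫χ-nonneg (dot h) (dot-⊕ʳ h)) ⟩
    ∫ {n} (λ _ → 1ℤ) ℤ.+ ∫ (χ ∘ dot h)     ≡⟨ ∫-+ (λ _ → 1ℤ) (χ ∘ dot h) ⟨
    ∫ κ                                    ∎
    where
    open ℤ.≤-Reasoning
    ∫1 : ∀ {n} → ∫ {n} (λ _ → 1ℤ) ≡ + (2 ^ n)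
    ∫1 {zero}  = refl
    ∫1 {suc n} = trans (cong₂ ℤ._+_ (∫1 {n}) (∫1 {n})) (cong (λ N → + (2 ^ n + N)) (sym (+-identityʳ (2 ^ n))))

  -- For fixed x or fixed y the sum of a character is nonnegative, so
  -- restricting the other variable to a hyperplane cannot increase it.
  ∫∫κ-≤4 : (β : 𝔽₂^ n → 𝔽₂^ n → 𝔽₂) → (∀ y → Additive (λ x → β x y)) → (∀ x → Additive (β x)) →
           ∫ (λ x → κ x ℤ.* ∫ (λ y → κ y ℤ.* χ (β x y))) ℤ.≤ + 4 ℤ.* ∫ (λ x → ∫ (λ y → χ (β x y)))
  ∫∫κ-≤4 β addˡ addʳ = begin
    ∫ (λ x → κ x ℤ.* ∫ (λ y → κ y ℤ.* χ (β x y)))     ≡⟨ ∫κ-swap (λ x y → κ y ℤ.* χ (β x y)) ⟩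
    ∫ (λ y → ∫ (λ x → κ x ℤ.* (κ y ℤ.* χ (β x y))))
      ≡⟨ ∫-cong (λ y → trans (∫-cong (λ x → comm (κ x) (κ y) (χ (β x y))))
          (∫-* (κ y) (λ x → κ x ℤ.* χ (β x y)))) ⟩
    ∫ (λ y → κ y ℤ.* ∫ (λ x → κ x ℤ.* χ (β x y)))     ≤⟨ ∫κ-≤2 (λ y → ∫κχ-nonneg (λ x → β x y) (addˡ y)) ⟩
    + 2 ℤ.* ∫ (λ y → ∫ (λ x → κ x ℤ.* χ (β x y)))     ≡⟨ cong (λ i → + 2 ℤ.* i) (∫κ-swap (λ x y → χ (β x y))) ⟨
    + 2 ℤ.* ∫ (λ x → κ x ℤ.* ∫ (λ y → χ (β x y)))
      ≤⟨ *-mono-nonneg {+ 2} (ℤ.+≤+ z≤n) (∫κ-≤2 (λ x → ∫χ-nonneg (β x) (addʳ x))) ⟩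
    + 2 ℤ.* (+ 2 ℤ.* ∫ (λ x → ∫ (λ y → χ (β x y))))   ≡⟨ ℤ.*-assoc (+ 2) (+ 2) _ ⟨
    + 4 ℤ.* ∫ (λ x → ∫ (λ y → χ (β x y)))             ∎
    where
    open ℤ.≤-Reasoning
    comm : ∀ i j k → i ℤ.* (j ℤ.* k) ≡ j ℤ.* (i ℤ.* k)
    comm = ℤRing.solve-∀

  -- With the weights κ x, κ y, κ z the sum equals (∫ κ)³ ≥ 2^(3n), because τ vanishes wherever the
  -- weights do not. Removing a weight costs at most a factor 2, since what it multiplies contains
  -- the sum of a character in another variable and so is nonnegative.
  trilinear-bias : (τ : 𝔽₂^ n → 𝔽₂^ n → 𝔽₂^ n → 𝔽₂) →
    (∀ y z → Additive (λ x → τ x y z)) → (∀ x z → Additive (λ y → τ x y z)) → (∀ x y → Additive (τ x y)) →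
    (∀ x y z → dot h x ≡ false → dot h y ≡ false → dot h z ≡ false → τ x y z ≡ false) →
    + (2 ^ n) ℤ.* (+ (2 ^ n) ℤ.* + (2 ^ n)) ℤ.≤ + 8 ℤ.* ∫ (λ x → ∫ (λ y → ∫ (λ z → χ (τ x y z))))
  trilinear-bias τ add₁ add₂ add₃ vanish = begin
    N ℤ.* (N ℤ.* N)
      ≤⟨ *-mono-nonneg 0≤N (*-mono-nonneg 0≤N 2^n≤∫κ) ⟩
    N ℤ.* (N ℤ.* j)
      ≡⟨ regroup N N j ⟩
    (N ℤ.* j) ℤ.* N
      ≤⟨ *-mono-nonneg (*-nonneg 0≤N 0≤j) 2^n≤∫κ ⟩
    (N ℤ.* j) ℤ.* j
      ≡⟨ regroup′ N j ⟩
    (j ℤ.* j) ℤ.* N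
      ≤⟨ *-mono-nonneg (*-nonneg 0≤j 0≤j) 2^n≤∫κ ⟩
    (j ℤ.* j) ℤ.* j
      ≡⟨ trans (∫-cong (λ x → trans (ℤ.*-comm (κ x) _)
          (cong (ℤ._* κ x) (trans (∫-cong (λ y → ℤ.*-comm (κ y) j)) (∫-* j κ))))) (∫-* (j ℤ.* j) κ) ⟨
    ∫ (λ x → κ x ℤ.* ∫ (λ y → κ y ℤ.* j))
      ≡⟨ ∫-cong (λ x → trans (weight x _)
          (∫-cong (λ y → trans (cong (κ x ℤ.*_) (weight y κ)) (trans (sym (∫-* (κ x) (λ z → κ y ℤ.* κ z)))
          (trans (∫-cong (supported x y)) (∫-* (κ x) (λ z → κ y ℤ.* (κ z ℤ.* χ (τ x y z))))))))) ⟩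
    ∫ (λ x → ∫ (λ y → κ x ℤ.* ∫ (λ z → κ y ℤ.* (κ z ℤ.* χ (τ x y z)))))
      ≡⟨ ∫-cong (λ x → trans (∫-cong (λ y → cong (κ x ℤ.*_) (∫-* (κ y) (λ z → κ z ℤ.* χ (τ x y z)))))
          (∫-* (κ x) (λ y → κ y ℤ.* ∫ (λ z → κ z ℤ.* χ (τ x y z))))) ⟩
    ∫ (λ x → κ x ℤ.* ∫ (λ y → κ y ℤ.* ∫ (λ z → κ z ℤ.* χ (τ x y z))))
      ≤⟨ ∫κ-mono (λ x → ∫∫κ-≤4 (τ x) (add₂ x) (add₃ x)) ⟩
    ∫ (λ x → κ x ℤ.* (+ 4 ℤ.* ∫ (λ y → ∫ (λ z → χ (τ x y z)))))
      ≤⟨ ∫κ-≤2 (λ x → *-nonneg {+ 4} (ℤ.+≤+ z≤n) (∫-nonneg (λ y → ∫χ-nonneg (τ x y) (add₃ x y)))) ⟩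
    + 2 ℤ.* ∫ (λ x → + 4 ℤ.* ∫ (λ y → ∫ (λ z → χ (τ x y z))))
      ≡⟨ trans (cong (λ i → + 2 ℤ.* i) (∫-* (+ 4) (λ x → ∫ (λ y → ∫ (λ z → χ (τ x y z))))))
          (sym (ℤ.*-assoc (+ 2) (+ 4) _)) ⟩
    + 8 ℤ.* ∫ (λ x → ∫ (λ y → ∫ (λ z → χ (τ x y z)))) ∎
    where
    open ℤ.≤-Reasoning
    N = + (2 ^ n)
    j = ∫ κ
    0≤N : 0ℤ ℤ.≤ N
    0≤N = ℤ.+≤+ z≤n
    0≤j : 0ℤ ℤ.≤ j
    0≤j = ∫-nonneg κ-nonneg
    regroup : ∀ a b c → a ℤ.* (b ℤ.* c) ≡ (a ℤ.* c) ℤ.* b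
    regroup = ℤRing.solve-∀
    regroup′ : ∀ a b → (a ℤ.* b) ℤ.* b ≡ (b ℤ.* b) ℤ.* a
    regroup′ = ℤRing.solve-∀
    weight : ∀ x (F : 𝔽₂^ n → ℤ) → κ x ℤ.* ∫ F ≡ ∫ (λ y → κ x ℤ.* F y)
    weight x F = sym (∫-* (κ x) F)
    supported : ∀ x y z → κ x ℤ.* (κ y ℤ.* κ z) ≡ κ x ℤ.* (κ y ℤ.* (κ z ℤ.* χ (τ x y z)))
    supported x y z with dot h x in hx | dot h y in hy | dot h z in hz
    ... | true  | _     | _     = refl
    ... | false | true  | _     = refl
    ... | false | false | true  = refl
    ... | false | false | false = cong (λ b → + 2 ℤ.* (+ 2 ℤ.* (+ 2 ℤ.* χ b))) (sym (vanish x y z hx hy hz))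

-- From bias to counting

∑-* : ∀ (xs : List A) c f → ∑ xs (λ x → c * f x) ≡ c * ∑ xs f
∑-* []       c f = sym (*-zeroʳ c)
∑-* (x ∷ xs) c f = trans (cong (λ s → c * f x + s) (∑-* xs c f)) (sym (*-distribˡ-+ c (f x) _))

∑-+ : ∀ (xs : List A) f g → ∑ xs (λ x → f x + g x) ≡ ∑ xs f + ∑ xs g
∑-+ []       f g = refl
∑-+ (x ∷ xs) f g = trans (cong (λ s → f x + g x + s) (∑-+ xs f g)) (interchange (f x) (g x) (∑ xs f) (∑ xs g))
  where
  interchange : ∀ a b c d → (a + b) + (c + d) ≡ (a + c) + (b + d)
  interchange = solve-∀

∑-mono : ∀ (xs : List A) {f g : A → ℕ} → (∀ x → f x ≤ g x) → ∑ xs f ≤ ∑ xs g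
∑-mono []       f≤g = z≤n
∑-mono (x ∷ xs) f≤g = +-mono-≤ (f≤g x) (∑-mono xs f≤g)

∑-0 : ∀ (xs : List A) → ∑ xs (λ _ → 0) ≡ 0
∑-0 []       = refl
∑-0 (x ∷ xs) = ∑-0 xs

∑-swap : ∀ (xs : List A) (ys : List B) (f : A → B → ℕ) → ∑ xs (λ x → ∑ ys (f x))
    ≡ ∑ ys (λ y → ∑ xs (λ x → f x y))
∑-swap []       ys f = sym (∑-0 ys)
∑-swap (x ∷ xs) ys f = trans (cong (λ s → ∑ ys (f x) + s) (∑-swap xs ys f))
    (sym (∑-+ ys (f x) (λ y → ∑ xs (λ x → f x y))))

term≤∑ : ∀ {xs : List A} f {x} → x ∈ xs → f x ≤ ∑ xs f
term≤∑ {xs = x ∷ xs} f (here refl) = m≤m+n (f x) (∑ xs f)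
term≤∑ {xs = x ∷ xs} f (there x∈)  = ≤-trans (term≤∑ f x∈) (m≤n+m (∑ xs f) (f x))

length-vectors : ∀ (xs : List A) k → length (vectors xs k) ≡ length xs ^ k
length-vectors xs zero    = refl
length-vectors xs (suc k) = begin
  length (vectors xs (suc k))                   ≡⟨ length-∑ (vectors xs (suc k)) ⟩
  ∑ (vectors xs (suc k)) (λ _ → 1)              ≡⟨ ∑-cartesianProductWith _∷_ xs (vectors xs k) (λ _ → 1) ⟩
  ∑ xs (λ _ → ∑ (vectors xs k) (λ _ → 1))       ≡⟨ ∑-const xs _ ⟩
  length xs * ∑ (vectors xs k) (λ _ → 1)
    ≡⟨ cong (length xs *_) (trans (sym (length-∑ (vectors xs k))) (length-vectors xs k)) ⟩
  length xs ^ suc k                             ∎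
  where open ≡-Reasoning

frames : ∀ n k → List (Frame n k)
frames n k = cartesianProduct (points n) (vectors (points n) k)

∑-frames : ∀ (f : Vec (𝔽₂^ n) k → ℕ) → ∑ (frames n k) (f ∘ proj₂) ≡ 2 ^ n * ∑ (vectors (points n) k) f
∑-frames {n} {k} f = begin
  ∑ (frames n k) (f ∘ proj₂)
    ≡⟨ ∑-cartesianProductWith _,_ (points n) _ (f ∘ proj₂) ⟩
  ∑ (points n) (λ _ → ∑ (vectors (points n) k) f)        ≡⟨ ∑-const (points n) _ ⟩
  length (points n) * ∑ (vectors (points n) k) f
    ≡⟨ cong (_* ∑ (vectors (points n) k) f) (length-points n) ⟩
  2 ^ n * ∑ (vectors (points n) k) f                     ∎
  where open ≡-Reasoning

-- If X is the character sum and s the number of ones, then 8 X ≥ N³ and X + 2 s = N³, whence 16 s ≤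
-- 7 N³.
trilinear-count : ∀ (h : 𝔽₂^ n) (τ : 𝔽₂^ n → 𝔽₂^ n → 𝔽₂^ n → 𝔽₂) →
  (∀ y z → Additive (λ x → τ x y z)) → (∀ x z → Additive (λ y → τ x y z)) → (∀ x y → Additive (τ x y)) →
  (∀ x y z → dot h x ≡ false → dot h y ≡ false → dot h z ≡ false → τ x y z ≡ false) →
  16 * ∑ (points n) (λ x → ∑ (points n) (λ y → ∑ (points n) (λ z → 𝟙 (τ x y z))))
      ≤ 7 * (2 ^ n * (2 ^ n * 2 ^ n))
trilinear-count {n} h τ add₁ add₂ add₃ vanish = +-cancelˡ-≤ N³ _ _ (ℤ.drop‿+≤+ (begin
  + (N³ + 16 * s)                      ≡⟨ ℤ.pos-+ N³ (16 * s) ⟩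
  + N³ ℤ.+ + (16 * s)                  ≡⟨ cong (λ i → i ℤ.+ + (16 * s)) cube ⟩
  + N ℤ.* (+ N ℤ.* + N) ℤ.+ + (16 * s) ≤⟨ ℤ.+-monoˡ-≤ (+ (16 * s)) (trilinear-bias h τ add₁ add₂ add₃ vanish) ⟩
  + 8 ℤ.* X ℤ.+ + (16 * s)
    ≡⟨ cong (λ i → + 8 ℤ.* X ℤ.+ i) (trans (cong +_ (*-assoc 8 2 s)) (ℤ.pos-* 8 (2 * s))) ⟩
  + 8 ℤ.* X ℤ.+ + 8 ℤ.* + (2 * s)      ≡⟨ ℤ.*-distribˡ-+ (+ 8) X (+ (2 * s)) ⟨
  + 8 ℤ.* (X ℤ.+ + (2 * s))            ≡⟨ cong (λ i → + 8 ℤ.* i) total ⟩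
  + 8 ℤ.* + N³                         ≡⟨ ℤ.pos-* 8 N³ ⟨
  + (8 * N³)                           ∎))
  where
  open ℤ.≤-Reasoning
  N = 2 ^ n
  N³ = N * (N * N)
  s = ∑ (points n) (λ x → ∑ (points n) (λ y → ∑ (points n) (λ z → 𝟙 (τ x y z))))
  X = ∫ (λ x → ∫ (λ y → ∫ (λ z → χ (τ x y z))))
  cube : + N³ ≡ + N ℤ.* (+ N ℤ.* + N)
  cube = trans (ℤ.pos-* N (N * N)) (cong (λ i → + N ℤ.* i) (ℤ.pos-* N N))
  total : X ℤ.+ + (2 * s) ≡ + N³
  total = ∫-complement _ _ (N * N) (λ x → ∫-complement _ _ N (λ y → ∫-χ (τ x y)))

∑-vectors : ∀ (xs : List A) k f → ∑ (vectors xs (suc k)) f ≡ ∑ xs (λ x → ∑ (vectors xs k) (λ V → f (x ∷ V)))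
∑-vectors xs k f = ∑-cartesianProductWith _∷_ xs (vectors xs k) f

∑-vectors³ : ∀ (xs : List A) k f → ∑ (vectors xs (3 + k)) f ≡
  ∑ (vectors xs k) (λ V → ∑ xs (λ x → ∑ xs (λ y → ∑ xs (λ z → f (x ∷ y ∷ z ∷ V)))))
∑-vectors³ xs k f = begin
  ∑ (vectors xs (3 + k)) f
    ≡⟨ trans (∑-vectors xs (2 + k) f)
        (∑-cong xs (λ x → trans (∑-vectors xs (1 + k) _) (∑-cong xs (λ y → ∑-vectors xs k _)))) ⟩
  ∑ xs (λ x → ∑ xs (λ y → ∑ xs (λ z → ∑ Vs (λ V → f (x ∷ y ∷ z ∷ V)))))
    ≡⟨ ∑-cong xs (λ x → ∑-cong xs (λ y → ∑-swap xs Vs (λ z V → f (x ∷ y ∷ z ∷ V)))) ⟩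
  ∑ xs (λ x → ∑ xs (λ y → ∑ Vs (λ V → ∑ xs (λ z → f (x ∷ y ∷ z ∷ V)))))
    ≡⟨ ∑-cong xs (λ x → ∑-swap xs Vs (λ y V → ∑ xs (λ z → f (x ∷ y ∷ z ∷ V)))) ⟩
  ∑ xs (λ x → ∑ Vs (λ V → ∑ xs (λ y → ∑ xs (λ z → f (x ∷ y ∷ z ∷ V)))))
    ≡⟨ ∑-swap xs Vs (λ x V → ∑ xs (λ y → ∑ xs (λ z → f (x ∷ y ∷ z ∷ V)))) ⟩
  ∑ Vs (λ V → ∑ xs (λ x → ∑ xs (λ y → ∑ xs (λ z → f (x ∷ y ∷ z ∷ V))))) ∎
  where
  open ≡-Reasoning
  Vs = vectors xs k


-- All vectors but the first three are fixed. The vector h depends on them, but the bound 7/16 does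
-- not.
ω-count : ∀ n k → 16 * ∑ (vectors (points n) (3 + k)) (𝟙 ∘ ω ∘ toList) ≤ 7 * (2 ^ n) ^ (3 + k)
ω-count n k = begin
  16 * ∑ (vectors (points n) (3 + k)) (𝟙 ∘ ω ∘ toList)
    ≡⟨ cong (16 *_) (∑-vectors³ (points n) k _) ⟩
  16 * ∑ Vs (λ V → ∑ X (λ x → ∑ X (λ y → ∑ X (λ z → 𝟙 (ω (x ∷ y ∷ z ∷ toList V))))))
    ≡⟨ ∑-* Vs 16 _ ⟨
  ∑ Vs (λ V → 16 * ∑ X (λ x → ∑ X (λ y → ∑ X (λ z → 𝟙 (ω (x ∷ y ∷ z ∷ toList V))))))
    ≤⟨ ∑-mono Vs fixed ⟩
  ∑ Vs (λ _ → 7 * (N * (N * N)))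
    ≡⟨ ∑-const Vs _ ⟩
  length Vs * (7 * (N * (N * N)))
    ≡⟨ cong (_* (7 * (N * (N * N)))) (trans (length-vectors X k) (cong (_^ k) (length-points n))) ⟩
  N ^ k * (7 * (N * (N * N)))
    ≡⟨ lemma (N ^ k) N ⟩
  7 * N ^ (3 + k) ∎
  where
  open ≤-Reasoning
  X = points n
  N = 2 ^ n
  Vs = vectors X k
  lemma : ∀ M N → M * (7 * (N * (N * N))) ≡ 7 * (N * (N * (N * M)))
  lemma = solve-∀
  fixed : ∀ V → 16 * ∑ X (λ x → ∑ X (λ y → ∑ X (λ z → 𝟙 (ω (x ∷ y ∷ z ∷ toList V))))) ≤ 7 * (N * (N * N))
  fixed V with trilinear-vanishes V
  ... | h , vanish = trilinear-count h (λ x y z → ω (x ∷ y ∷ z ∷ toList V))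
    (λ y z x x′ → ω-⊕ x x′ _)
    (λ x z y y′ → trans (move₂ x (y ⊕ y′) z)
        (trans (ω-⊕ y y′ _) (sym (cong₂ _xor_ (move₂ x y z) (move₂ x y′ z)))))
    (λ x y z z′ → trans (move₃ x y (z ⊕ z′))
        (trans (ω-⊕ z z′ _) (sym (cong₂ _xor_ (move₃ x y z) (move₃ x y z′)))))
    vanish
    where
    move₂ : ∀ x y z → ω (x ∷ y ∷ z ∷ toList V) ≡ ω (y ∷ x ∷ z ∷ toList V)
    move₂ x y z = ω-symmetric (swap x y refl)
    move₃ : ∀ x y z → ω (x ∷ y ∷ z ∷ toList V) ≡ ω (z ∷ x ∷ y ∷ toList V)
    move₃ x y z = ω-symmetric (shift z (x ∷ y ∷ []) (toList V))

-- Counting tuples of vectors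

∑-≟ᵥ : ∀ (y : 𝔽₂^ n) → ∑ (points n) (λ x → 𝟙 (does (x ≟ᵥ y))) ≡ 1
∑-≟ᵥ []          = refl
∑-≟ᵥ {suc n} (false ∷ y) = trans (∑-points n (λ x → 𝟙 (does (x ≟ᵥ (false ∷ y)))))
    (cong₂ _+_ (∑-≟ᵥ y) (∑-0 (points n)))
∑-≟ᵥ {suc n} (true ∷ y)  = trans (∑-points n (λ x → 𝟙 (does (x ≟ᵥ (true ∷ y)))))
    (cong₂ _+_ (∑-0 (points n)) (∑-≟ᵥ y))

-- The first vector with coefficient 1 is determined by `w` and the vectors after it; those before
-- it are free.
combination-equidistributed : ∀ {x : 𝔽₂^ k} → x ≢ 𝟎 → ∀ (w : 𝔽₂^ n) →
  2 ^ n * ∑ (vectors (points n) k) (λ V → 𝟙 (does (combination V x ≟ᵥ w))) ≡ (2 ^ n) ^ k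
combination-equidistributed {x = []} x≢𝟎 w = contradiction refl x≢𝟎
combination-equidistributed {suc k} {n} {true ∷ x} x≢𝟎 w = cong (2 ^ n *_) (begin
  ∑ (vectors (points n) (suc k)) (λ V → 𝟙 (does (combination V (true ∷ x) ≟ᵥ w)))
    ≡⟨ ∑-vectors (points n) k _ ⟩
  ∑ (points n) (λ v → ∑ Vs (λ V → 𝟙 (does (((true · v) ⊕ combination V x) ≟ᵥ w))))
    ≡⟨ ∑-swap (points n) Vs (λ v V → 𝟙 (does (((true · v) ⊕ combination V x) ≟ᵥ w))) ⟩
  ∑ Vs (λ V → ∑ (points n) (λ v → 𝟙 (does (((true · v) ⊕ combination V x) ≟ᵥ w))))
    ≡⟨ ∑-cong Vs (λ V →
        trans (∑-cong (points n)
        (λ v → cong 𝟙 (does-⇔ (mk⇔ (solve V v) (unsolve V v)) (_ ≟ᵥ w) (v ≟ᵥ (combination V x ⊕ w)))))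
                              (∑-≟ᵥ (combination V x ⊕ w))) ⟩
  ∑ Vs (λ _ → 1)
    ≡⟨ trans (sym (length-∑ Vs)) (trans (length-vectors (points n) k) (cong (_^ k) (length-points n))) ⟩
  (2 ^ n) ^ k ∎)
  where
  open ≡-Reasoning
  Vs = vectors (points n) k
  solve : ∀ V v → (true · v) ⊕ combination V x ≡ w → v ≡ combination V x ⊕ w
  solve V v eq = trans (sym (⊕-cancelˡ (combination V x) v))
    (cong (combination V x ⊕_) (trans (⊕-comm _ v) (trans (cong (_⊕ combination V x) (sym (true·≡id v))) eq)))
  unsolve : ∀ V v → v ≡ combination V x ⊕ w → (true · v) ⊕ combination V x ≡ w
  unsolve V v eq = trans (cong (_⊕ combination V x) (trans (true·≡id v) eq))
    (trans (⊕-comm _ (combination V x)) (⊕-cancelˡ (combination V x) w))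
combination-equidistributed {suc k} {n} {false ∷ x} x≢𝟎 w = cong (2 ^ n *_) (begin
  ∑ (vectors (points n) (suc k)) (λ V → 𝟙 (does (combination V (false ∷ x) ≟ᵥ w)))
    ≡⟨ ∑-vectors (points n) k _ ⟩
  ∑ (points n) (λ v → ∑ Vs (λ V → 𝟙 (does (((false · v) ⊕ combination V x) ≟ᵥ w))))
    ≡⟨ ∑-cong (points n)
        (λ v → ∑-cong Vs (λ V → cong (λ u → 𝟙 (does (u ≟ᵥ w)))
        (trans (cong (_⊕ combination V x) (false·≡𝟎 v)) (⊕-identityˡ _)))) ⟩
  ∑ (points n) (λ _ → ∑ Vs (λ V → 𝟙 (does (combination V x ≟ᵥ w))))
    ≡⟨ ∑-const (points n) _ ⟩
  length (points n) * ∑ Vs (λ V → 𝟙 (does (combination V x ≟ᵥ w)))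
    ≡⟨ cong (_* ∑ Vs (λ V → 𝟙 (does (combination V x ≟ᵥ w)))) (length-points n) ⟩
  2 ^ n * ∑ Vs (λ V → 𝟙 (does (combination V x ≟ᵥ w)))
    ≡⟨ combination-equidistributed (x≢𝟎 ∘ cong (false ∷_)) w ⟩
  (2 ^ n) ^ k ∎)
  where
  open ≡-Reasoning
  Vs = vectors (points n) k

linearlyIndependent? : (V : Vec (𝔽₂^ n) k) → Dec (LinearlyIndependent V)
linearlyIndependent? V = decide-∀ ∈-points (λ x → (combination V x ≟ᵥ 𝟎) →-dec (x ≟ᵥ 𝟎))

relation? : (V : Vec (𝔽₂^ n) k) (x : 𝔽₂^ k) → Dec (x ≢ 𝟎 × combination V x ≡ 𝟎)
relation? V x = ¬? (x ≟ᵥ 𝟎) ×-dec (combination V x ≟ᵥ 𝟎)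

1≤independent+relations : ∀ (V : Vec (𝔽₂^ n) k) →
  1 ≤ 𝟙 (does (linearlyIndependent? V)) + ∑ (points k) (λ x → 𝟙 (does (relation? V x)))
1≤independent+relations {k = k} V with decide-∃ ∈-points (relation? V)
... | yes (x , rel) = ≤-trans (≤-trans (≤-reflexive (cong 𝟙 (sym (dec-true (relation? V x) rel))))
    (term≤∑ (λ x → 𝟙 (does (relation? V x))) (∈-points x)))
                              (m≤n+m _ (𝟙 (does (linearlyIndependent? V))))
... | no ¬rel = ≤-trans (≤-reflexive (cong 𝟙 (sym (dec-true (linearlyIndependent? V) independent)))) (m≤m+n _ _)
  where
  independent : LinearlyIndependent V
  independent x eq with x ≟ᵥ 𝟎
  ... | yes x≡𝟎 = x≡𝟎
  ... | no  x≢𝟎 = contradiction (x , x≢𝟎 , eq) ¬rel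

-- Union bound: each of fewer than 2^k nontrivial relations holds with probability 2^-n, and 2^(k-n)
-- ≤ 1/16.
relations-rare : ∀ n k → k + 4 ≤ n →
  16 * ∑ (vectors (points n) k) (λ V → ∑ (points k) (λ x → 𝟙 (does (relation? V x)))) ≤ (2 ^ n) ^ k
relations-rare n k k+4≤n = *-cancelˡ-≤ (2 ^ k) {{m^n≢0 2 k}} (begin
  2 ^ k * (16 * s)       ≡⟨ *-assoc (2 ^ k) 16 s ⟨
  2 ^ k * 2 ^ 4 * s      ≡⟨ cong (_* s) (^-distribˡ-+-* 2 k 4) ⟨
  2 ^ (k + 4) * s        ≤⟨ *-monoˡ-≤ s (^-monoʳ-≤ 2 k+4≤n) ⟩
  2 ^ n * s              ≡⟨ cong (2 ^ n *_) (∑-swap Vs (points k) (λ V x → 𝟙 (does (relation? V x)))) ⟩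
  2 ^ n * ∑ (points k) (λ x → ∑ Vs (λ V → 𝟙 (does (relation? V x))))
                         ≡⟨ ∑-* (points k) (2 ^ n) _ ⟨
  ∑ (points k) (λ x → 2 ^ n * ∑ Vs (λ V → 𝟙 (does (relation? V x))))
                         ≤⟨ ∑-mono (points k) each ⟩
  ∑ (points k) (λ _ → (2 ^ n) ^ k)
                         ≡⟨ ∑-const (points k) _ ⟩
  length (points k) * (2 ^ n) ^ k
                         ≡⟨ cong (_* (2 ^ n) ^ k) (length-points k) ⟩
  2 ^ k * (2 ^ n) ^ k    ∎)
  where
  open ≤-Reasoning
  Vs = vectors (points n) k
  s = ∑ Vs (λ V → ∑ (points k) (λ x → 𝟙 (does (relation? V x))))
  each : ∀ x → 2 ^ n * ∑ Vs (λ V → 𝟙 (does (relation? V x))) ≤ (2 ^ n) ^ k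
  each x with x ≟ᵥ 𝟎
  ... | yes _   = ≤-trans (≤-reflexive (trans (cong (2 ^ n *_) (∑-0 Vs)) (*-zeroʳ (2 ^ n)))) z≤n
  ... | no  x≢𝟎 = ≤-reflexive (combination-equidistributed x≢𝟎 (𝟎 {n}))

independent-count : ∀ n k → k + 4 ≤ n →
  15 * (2 ^ n) ^ k ≤ 16 * ∑ (vectors (points n) k) (λ V → 𝟙 (does (linearlyIndependent? V)))
independent-count n k k+4≤n = +-cancelˡ-≤ M _ _ (begin
  M + 15 * M         ≡⟨ cong (16 *_) (sym count) ⟩
  16 * ∑ Vs (λ _ → 1)
    ≤⟨ *-monoʳ-≤ 16 (∑-mono Vs 1≤independent+relations) ⟩
  16 * ∑ Vs (λ V → 𝟙 (does (linearlyIndependent? V)) + ∑ (points k) (λ x → 𝟙 (does (relation? V x))))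
    ≡⟨ cong (16 *_) (∑-+ Vs _ _) ⟩
  16 * (i + r)       ≡⟨ *-distribˡ-+ 16 i r ⟩
  16 * i + 16 * r    ≤⟨ +-monoʳ-≤ (16 * i) (relations-rare n k k+4≤n) ⟩
  16 * i + M         ≡⟨ +-comm (16 * i) M ⟩
  M + 16 * i         ∎)
  where
  open ≤-Reasoning
  M = (2 ^ n) ^ k
  Vs = vectors (points n) k
  i = ∑ Vs (λ V → 𝟙 (does (linearlyIndependent? V)))
  r = ∑ Vs (λ V → ∑ (points k) (λ x → 𝟙 (does (relation? V x))))
  count : ∑ Vs (λ _ → 1) ≡ M
  count = trans (sym (length-∑ Vs)) (trans (length-vectors (points n) k) (cong (_^ k) (length-points n)))

-- Parametrizations of affine subspaces

combination-injective : ∀ (V : Vec (𝔽₂^ n) k) → LinearlyIndependent V → ∀ {x y} →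
    combination V x ≡ combination V y → x ≡ y
combination-injective V ind {x} {y} eq =
  ⊕≡𝟎⇒≡ (ind (x ⊕ y) (trans (combination-⊕ V x y) (trans (cong (_⊕ combination V y) eq) (⊕-self _))))

⊕-injective : ∀ (o : 𝔽₂^ n) {x y} → o ⊕ x ≡ o ⊕ y → x ≡ y
⊕-injective o {x} {y} eq = trans (sym (⊕-cancelˡ o x)) (trans (cong (o ⊕_) eq) (⊕-cancelˡ o y))

affine-injective : ∀ (φ : Frame n k) → LinearlyIndependent (proj₂ φ) → ∀ {x y} → affine φ x ≡ affine φ y → x ≡ y
affine-injective (o , V) ind eq = combination-injective V ind (⊕-injective o eq)

compose : Frame n k → Frame k l → Frame n l
compose φ@(_ , V) (o , W) = affine φ o , Vec.map (combination V) W

combination-· : ∀ (V : Vec (𝔽₂^ n) k) b x → b · combination V x ≡ combination V (b · x)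
combination-· V false x = trans (false·≡𝟎 _) (sym (trans (cong (combination V) (false·≡𝟎 x)) (combination-𝟎 V)))
combination-· V true  x = trans (true·≡id _) (cong (combination V) (sym (true·≡id x)))

combination-map : ∀ (V : Vec (𝔽₂^ n) k) (W : Vec (𝔽₂^ k) l) x →
                  combination (Vec.map (combination V) W) x ≡ combination V (combination W x)
combination-map V []      []      = sym (combination-𝟎 V)
combination-map V (w ∷ W) (b ∷ x) =
  trans (cong₂ _⊕_ (combination-· V b w) (combination-map V W x))
      (sym (combination-⊕ V (b · w) (combination W x)))

affine-compose : ∀ (φ : Frame n k) (α : Frame k l) x → affine (compose φ α) x ≡ affine φ (affine α x)
affine-compose (o , V) (p , W) x = trans (⊕-assoc o (combination V p) _)
  (cong (o ⊕_) (trans (cong (combination V p ⊕_) (combination-map V W x))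
      (sym (combination-⊕ V p (combination W x)))))

map-injective : ∀ (V : Vec (𝔽₂^ n) k) → LinearlyIndependent V → ∀ (W W′ : Vec (𝔽₂^ k) l) →
                Vec.map (combination V) W ≡ Vec.map (combination V) W′ → W ≡ W′
map-injective V ind []      []        _  = refl
map-injective V ind (w ∷ W) (w′ ∷ W′) eq =
  let h , t = ∷-injective eq in cong₂ _∷_ (combination-injective V ind h) (map-injective V ind W W′ t)

compose-injective : ∀ (φ : Frame n k) → LinearlyIndependent (proj₂ φ) → ∀ {α β : Frame k l} →
                    compose φ α ≡ compose φ β → α ≡ β
compose-injective φ ind {_ , W} {_ , W′} eq =
  let h , t = ,-injective eq in cong₂ _,_ (affine-injective φ ind h) (map-injective (proj₂ φ) ind W W′ t)

module _ (φ : Frame n k) {A : 𝔽₂^ n → Bool} (φ-par : Parametrizes φ A) where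

  affine-∈ : ∀ x → T (A (affine φ x))
  affine-∈ x = Equivalence.from (proj₂ φ-par (affine φ x)) (x , refl)

  coordinates : ∀ y → T (A y) → ∃[ x ] affine φ x ≡ y
  coordinates y = Equivalence.to (proj₂ φ-par y)

compose-parametrizes : ∀ (φ : Frame n k) {A} → Parametrizes φ A → (α : Frame k k) →
                       LinearlyIndependent (proj₂ α) → Parametrizes (compose φ α) A
compose-parametrizes {k = k} φ@(o , V) {A} φ-par@(indV , _) α@(p , W) indW = independent ,
    λ y → mk⇔ (to y) (from y)
  where
  independent : LinearlyIndependent (Vec.map (combination V) W)
  independent x eq = indW x (indV (combination W x) (trans (sym (combination-map V W x)) eq))
  to : ∀ y → T (A y) → ∃[ x ] affine (compose φ α) x ≡ y
  to y y∈A =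
    let z , φz≡y = coordinates φ φ-par y y∈A
        x , αx≡z = injective⇒surjective _≟ᵥ_ (points-unique k) ∈-points {affine α} (affine-injective α indW) z
    in x , trans (affine-compose φ α x) (trans (cong (affine φ) αx≡z) φz≡y)
  from : ∀ y → (∃[ x ] affine (compose φ α) x ≡ y) → T (A y)
  from y (x , eq) = subst (T ∘ A) (trans (sym (affine-compose φ α x)) eq) (affine-∈ φ φ-par (affine α x))

preimages : ∀ (V : Vec (𝔽₂^ n) k) (W : Vec (𝔽₂^ n) l) → (∀ x → ∃[ c ] combination V c ≡ combination W x) →
            ∃[ C ] Vec.map (combination V) C ≡ W
preimages V []      span = [] , refl
preimages V (w ∷ W) span =
  let c , Vc≡ = span (true ∷ 𝟎)
      C , VC≡ = preimages V W (λ x → let c , eq = span (false ∷ x) in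
                  c , trans eq (trans (cong (_⊕ combination W x) (false·≡𝟎 w)) (⊕-identityˡ _)))
  in c ∷ C , cong₂ _∷_ (trans Vc≡ (trans (cong₂ _⊕_ (true·≡id w) (combination-𝟎 W)) (⊕-identityʳ w))) VC≡

decompose : ∀ (φ ψ : Frame n k) {A} → Parametrizes φ A → Parametrizes ψ A →
            ∃[ α ] LinearlyIndependent (proj₂ α) × ψ ≡ compose φ α
decompose φ@(o , V) ψ@(p , W) {A} φ-par ψ-par = (x₀ , C) , independent , cong₂ _,_ p≡ (sym VC≡W)
  where
  coord : ∀ x → ∃[ c ] affine φ c ≡ affine ψ x
  coord x = coordinates φ φ-par (affine ψ x) (affine-∈ ψ ψ-par x)
  x₀ = proj₁ (coord 𝟎)
  affineψ𝟎 : affine ψ 𝟎 ≡ p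
  affineψ𝟎 = trans (cong (p ⊕_) (combination-𝟎 W)) (⊕-identityʳ p)
  p≡ : p ≡ affine φ x₀
  p≡ = sym (trans (proj₂ (coord 𝟎)) affineψ𝟎)
  span : ∀ x → ∃[ c ] combination V c ≡ combination W x
  -- `x₀` holds the coordinates of the base point of ψ, so adding it passes from points to
  -- directions.
  span x = proj₁ (coord x) ⊕ x₀ , (begin
    combination V (y ⊕ x₀)                                     ≡⟨ combination-⊕ V y x₀ ⟩
    combination V y ⊕ combination V x₀                         ≡⟨ ⊕-identityˡ _ ⟨
    𝟎 ⊕ (combination V y ⊕ combination V x₀)
      ≡⟨ cong (_⊕ (combination V y ⊕ combination V x₀)) (⊕-self o) ⟨
    (o ⊕ o) ⊕ (combination V y ⊕ combination V x₀)             ≡⟨ ⊕-interchange o o _ _ ⟩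
    affine φ y ⊕ affine φ x₀                                   ≡⟨ cong₂ _⊕_ (proj₂ (coord x)) (sym p≡) ⟩
    (p ⊕ combination W x) ⊕ p                                  ≡⟨ ⊕-comm _ p ⟩
    p ⊕ (p ⊕ combination W x)                                  ≡⟨ ⊕-cancelˡ p _ ⟩
    combination W x                                            ∎)
    where
    open ≡-Reasoning
    y = proj₁ (coord x)
  C = proj₁ (preimages V W span)
  VC≡W : Vec.map (combination V) C ≡ W
  VC≡W = proj₂ (preimages V W span)
  independent : LinearlyIndependent C
  independent x eq = proj₁ ψ-par x (begin
    combination W x                              ≡⟨ cong (λ W → combination W x) VC≡W ⟨
    combination (Vec.map (combination V) C) x    ≡⟨ combination-map V C x ⟩
    combination V (combination C x)              ≡⟨ cong (combination V) eq ⟩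
    combination V 𝟎                              ≡⟨ combination-𝟎 V ⟩
    𝟎                                            ∎)
    where open ≡-Reasoning

vectors-unique : ∀ {xs : List A} → Unique xs → ∀ k → Unique (vectors xs k)
vectors-unique xs! zero    = [] ∷ []
vectors-unique xs! (suc k) = Unique.cartesianProductWith⁺ _∷_ ∷-injective xs! (vectors-unique xs! k)

frames-unique : ∀ n k → Unique (frames n k)
frames-unique n k = Unique.cartesianProduct⁺ (points-unique n) (vectors-unique (points-unique n) k)

∣AGL∣ : ℕ → ℕ
∣AGL∣ k = ∑ (frames k k) (λ α → 𝟙 (does (linearlyIndependent? (proj₂ α))))

-- The affine group of F₂^k acts on the parametrizations of A by composition. `decompose` makes the
-- action transitive and `compose-injective` makes it free.
parametrizations : ∀ (φ : Frame n k) {A} → Parametrizes φ A →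
                   ∑ (frames n k) (λ ψ → 𝟙 (does (parametrizes? ψ A))) ≡ ∣AGL∣ k
parametrizations {n} {k} φ {A} φ-par = begin
  ∑ (frames n k) (λ ψ → 𝟙 (does (parametrizes? ψ A)))  ≡⟨ length-filter P? (frames n k) ⟨
  length (filter P? (frames n k))
    ≡⟨ ≤-antisym (unique-⊆⇒length≤ (Unique.filter⁺ P? (frames-unique n k)) to)
                                                                    (unique-⊆⇒length≤ images! from) ⟩
  length (map (compose φ) (filter L? (frames k k)))    ≡⟨ length-map (compose φ) (filter L? (frames k k)) ⟩
  length (filter L? (frames k k))                      ≡⟨ length-filter L? (frames k k) ⟩
  ∣AGL∣ k                                              ∎
  where
  open ≡-Reasoning
  P? : ∀ ψ → Dec (Parametrizes ψ A)
  P? ψ = parametrizes? ψ A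
  L? : ∀ (α : Frame k k) → Dec (LinearlyIndependent (proj₂ α))
  L? α = linearlyIndependent? (proj₂ α)
  images! : Unique (map (compose φ) (filter L? (frames k k)))
  images! = Unique.map⁺ (compose-injective φ (proj₁ φ-par)) (Unique.filter⁺ L? (frames-unique k k))
  to : ∀ {ψ} → ψ ∈ filter P? (frames n k) → ψ ∈ map (compose φ) (filter L? (frames k k))
  to {ψ} ψ∈ with decompose φ ψ φ-par (proj₂ (∈-filter⁻ P? {xs = frames n k} ψ∈))
  ... | α , ind , refl = ∈-map⁺ (compose φ) (∈-filter⁺ L? (∈-frames α) ind)
  from : ∀ {ψ} → ψ ∈ map (compose φ) (filter L? (frames k k)) → ψ ∈ filter P? (frames n k)
  from ψ∈ with ∈-map⁻ (compose φ) ψ∈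
  ... | α , α∈ , refl = ∈-filter⁺ P? (∈-frames (compose φ α))
                          (compose-parametrizes φ φ-par α (proj₂ (∈-filter⁻ L? {xs = frames k k} α∈)))

≗? : (f g : 𝔽₂^ n → Bool) → Dec (f ≗ g)
≗? {zero}  f g = map′ (λ { eq [] → eq }) (λ f≗g → f≗g []) (f [] Bool.≟ g [])
≗? {suc n} f g = map′ (λ { (p , q) (false ∷ x) → p x ; (p , q) (true ∷ x) → q x })
                      (λ f≗g → f≗g ∘ (false ∷_) , f≗g ∘ (true ∷_))
                      (≗? (f ↾ false) (g ↾ false) ×-dec ≗? (f ↾ true) (g ↾ true))

𝟙-∧ : ∀ b c → 𝟙 (b ∧ c) ≡ 𝟙 b * 𝟙 c
𝟙-∧ false c = refl
𝟙-∧ true  c = sym (+-identityʳ (𝟙 c))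

∑-functions-≗ : ∀ (g : 𝔽₂^ n → Bool) → ∑ (functions n) (λ f → 𝟙 (does (≗? f g))) ≡ 1
∑-functions-≗ {zero} g with g []
... | false = refl
... | true  = refl
∑-functions-≗ {suc n} g = begin
  ∑ (functions (suc n)) (λ f → 𝟙 (does (≗? f g)))
    ≡⟨ ∑-cartesianProductWith glue (functions n) (functions n) _ ⟩
  ∑ (functions n) (λ f₀ → ∑ (functions n) (λ f₁ → 𝟙 (b₀ f₀ ∧ b₁ f₁)))
    ≡⟨ ∑-cong (functions n) (λ f₀ → trans (∑-cong (functions n) (λ f₁ → 𝟙-∧ (b₀ f₀) (b₁ f₁)))
        (∑-* (functions n) (𝟙 (b₀ f₀)) (𝟙 ∘ b₁))) ⟩
  ∑ (functions n) (λ f₀ → 𝟙 (b₀ f₀) * ∑ (functions n) (𝟙 ∘ b₁))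
    ≡⟨ ∑-cong (functions n) (λ f₀ → trans (cong (𝟙 (b₀ f₀) *_) (∑-functions-≗ (g ↾ true)))
        (*-identityʳ (𝟙 (b₀ f₀)))) ⟩
  ∑ (functions n) (𝟙 ∘ b₀)
    ≡⟨ ∑-functions-≗ (g ↾ false) ⟩
  1 ∎
  where
  open ≡-Reasoning
  b₀ b₁ : (𝔽₂^ n → Bool) → Bool
  b₀ f = does (≗? f (g ↾ false))
  b₁ f = does (≗? f (g ↾ true))

image : Frame n k → 𝔽₂^ n → Bool
image φ y = does (decide-∃ ∈-points (λ x → affine φ x ≟ᵥ y))

T-does : {P : Set ℓp} (P? : Dec P) → T (does P?) ⇔ P
T-does (yes p) = mk⇔ (λ _ → p) _
T-does (no ¬p) = mk⇔ (λ ()) ¬p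

-- A frame with independent directions parametrizes only its image, which `functions n` lists once
-- up to pointwise equality. With `parametrizations` this allows pairs of a subspace and a frame to
-- be counted in two ways.
subspaces : ∀ (φ : Frame n k) → ∑ (functions n) (λ A → 𝟙 (does (parametrizes? φ A)))
    ≡ 𝟙 (does (linearlyIndependent? (proj₂ φ)))
subspaces {n} φ@(o , V) with linearlyIndependent? V
... | yes ind = trans (∑-cong (functions n)
    (λ A → cong 𝟙 (does-⇔ (mk⇔ to from) (parametrizes? φ A) (≗? A (image φ)))))
    (trans (∑-functions-≗ (image φ)) (cong 𝟙 (sym (dec-true (linearlyIndependent? V) ind))))
  where
  T-ext : ∀ {a b} → T a ⇔ T b → a ≡ b
  T-ext {false} {false} _ = refl
  T-ext {false} {true}  e = contradiction (Equivalence.from e _) λ ()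
  T-ext {true}  {false} e = contradiction (Equivalence.to e _) λ ()
  T-ext {true}  {true}  _ = refl
  image-spec : ∀ y → T (image φ y) ⇔ (∃[ x ] affine φ x ≡ y)
  image-spec y = T-does (decide-∃ ∈-points (λ x → affine φ x ≟ᵥ y))
  to : ∀ {A} → Parametrizes φ A → A ≗ image φ
  to (_ , h) y = T-ext (mk⇔ (Equivalence.from (image-spec y) ∘ Equivalence.to (h y))
                            (Equivalence.from (h y) ∘ Equivalence.to (image-spec y)))
  from : ∀ {A} → A ≗ image φ → Parametrizes φ A
  from A≗ = ind , λ y → subst (λ b → T b ⇔ (∃[ x ] affine φ x ≡ y)) (sym (A≗ y)) (image-spec y)
... | no ¬ind = trans (∑-cong (functions n) (λ A → cong 𝟙 (dec-false (parametrizes? φ A) (¬ind ∘ proj₁))))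
    (trans (∑-0 (functions n)) (cong 𝟙 (sym (dec-false (linearlyIndependent? V) ¬ind))))

-- Rejection

coeff-𝟏 : ∀ (f : 𝔽₂^ n → 𝔽₂) → coeff f 𝟏 ≡ Σ₂ (points n) f
coeff-𝟏 {zero}  f = sym (Bool.xor-identityʳ (f []))
coeff-𝟏 {suc n} f = trans (coeff-𝟏 (λ x → f (false ∷ x) xor f (true ∷ x)))
  (trans (Σ₂-xor (points n) (f ↾ false) (f ↾ true)) (sym (Σ₂-points n f)))

∣I∣≤n : ∀ (I : Subset n) → ∣ I ∣ ≤ n
∣I∣≤n []            = z≤n
∣I∣≤n (inside  ∷ I) = s≤s (∣I∣≤n I)
∣I∣≤n (outside ∷ I) = m≤n⇒m≤1+n (∣I∣≤n I)

full : ∀ (I : Subset n) → n ≤ ∣ I ∣ → I ≡ 𝟏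
full []            _         = refl
full (inside  ∷ I) (s≤s n≤I) = cong (inside ∷_) (full I n≤I)
full (outside ∷ I) n<I       = contradiction (≤-trans n<I (∣I∣≤n I)) 1+n≰n

-- In `suc d` variables the only monomial of degree above d is the full one, and its coefficient is
-- the sum of all values.
Σ₂≡false⇒deg≤ : ∀ {d} (f : 𝔽₂^ (suc d) → 𝔽₂) → Σ₂ (points (suc d)) f ≡ false → deg f ≤ d
Σ₂≡false⇒deg≤ f Σf≡0 = Degree<⇒deg≤ f (λ I d<I → trans (cong (coeff f) (full I d<I)) (trans (coeff-𝟏 f) Σf≡0))

Σ₂-↭ : ∀ {xs ys : List A} (f : A → 𝔽₂) → xs ↭ ys → Σ₂ xs f ≡ Σ₂ ys f
Σ₂-↭ f refl              = refl
Σ₂-↭ f (prep x p)        = cong (f x xor_) (Σ₂-↭ f p)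
Σ₂-↭ {ys = _ ∷ _ ∷ ys} f (swap x y p) = trans (cong (λ s → f x xor (f y xor s)) (Σ₂-↭ f p))
  (trans (sym (Bool.xor-assoc (f x) (f y) _)) (trans (cong (_xor Σ₂ ys f) (Bool.xor-comm (f x) (f y)))
      (Bool.xor-assoc (f y) (f x) _)))
Σ₂-↭ f (↭.trans p q)     = trans (Σ₂-↭ f p) (Σ₂-↭ f q)

-- Both sides sum f over A, listed without repetition in two orders. This is needed because the
-- frame witnessing `Rejects` need not be the one being counted.
Σ₂-parametrization : ∀ (f : 𝔽₂^ n → 𝔽₂) (φ ψ : Frame n k) {A} → Parametrizes φ A → Parametrizes ψ A →
                     Σ₂ (points k) (f ∘ affine φ) ≡ Σ₂ (points k) (f ∘ affine ψ)
Σ₂-parametrization {n} {k} f φ ψ {A} φ-par ψ-par =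
  trans (sym (Σ₂-map (affine φ) (points k) f))
    (trans (Σ₂-↭ f (∼bag⇒↭ (unique∧set⇒bag (images! φ φ-par) (images! ψ ψ-par)
        (mk⇔ (⊆ φ ψ φ-par ψ-par) (⊆ ψ φ ψ-par φ-par)))))
           (Σ₂-map (affine ψ) (points k) f))
  where
  images! : ∀ (φ : Frame n k) → Parametrizes φ A → Unique (map (affine φ) (points k))
  images! φ φ-par = Unique.map⁺ (affine-injective φ (proj₁ φ-par)) (points-unique k)
  ⊆ : ∀ (φ ψ : Frame n k) → Parametrizes φ A → Parametrizes ψ A → ∀ {y} →
      y ∈ map (affine φ) (points k) → y ∈ map (affine ψ) (points k)
  ⊆ φ ψ φ-par ψ-par y∈ with ∈-map⁻ (affine φ) y∈
  ... | x , _ , refl with coordinates ψ ψ-par (affine φ x) (affine-∈ φ φ-par x)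
  ...   | z , eq = subst (_∈ map (affine ψ) (points k)) eq (∈-map⁺ (affine ψ) (∈-points z))

rejects⇒ω : ∀ d {A} → Rejects {n} d (suc d) (S (suc d) n) A → ∀ φ → Parametrizes φ A →
    ω (toList (proj₂ φ)) ≡ true
rejects⇒ω {n} d {A} (ψ , ψ-par , deg≰d) φ@(o , V) φ-par = begin
  ω (toList V)                                                 ≡⟨ ∂-S (suc d) n (toList V) o (length-toList V) ⟨
  ∂ (S (suc d) n) (toList V) o                                 ≡⟨ Σ₂-affine (S (suc d) n) o V ⟨
  Σ₂ (points (suc d)) (S (suc d) n ∘ affine φ)
    ≡⟨ Σ₂-parametrization (S (suc d) n) φ ψ φ-par ψ-par ⟩
  Σ₂ (points (suc d)) (S (suc d) n ∘ affine ψ)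
    ≡⟨ Bool.¬-not (deg≰d ∘ Σ₂≡false⇒deg≤ (S (suc d) n ∘ affine ψ)) ⟩
  true                                                         ∎
  where open ≡-Reasoning

-- Double counting of subspaces and frames

∑-filter : {P : A → Set ℓp} (P? : ∀ x → Dec (P x)) → ∀ xs f → ∑ (filter P? xs)
    f ≡ ∑ xs (λ x → 𝟙 (does (P? x)) * f x)
∑-filter P? []       f = refl
∑-filter P? (x ∷ xs) f with does (P? x)
... | true  = cong₂ _+_ (sym (+-identityʳ (f x))) (∑-filter P? xs f)
... | false = ∑-filter P? xs f

module _ (n k : ℕ) where

  affineSubspaces : List (𝔽₂^ n → Bool)
  affineSubspaces = filter (isAffineSubspace? k) (functions n)

  parametrizations-of : ∀ A → ∑ (frames n k) (λ φ → 𝟙 (does (parametrizes? φ A)))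
      ≡ 𝟙 (does (isAffineSubspace? k A)) * ∣AGL∣ k
  parametrizations-of A with isAffineSubspace? k A
  ... | yes (φ , φ-par) = trans (parametrizations φ φ-par) (trans (sym (+-identityʳ (∣AGL∣ k)))
      (cong (λ b → 𝟙 b * ∣AGL∣ k) (sym (dec-true (isAffineSubspace? k A) (φ , φ-par)))))
  ... | no  ¬affine     = trans (∑-cong (frames n k)
      (λ φ → cong 𝟙 (dec-false (parametrizes? φ A) (λ φ-par → ¬affine (φ , φ-par)))))
      (trans (∑-0 (frames n k)) (cong (λ b → 𝟙 b * ∣AGL∣ k) (sym (dec-false (isAffineSubspace? k A) ¬affine))))

  subspaces*∣AGL∣ : length affineSubspaces * ∣AGL∣ k ≡ 2 ^ n * ∑ (vectors (points n) k)
      (λ V → 𝟙 (does (linearlyIndependent? V)))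
  subspaces*∣AGL∣ = begin
    length affineSubspaces * ∣AGL∣ k
      ≡⟨ ∑-const affineSubspaces (∣AGL∣ k) ⟨
    ∑ affineSubspaces (λ _ → ∣AGL∣ k)
      ≡⟨ ∑-filter (isAffineSubspace? k) (functions n) _ ⟩
    ∑ (functions n) (λ A → 𝟙 (does (isAffineSubspace? k A)) * ∣AGL∣ k)
      ≡⟨ ∑-cong (functions n) parametrizations-of ⟨
    ∑ (functions n) (λ A → ∑ (frames n k) (λ φ → 𝟙 (does (parametrizes? φ A))))
      ≡⟨ ∑-swap (functions n) (frames n k) (λ A φ → 𝟙 (does (parametrizes? φ A))) ⟩
    ∑ (frames n k) (λ φ → ∑ (functions n) (λ A → 𝟙 (does (parametrizes? φ A))))
      ≡⟨ ∑-cong (frames n k) subspaces ⟩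
    ∑ (frames n k) (λ φ → 𝟙 (does (linearlyIndependent? (proj₂ φ))))
      ≡⟨ ∑-frames {n} {k} (λ V → 𝟙 (does (linearlyIndependent? V))) ⟩
    2 ^ n * ∑ (vectors (points n) k) (λ V → 𝟙 (does (linearlyIndependent? V))) ∎
    where open ≡-Reasoning

𝟙≤1 : ∀ b → 𝟙 b ≤ 1
𝟙≤1 false = z≤n
𝟙≤1 true  = ≤-refl

𝟙-imp : {P : Set ℓa} {Q : Set ℓb} (P? : Dec P) (Q? : Dec Q) → ∀ c → (P → Q → c ≡ true) →
        𝟙 (does P?) * 𝟙 (does Q?) ≤ 𝟙 c * 𝟙 (does Q?)
𝟙-imp (no _)  _       c imp = z≤n
𝟙-imp (yes _) (no _)  c imp = z≤n
𝟙-imp (yes p) (yes q) c imp rewrite imp p q = ≤-refl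

rejecting*∣AGL∣ : ∀ n d → length (filter (rejects? d (suc d) (S (suc d) n))
    (affineSubspaces n (suc d))) * ∣AGL∣ (suc d)
                  ≤ 2 ^ n * ∑ (vectors (points n) (suc d)) (𝟙 ∘ ω ∘ toList)
rejecting*∣AGL∣ n d = begin
  length (filter R? As) * ∣AGL∣ dim
    ≡⟨ ∑-const (filter R? As) (∣AGL∣ dim) ⟨
  ∑ (filter R? As) (λ _ → ∣AGL∣ dim)
    ≡⟨ trans (∑-filter R? As _) (∑-filter (isAffineSubspace? dim) (functions n) _) ⟩
  ∑ (functions n) (λ A → 𝟙 (does (isAffineSubspace? dim A)) * (𝟙 (does (R? A)) * ∣AGL∣ dim))
    ≡⟨ ∑-cong (functions n)
        (λ A → trans (comm (𝟙 (does (isAffineSubspace? dim A))) (𝟙 (does (R? A))) (∣AGL∣ dim))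
         (trans (cong (𝟙 (does (R? A)) *_) (sym (parametrizations-of n dim A)))
             (sym (∑-* (frames n dim) (𝟙 (does (R? A))) _)))) ⟩
  ∑ (functions n) (λ A → ∑ (frames n dim) (λ φ → 𝟙 (does (R? A)) * 𝟙 (does (parametrizes? φ A))))
    ≤⟨ ∑-mono (functions n)
        (λ A → ∑-mono (frames n dim) (λ φ → 𝟙-imp (R? A) (parametrizes? φ A)
        _ (λ rej φ-par → rejects⇒ω d rej φ φ-par))) ⟩
  ∑ (functions n) (λ A → ∑ (frames n dim) (λ φ → 𝟙 (ω (toList (proj₂ φ))) * 𝟙 (does (parametrizes? φ A))))
    ≡⟨ ∑-swap (functions n) (frames n dim) (λ A φ → 𝟙 (ω (toList (proj₂ φ))) * 𝟙 (does (parametrizes? φ A))) ⟩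
  ∑ (frames n dim) (λ φ → ∑ (functions n) (λ A → 𝟙 (ω (toList (proj₂ φ))) * 𝟙 (does (parametrizes? φ A))))
    ≡⟨ ∑-cong (frames n dim) (λ φ → trans (∑-* (functions n) (𝟙 (ω (toList (proj₂ φ)))) _)
        (cong (𝟙 (ω (toList (proj₂ φ))) *_) (subspaces φ))) ⟩
  ∑ (frames n dim) (λ φ → 𝟙 (ω (toList (proj₂ φ))) * 𝟙 (does (linearlyIndependent? (proj₂ φ))))
    ≤⟨ ∑-mono (frames n dim)
        (λ φ → ≤-trans (*-monoʳ-≤ (𝟙 (ω (toList (proj₂ φ)))) (𝟙≤1 (does (linearlyIndependent? (proj₂ φ)))))
        (≤-reflexive (*-identityʳ _))) ⟩
  ∑ (frames n dim) (λ φ → 𝟙 (ω (toList (proj₂ φ))))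
    ≡⟨ ∑-frames {n} {dim} (𝟙 ∘ ω ∘ toList) ⟩
  2 ^ n * ∑ (vectors (points n) dim) (𝟙 ∘ ω ∘ toList) ∎
  where
  open ≤-Reasoning
  dim = suc d
  As = affineSubspaces n dim
  R? : ∀ A → Dec (Rejects d dim (S dim n) A)
  R? = rejects? d dim (S dim n)
  comm : ∀ a b c → a * (b * c) ≡ b * (a * c)
  comm = solve-∀

compare-counts : ∀ r s G N M w i → NonZero N → NonZero M → r * G ≤ N * w → s * G ≡ N * i →
                 16 * w ≤ 7 * M → 15 * M ≤ 16 * i → 15 * r ≤ 7 * s
-- G is the order of the affine group, here a bare number. If it were 0, `sG≡Ni` would force i = 0,
-- against `15M≤16i`.
compare-counts r s zero N M w i N≢0 M≢0 rG≤Nw sG≡Ni 16w≤7M 15M≤16i = contradiction 15M≤16i (<⇒≱ (begin-strict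
  16 * i        ≡⟨ cong (16 *_) (m*n≡0⇒m≡0 i N {{N≢0}} (trans (*-comm i N) (trans (sym sG≡Ni) (*-zeroʳ s)))) ⟩
  0             <⟨ >-nonZero⁻¹ M {{M≢0}} ⟩
  M             ≤⟨ m≤m+n M (14 * M) ⟩
  15 * M        ∎))
  where open ≤-Reasoning
compare-counts r s G@(suc _) N M w i _ _ rG≤Nw sG≡Ni 16w≤7M 15M≤16i = *-cancelʳ-≤ (15 * r) (7 * s)
    G (*-cancelˡ-≤ 16 (begin
  16 * (15 * r * G)        ≡⟨ lemma₁ r G ⟩
  16 * (15 * (r * G))      ≤⟨ *-monoʳ-≤ 16 (*-monoʳ-≤ 15 rG≤Nw) ⟩
  16 * (15 * (N * w))      ≡⟨ lemma₂ N w ⟩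
  15 * (N * (16 * w))      ≤⟨ *-monoʳ-≤ 15 (*-monoʳ-≤ N 16w≤7M) ⟩
  15 * (N * (7 * M))       ≡⟨ lemma₃ N M ⟩
  7 * (N * (15 * M))       ≤⟨ *-monoʳ-≤ 7 (*-monoʳ-≤ N 15M≤16i) ⟩
  7 * (N * (16 * i))       ≡⟨ lemma₄ N i ⟩
  16 * (7 * (N * i))       ≡⟨ cong (λ j → 16 * (7 * j)) sG≡Ni ⟨
  16 * (7 * (s * G))       ≡⟨ lemma₅ s G ⟩
  16 * (7 * s * G)         ∎))
  where
  open ≤-Reasoning
  lemma₁ : ∀ r G → 16 * (15 * r * G) ≡ 16 * (15 * (r * G))
  lemma₁ = solve-∀
  lemma₂ : ∀ N w → 16 * (15 * (N * w)) ≡ 15 * (N * (16 * w))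
  lemma₂ = solve-∀
  lemma₃ : ∀ N M → 15 * (N * (7 * M)) ≡ 7 * (N * (15 * M))
  lemma₃ = solve-∀
  lemma₄ : ∀ N i → 7 * (N * (16 * i)) ≡ 16 * (7 * (N * i))
  lemma₄ = solve-∀
  lemma₅ : ∀ s G → 16 * (7 * (s * G)) ≡ 16 * (7 * s * G)
  lemma₅ = solve-∀

Rej-count : ∀ n d → 2 ≤ d → suc d + 4 ≤ n →
  15 * length (filter (rejects? d (suc d) (S (suc d) n)) (affineSubspaces n (suc d)))
      ≤ 7 * length (affineSubspaces n (suc d))
-- The dimension is 3 + e, which leaves e fixed vectors beside the three variable ones.
Rej-count n d@(suc (suc e)) (s≤s (s≤s _)) k+4≤n =
  compare-counts (length (filter (rejects? d (suc d) (S (suc d) n)) (affineSubspaces n (suc d))))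
      (length (affineSubspaces n (suc d)))
    (∣AGL∣ (suc d)) (2 ^ n) ((2 ^ n) ^ suc d)
    (∑ (vectors (points n) (suc d)) (𝟙 ∘ ω ∘ toList))
    (∑ (vectors (points n) (suc d)) (λ V → 𝟙 (does (linearlyIndependent? V))))
    (m^n≢0 2 n) (m^n≢0 (2 ^ n) (suc d) {{m^n≢0 2 n}})
    (rejecting*∣AGL∣ n d) (subspaces*∣AGL∣ n (suc d)) (ω-count n e) (independent-count n (suc d) k+4≤n)


Rej-bound : ∀ n d → 2 ≤ d → suc d + 4 ≤ n → Rej d (suc d) (S (suc d) n) ℚ.≤ ½ ℚ.- + 1 / (2 ^ 7)
Rej-bound n d 2≤d k+4≤n = Pr≤ (rejects? d (suc d) (S (suc d) n)) (affineSubspaces n (suc d))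
    (Rej-count n d 2≤d k+4≤n)

≤-+-positive : ∀ {p q ε} → 0ℚ ℚ.< ε → p ℚ.≤ q → p ℚ.≤ q ℚ.+ ε
≤-+-positive {p} {q} {ε} ε>0 p≤q = begin
  p            ≤⟨ p≤q ⟩
  q            ≡⟨ ℚ.+-identityʳ q ⟨
  q ℚ.+ 0ℚ     ≤⟨ ℚ.+-monoʳ-≤ q (ℚ.<⇒≤ ε>0) ⟩
  q ℚ.+ ε      ∎
  where open ℚ.≤-Reasoning

theorem24 : (d t : ℕ) → 2 ≤ t → d + 1 ≡ 2 ^ t →
    (ε : ℚ) → 0ℚ ℚ.< ε →
    ∃ λ (n₀ : ℕ) → (n : ℕ) → n₀ ≤ n →
    (δ d (S (d + 1) n) ℚ.≥ ½ ℚ.- ε)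
    × (Rej d (d + 1) (S (d + 1) n) ℚ.≤ ½ ℚ.- + 1 / (2 ^ 7) ℚ.+ ε)
theorem24 d t 2≤t d+1≡2^t ε ε>0 with δ-bound d t 2≤t d+1≡2^t ε ε>0
-- The summand `suc d + 4` makes dependent tuples at most a 1/16 of all tuples, as 2^-4 = 1/16.
... | N , δ≥ = N + (suc d + 4) , λ n n₀≤n →
  δ≥ n (≤-trans (m≤m+n N (suc d + 4)) n₀≤n) ,
  ≤-+-positive ε>0
    (subst (λ k → Rej d k (S k n) ℚ.≤ ½ ℚ.- + 1 / (2 ^ 7)) (+-comm 1 d)
      (Rej-bound n d 2≤d (≤-trans (m≤n+m (suc d + 4) N) n₀≤n)))
  where
  2≤d : 2 ≤ d
  2≤d = +-cancelˡ-≤ 1 2 d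
      (≤-trans (n≤1+n 3) (≤-trans (^-monoʳ-≤ 2 2≤t) (≤-reflexive (trans (sym d+1≡2^t) (+-comm d 1)))))
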